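{- Let $n$ be a positive integer and let $w\in S_n$ be a $321$-avoiding permutation, with associated flagging $f(w)=(f_1,\dots,f_r)$ and associated skew partition $\sigma(w)=\lambda/\mu$. Then the double Grothendieck polynomial $\mathfrak{G}_w(x,b)$ satisfies \[ \mathfrak{G}_{w}(x,b) = \sum_{T\in SVT(\sigma(w),f(w))} \beta^{|T|-|\sigma(w)|} \prod_{e\in T} \left(x_{val(e)} \oplus b_{\lambda_{r(e)} + f_{r(e)} - c(e) - val(e) +1}\right). \]
   Context: Notation: $x=(x_1,\dots,x_n)$ and $b=(b_1,\dots,b_n)$ are two sets of variables, $\beta$ is a formal variable, and all polynomials lie in $\mathbb{Z}[\beta][x,b]$. For $u,v$ put $u\oplus v:=u+v+\beta uv$. Double Grothendieck polynomials: $S_n$ is the group of permutations of $\{1,\dots,n\}$, with $s_i=(i,i+1)$ for $1\le i\le n-1$; products are compositions, so $(ws_i)(j)=w(s_i(j))$. $\ell(w)$ is the Coxeter length. $S_n$ acts on $\mathbb{Z}[\beta][x,b]$ by permuting the indices of the $x$-variables (fixing the $b$-variables). The divided difference operator is \[ \pi_i(g)=\frac{(1+\beta x_{i+1})g-(1+\beta x_i)\,s_i g}{x_i-x_{i+1}}. \] For the longest element $w_0\in S_n$ put $\mathfrak{G}_{w_0}=\prod_{i+j\le n}(x_i\oplus b_j)$ (product over positive integers $i,j$). For $w\neq w_0$ choose $i$ with $\ell(ws_i)=\ell(w)+1$ and set $\mathfrak{G}_w:=\pi_i(\mathfrak{G}_{ws_i})$; this is independent of the choice, since the $\pi_i$ satisfy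 the braid and commutation relations. $321$-avoiding permutations: $w\in S_n$ is $321$-avoiding if there are no $i<j<k$ with $w(i)>w(j)>w(k)$. For such $w$, let $f(w)=(f_1,\dots,f_r)$ be the increasing sequence of all indices $i$ with $w(i)>i$ (then $w(f_1)<\cdots<w(f_r)$). Define, for $i=1,\dots,r$, \[ \lambda_i=w(f_r)-r-(f_i-i),\qquad \mu_i=w(f_r)-r-(w(f_i)-i), \] and $\sigma(w)=\lambda/\mu$. (If $w$ is the identity then $r=0$, $\sigma(w)$ is the empty shape, and there is a single, empty, tableau.) Tableaux: for partitions $\lambda=(\lambda_1\ge\cdots\ge\lambda_r>0)$ and $\mu=(\mu_1\ge\cdots\ge\mu_r\ge0)$ with $\mu_i\le\lambda_i$, the skew partition $\lambda/\mu$ is identified with the set of boxes $\{(i,j): 1\le i\le r,\ \mu_i<j\le\lambda_i\}$ ($i$ is the row index, increasing from top to bottom, and $j$ the column index, increasing from left to right); $|\lambda/\mu|$ is the number of boxes. For nonempty finite sets $A,B$ of positive integers write $A<B$ if $\max A<\min B$ and $A\le B$ if $\max A\le\min B$. A set-valued tableau of shape $\lambda/\mu$ assigns to each box a nonempty finite set of positive integers so that rows are weakly increasing ($\le$) from left to right and columns are strictly increasing ($<$) from top to bottom. For a flagging $f=(f_1\le\cdots\le f_r)$ of positive integers, $SVT(\lambda/\mu,f)$ is the set of set-valued tableaux of shape $\lambda/\mu$ such that each set in row $i$ is a subset of $\{1,\dots,f_i\}$, for all $i$. An entry $e\in T$ is an element of the set assigned to one of the boxes; $val(e)$ is its value, and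 $r(e)$, $c(e)$ are the row and column indices of its box. $|T|$ is the total number of entries of $T$. -}

module Defs where

open import Algebra.Bundles using (CommutativeRing)
import Algebra.Properties.CommutativeMonoid.Sum as Sum
import Algebra.Properties.Ring as RingProperties
import Algebra.Properties.Semiring.Exp as Exp
import Algebra.Solver.Ring.NaturalCoefficients.Default as Solver
open import Data.Bool.Base using (if_then_else_)
open import Data.Fin.Base as Fin using (Fin; zero; suc; toℕ; fromℕ; fromℕ<; inject₁; opposite)
open import Data.Fin.Induction using (<-weakInduction; >-weakInduction)
import Data.Fin.Properties as Fin
open import Data.Fin.Permutation as Perm
  using (Permutation′; _⟨$⟩ʳ_; _∘ₚ_; transpose; reverse)
open import Data.Fin.Subset using (Subset; inside; outside; _∈_; Nonempty)
open import Data.Fin.Subset.Properties using (_∈?_; nonempty?)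
open import Data.List.Base
  using (List; []; _∷_; [_]; _++_; map; concatMap; filter; foldr; foldl; length; last; lookup;
         allFin; cartesianProduct; cartesianProductWith)
open import Data.List.Extrema.Nat using (max; min)
open import Data.List.Membership.Propositional.Properties using (∈-filter⁻; ∈-lookup)
import Data.List.Properties as List
open import Data.Maybe.Base using (maybe′; nothing)
open import Data.Nat.Base using (ℕ; zero; suc; _+_; _*_; _∸_; _≤_; _<_; z≤n; s≤s)
import Data.Nat.Properties as ℕ
open import Data.Product.Base using (Σ; ∃; _×_; _,_; proj₁; proj₂)
open import Data.Sum.Base using (_⊎_; inj₁; inj₂)
open import Data.Vec.Base as Vec using (Vec)
open import Function.Base using (_∘_; case_of_)
open import Level using (0ℓ)
open import Relation.Binary.Definitions using (tri<; tri≈; tri>)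
open import Relation.Binary.PropositionalEquality
  using (_≡_; _≢_; refl; sym; trans; cong; cong₂; subst; subst₂; module ≡-Reasoning)
open import Relation.Nullary using (¬_; Dec; yes; no; does; contradiction)
open import Relation.Nullary.Decidable using (_×-dec_; _→-dec_; dec-true; dec-false)

------------------------------------------------------------------------
-- The ring ℤ[β][x₁,…,xₙ,b₁,…,bₙ], as the free commutative ring on its
-- variables: ring expressions modulo the commutative ring axioms.  The
-- element i of Fin n stands for the index i + 1.

infix  8 -ᴾ_
infixl 7 _*ᴾ_
infixl 6 _+ᴾ_
infix  4 _≈ᴾ_

data Poly (n : ℕ) : Set where
  β     : Poly n
  x b   : Fin n → Poly n
  0ᴾ 1ᴾ : Poly n
  _+ᴾ_  : Poly n → Poly n → Poly n
  _*ᴾ_  : Poly n → Poly n → Poly n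
  -ᴾ_   : Poly n → Poly n

data _≈ᴾ_ {n : ℕ} : Poly n → Poly n → Set where
  ≈-refl      : ∀ {p} → p ≈ᴾ p
  ≈-sym       : ∀ {p q} → p ≈ᴾ q → q ≈ᴾ p
  ≈-trans     : ∀ {p q r} → p ≈ᴾ q → q ≈ᴾ r → p ≈ᴾ r
  +-cong      : ∀ {p p′ q q′} → p ≈ᴾ p′ → q ≈ᴾ q′ → p +ᴾ q ≈ᴾ p′ +ᴾ q′
  *-cong      : ∀ {p p′ q q′} → p ≈ᴾ p′ → q ≈ᴾ q′ → p *ᴾ q ≈ᴾ p′ *ᴾ q′
  neg-cong    : ∀ {p p′} → p ≈ᴾ p′ → -ᴾ p ≈ᴾ -ᴾ p′
  +-assoc     : ∀ p q r → (p +ᴾ q) +ᴾ r ≈ᴾ p +ᴾ (q +ᴾ r)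
  +-comm      : ∀ p q → p +ᴾ q ≈ᴾ q +ᴾ p
  +-identityˡ : ∀ p → 0ᴾ +ᴾ p ≈ᴾ p
  +-inverseˡ  : ∀ p → -ᴾ p +ᴾ p ≈ᴾ 0ᴾ
  *-assoc     : ∀ p q r → (p *ᴾ q) *ᴾ r ≈ᴾ p *ᴾ (q *ᴾ r)
  *-comm      : ∀ p q → p *ᴾ q ≈ᴾ q *ᴾ p
  *-identityˡ : ∀ p → 1ᴾ *ᴾ p ≈ᴾ p
  distribˡ    : ∀ p q r → p *ᴾ (q +ᴾ r) ≈ᴾ p *ᴾ q +ᴾ p *ᴾ r

polyRing : ℕ → CommutativeRing 0ℓ 0ℓ
polyRing n = record
  { Carrier = Poly n ; _≈_ = _≈ᴾ_ ; _+_ = _+ᴾ_ ; _*_ = _*ᴾ_ ; -_ = -ᴾ_ ; 0# = 0ᴾ ; 1# = 1ᴾ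
  ; isCommutativeRing = record
    { isRing = record
      { +-isAbelianGroup = record
        { isGroup = record
          { isMonoid = record
            { isSemigroup = record
              { isMagma = record
                { isEquivalence = record { refl = ≈-refl ; sym = ≈-sym ; trans = ≈-trans }
                ; ∙-cong = +-cong
                }
              ; assoc = +-assoc
              }
            ; identity = +-identityˡ , λ p → ≈-trans (+-comm p 0ᴾ) (+-identityˡ p)
            }
          ; inverse = +-inverseˡ , λ p → ≈-trans (+-comm p (-ᴾ p)) (+-inverseˡ p)
          ; ⁻¹-cong = neg-cong
          }
        ; comm = +-comm
        }
      ; *-cong = *-cong
      ; *-assoc = *-assoc
      ; *-identity = *-identityˡ , λ p → ≈-trans (*-comm p 1ᴾ) (*-identityˡ p)
      ; distrib = distribˡ , λ p q r → ≈-trans (*-comm (q +ᴾ r) p)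
          (≈-trans (distribˡ p q r) (+-cong (*-comm p q) (*-comm p r)))
      }
    ; *-comm = *-comm
    }
  }

module _ {n : ℕ} where

  open Exp (CommutativeRing.semiring (polyRing n)) public using () renaming (_^_ to _^ᴾ_)

  infixl 6 _-ᴾ_ _⊕_

  _-ᴾ_ : Poly n → Poly n → Poly n
  p -ᴾ q = p +ᴾ -ᴾ q

  _⊕_ : Poly n → Poly n → Poly n
  u ⊕ v = u +ᴾ v +ᴾ β *ᴾ u *ᴾ v

  ∑ ∏ : {A : Set} → List A → (A → Poly n) → Poly n
  ∑ as f = foldr (λ a p → f a +ᴾ p) 0ᴾ as
  ∏ as f = foldr (λ a p → f a *ᴾ p) 1ᴾ as

-- The universal property.
module Evaluation {c ℓ} {n : ℕ} (R : CommutativeRing c ℓ)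
  (β̂ : CommutativeRing.Carrier R) (x̂ b̂ : Fin n → CommutativeRing.Carrier R) where

  private
    module R = CommutativeRing R

  eval : Poly n → R.Carrier
  eval β        = β̂
  eval (x i)    = x̂ i
  eval (b i)    = b̂ i
  eval 0ᴾ       = R.0#
  eval 1ᴾ       = R.1#
  eval (p +ᴾ q) = eval p R.+ eval q
  eval (p *ᴾ q) = eval p R.* eval q
  eval (-ᴾ p)   = R.- eval p

  eval-cong : ∀ {p q} → p ≈ᴾ q → eval p R.≈ eval q
  eval-cong ≈-refl            = R.refl
  eval-cong (≈-sym e)         = R.sym (eval-cong e)
  eval-cong (≈-trans e e′)    = R.trans (eval-cong e) (eval-cong e′)
  eval-cong (+-cong e e′)     = R.+-cong (eval-cong e) (eval-cong e′)
  eval-cong (*-cong e e′)     = R.*-cong (eval-cong e) (eval-cong e′)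
  eval-cong (neg-cong e)      = R.-‿cong (eval-cong e)
  eval-cong (+-assoc p q r)   = R.+-assoc _ _ _
  eval-cong (+-comm p q)      = R.+-comm _ _
  eval-cong (+-identityˡ p)   = R.+-identityˡ _
  eval-cong (+-inverseˡ p)    = R.-‿inverseˡ _
  eval-cong (*-assoc p q r)   = R.*-assoc _ _ _
  eval-cong (*-comm p q)      = R.*-comm _ _
  eval-cong (*-identityˡ p)   = R.*-identityˡ _
  eval-cong (distribˡ p q r)  = R.distribˡ _ _ _

-- Substitution for the x-variables, fixing β and the b-variables.
substX : ∀ {n} → (Fin n → Poly n) → Poly n → Poly n
substX {n} ρ = Evaluation.eval (polyRing n) β ρ b

substX-cong : ∀ {n} (ρ : Fin n → Poly n) {p q} → p ≈ᴾ q → substX ρ p ≈ᴾ substX ρ q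
substX-cong {n} ρ = Evaluation.eval-cong (polyRing n) β ρ b

permuteX : ∀ {n} → Permutation′ n → Poly n → Poly n
permuteX w = substX (λ i → x (w ⟨$⟩ʳ i))

------------------------------------------------------------------------
-- Division by xᵢ - xⱼ

module Division {n : ℕ} (i j : Fin n) where

  merge : Poly n → Poly n
  merge = substX (λ k → if does (k Fin.≟ i) then x j else x k)

  -- The quotient of g - merge g, hence of g itself when g is divisible.
  -- On products it is the twisted Leibniz rule
  -- pq - p′q′ = (p - p′) q + p′ (q - q′), where ′ is merge.
  quotient : Poly n → Poly n
  quotient β        = 0ᴾ
  quotient (x k)    = if does (k Fin.≟ i) then 1ᴾ else 0ᴾ
  quotient (b k)    = 0ᴾ
  quotient 0ᴾ       = 0ᴾ
  quotient 1ᴾ       = 0ᴾ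
  quotient (p +ᴾ q) = quotient p +ᴾ quotient q
  quotient (p *ᴾ q) = quotient p *ᴾ q +ᴾ merge p *ᴾ quotient q
  quotient (-ᴾ p)   = -ᴾ quotient p

  private
    module R = CommutativeRing (polyRing n)
    module P = RingProperties R.ring

    open Solver R.commutativeSemiring using (solve; _:+_; _:*_; _:=_; con)

    d : Poly n
    d = x i -ᴾ x j

  quotient-merge : ∀ p → p ≈ᴾ merge p +ᴾ (x i -ᴾ x j) *ᴾ quotient p
  quotient-merge β = solve 2 (λ p d → p := p :+ d :* con 0) ≈-refl β d
  quotient-merge (x k) with k Fin.≟ i
  ... | yes refl = ≈-sym (≈-trans (+-cong ≈-refl (R.*-identityʳ d))
                   (≈-trans (solve 3 (λ u v w → u :+ (v :+ w) := v :+ (u :+ w)) ≈-refl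
                                     (x j) (x i) (-ᴾ x j))
                   (≈-trans (+-cong ≈-refl (R.-‿inverseʳ _)) (R.+-identityʳ _))))
  ... | no  _    = solve 2 (λ p d → p := p :+ d :* con 0) ≈-refl (x k) d
  quotient-merge (b k) = solve 2 (λ p d → p := p :+ d :* con 0) ≈-refl (b k) d
  quotient-merge 0ᴾ = solve 2 (λ p d → p := p :+ d :* con 0) ≈-refl 0ᴾ d
  quotient-merge 1ᴾ = solve 2 (λ p d → p := p :+ d :* con 0) ≈-refl 1ᴾ d
  quotient-merge (p +ᴾ q) = ≈-trans (+-cong (quotient-merge p) (quotient-merge q))
    (solve 5 (λ p′ q′ d p° q° →
        (p′ :+ d :* p°) :+ (q′ :+ d :* q°) := (p′ :+ q′) :+ d :* (p° :+ q°))
      ≈-refl (merge p) (merge q) d (quotient p) (quotient q))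
  quotient-merge (p *ᴾ q) = ≈-trans (*-cong (quotient-merge p) (quotient-merge q))
    (≈-trans
      (solve 5 (λ p′ q′ d p° q° →
          (p′ :+ d :* p°) :* (q′ :+ d :* q°) :=
          p′ :* q′ :+ d :* (p° :* (q′ :+ d :* q°) :+ p′ :* q°))
        ≈-refl (merge p) (merge q) d (quotient p) (quotient q))
      (+-cong ≈-refl (*-cong ≈-refl
        (+-cong (*-cong ≈-refl (≈-sym (quotient-merge q))) ≈-refl))))
  quotient-merge (-ᴾ p) = ≈-trans (neg-cong (quotient-merge p))
    (≈-trans (≈-sym (P.-‿+-comm _ _)) (+-cong ≈-refl (P.-‿distribʳ-* _ _)))

  quotient-cong : ∀ {p q} → p ≈ᴾ q → quotient p ≈ᴾ quotient q
  quotient-cong ≈-refl         = ≈-refl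
  quotient-cong (≈-sym e)      = ≈-sym (quotient-cong e)
  quotient-cong (≈-trans e e′) = ≈-trans (quotient-cong e) (quotient-cong e′)
  quotient-cong (+-cong e e′)  = +-cong (quotient-cong e) (quotient-cong e′)
  quotient-cong (*-cong e e′)  =
    +-cong (*-cong (quotient-cong e) e′) (*-cong (substX-cong _ e) (quotient-cong e′))
  quotient-cong (neg-cong e)     = neg-cong (quotient-cong e)
  quotient-cong (+-assoc p q r)  = +-assoc _ _ _
  quotient-cong (+-comm p q)     = +-comm _ _
  quotient-cong (+-identityˡ p)  = +-identityˡ _
  quotient-cong (+-inverseˡ p)   = +-inverseˡ _
  quotient-cong (*-assoc p q r)  =
    solve 7 (λ p′ q′ q r p° q° r° →
        (p° :* q :+ p′ :* q°) :* r :+ (p′ :* q′) :* r° :=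
        p° :* (q :* r) :+ p′ :* (q° :* r :+ q′ :* r°))
      ≈-refl (merge p) (merge q) q r (quotient p) (quotient q) (quotient r)
  quotient-cong (*-comm p q) = ≈-trans
    (+-cong (*-cong ≈-refl (quotient-merge q)) ≈-refl)
    (≈-trans
      (solve 5 (λ p′ q′ d p° q° →
          p° :* (q′ :+ d :* q°) :+ p′ :* q° := q° :* (p′ :+ d :* p°) :+ q′ :* p°)
        ≈-refl (merge p) (merge q) d (quotient p) (quotient q))
      (+-cong (*-cong ≈-refl (≈-sym (quotient-merge p))) ≈-refl))
  quotient-cong (*-identityˡ p)  =
    solve 2 (λ p p° → con 0 :* p :+ con 1 :* p° := p°) ≈-refl p (quotient p)
  quotient-cong (distribˡ p q r) =
    solve 6 (λ p° p′ q q° r r° →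
        p° :* (q :+ r) :+ p′ :* (q° :+ r°) := (p° :* q :+ p′ :* q°) :+ (p° :* r :+ p′ :* r°))
      ≈-refl (quotient p) (merge p) q (quotient q) r (quotient r)

  quotient-exact : i ≢ j → ∀ {p} q → p ≈ᴾ (x i -ᴾ x j) *ᴾ q → quotient p ≈ᴾ q
  quotient-exact i≢j q e with quotient-cong e
  ... | e′ rewrite dec-true (i Fin.≟ i) refl | dec-false (j Fin.≟ i) (i≢j ∘ sym) =
    ≈-trans e′ (≈-trans
      (+-cong (*-cong (≈-trans (+-cong ≈-refl P.-0#≈0#) (R.+-identityʳ _)) ≈-refl)
              (*-cong (R.-‿inverseʳ _) ≈-refl))
      (solve 2 (λ q q° → con 1 :* q :+ con 0 :* q° := q) ≈-refl q (quotient q)))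

------------------------------------------------------------------------
-- Permutations

infixl 7 _·_

_·_ : ∀ {n} → Permutation′ n → Permutation′ n → Permutation′ n
u · v = v ∘ₚ u

s : ∀ {m} → Fin m → Permutation′ (suc m)
s i = transpose (inject₁ i) (suc i)

private
  module ℕΣ = Sum ℕ.+-0-commutativeMonoid

𝟙 : ∀ {P : Set} → Dec P → ℕ
𝟙 P? = if does P? then 1 else 0

Inversion : ∀ {n} → Permutation′ n → Fin n → Fin n → Set
Inversion w i j = i Fin.< j × (w ⟨$⟩ʳ j) Fin.< (w ⟨$⟩ʳ i)

inversion? : ∀ {n} (w : Permutation′ n) i j → Dec (Inversion w i j)
inversion? w i j = (i Fin.<? j) ×-dec ((w ⟨$⟩ʳ j) Fin.<? (w ⟨$⟩ʳ i))

ℓ : ∀ {n} → Permutation′ n → ℕ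
ℓ w = ℕΣ.sum λ i → ℕΣ.sum λ j → 𝟙 (inversion? w i j)

Avoids321 : ∀ {n} → Permutation′ n → Set
Avoids321 w = ∀ i j k → i Fin.< j → j Fin.< k →
              ¬ ((w ⟨$⟩ʳ j) Fin.< (w ⟨$⟩ʳ i) × (w ⟨$⟩ʳ k) Fin.< (w ⟨$⟩ʳ j))

wordProduct : ∀ {m} → List (Fin m) → Permutation′ (suc m)
wordProduct = foldl (λ u i → u · s i) Perm.id

-- ℓ, the number of inversions, is the Coxeter length (ℓ-isCoxeterLength below).
IsCoxeterLength : ∀ {m} → Permutation′ (suc m) → ℕ → Set
IsCoxeterLength w k = (∃ λ is → wordProduct is Perm.≈ w × length is ≡ k)
                    × (∀ is → wordProduct is Perm.≈ w → k ≤ length is)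

module Inversions where

  𝟙-yes : ∀ {P : Set} (P? : Dec P) → P → 𝟙 P? ≡ 1
  𝟙-yes P? p rewrite dec-true P? p = refl

  𝟙-no : ∀ {P : Set} (P? : Dec P) → ¬ P → 𝟙 P? ≡ 0
  𝟙-no P? ¬p rewrite dec-false P? ¬p = refl

  𝟙-⇔ : ∀ {P Q : Set} (P? : Dec P) (Q? : Dec Q) → (P → Q) → (Q → P) → 𝟙 P? ≡ 𝟙 Q?
  𝟙-⇔ P? (yes q) f g = 𝟙-yes P? (g q)
  𝟙-⇔ P? (no ¬q) f g = 𝟙-no P? (¬q ∘ f)

  𝟙≤1 : ∀ {P : Set} (P? : Dec P) → 𝟙 P? ≤ 1
  𝟙≤1 (yes _) = ℕ.≤-refl
  𝟙≤1 (no _)  = z≤n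

  ∑∑ : ∀ {n} → (Fin n → Fin n → ℕ) → ℕ
  ∑∑ f = ℕΣ.sum λ i → ℕΣ.sum λ j → f i j

  ∑∑-cong : ∀ {n} {f g : Fin n → Fin n → ℕ} → (∀ i j → f i j ≡ g i j) → ∑∑ f ≡ ∑∑ g
  ∑∑-cong e = ℕΣ.sum-cong-≗ (λ i → ℕΣ.sum-cong-≗ (e i))

  sum-≤ : ∀ {n c} (f : Fin n → ℕ) → (∀ i → f i ≤ c) → ℕΣ.sum f ≤ n * c
  sum-≤ {zero}  f h = z≤n
  sum-≤ {suc n} f h = ℕ.+-mono-≤ (h zero) (sum-≤ (f ∘ suc) (h ∘ suc))

  sum-0 : ∀ {n} (f : Fin n → ℕ) → (∀ i → f i ≡ 0) → ℕΣ.sum f ≡ 0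
  sum-0 {n} f h = trans (ℕΣ.sum-cong-≗ h) (ℕΣ.sum-replicate-zero n)

  sum-δ : ∀ {n} (f : Fin n → ℕ) k → (∀ i → i ≢ k → f i ≡ 0) → ℕΣ.sum f ≡ f k
  sum-δ f zero h =
    trans (cong (f zero +_) (sum-0 (f ∘ suc) (λ i → h (suc i) λ ()))) (ℕ.+-identityʳ _)
  sum-δ f (suc k) h = cong₂ _+_ (h zero λ ())
    (sum-δ (f ∘ suc) k (λ i i≢k → h (suc i) (i≢k ∘ Fin.suc-injective)))

  ℓ-bound : ∀ {n} (w : Permutation′ n) → ℓ w ≤ n * (n * 1)
  ℓ-bound w = sum-≤ (λ i → ℕΣ.sum λ j → 𝟙 (inversion? w i j))
    (λ i → sum-≤ (λ j → 𝟙 (inversion? w i j)) (λ j → 𝟙≤1 (inversion? w i j)))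

  ℓ-cong : ∀ {n} {u v : Permutation′ n} → u Perm.≈ v → ℓ u ≡ ℓ v
  ℓ-cong e = ∑∑-cong (λ i j → cong₂ (λ a c → 𝟙 ((i Fin.<? j) ×-dec (a Fin.<? c))) (e j) (e i))

  ℓ-id : ∀ {n} → ℓ (Perm.id {n}) ≡ 0
  ℓ-id {n} = sum-0 {n} _ λ i → sum-0 (λ j → 𝟙 (inversion? Perm.id i j)) λ j →
    𝟙-no (inversion? Perm.id i j) λ (i<j , j<i) → ℕ.<-asym i<j j<i

  module _ {m} (k : Fin m) where

    private
      p q : Fin (suc m)
      p = inject₁ k
      q = suc k

    p<q : p Fin.< q
    p<q = s≤s (ℕ.≤-reflexive (Fin.toℕ-inject₁ k))

    p≢q : p ≢ q
    p≢q e = ℕ.<-irrefl (cong toℕ e) p<q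

    s-p : s k ⟨$⟩ʳ p ≡ q
    s-p rewrite dec-true (p Fin.≟ p) refl = refl

    s-q : s k ⟨$⟩ʳ q ≡ p
    s-q rewrite dec-false (q Fin.≟ p) (p≢q ∘ sym) | dec-true (q Fin.≟ q) refl = refl

    s-other : ∀ {i} → i ≢ p → i ≢ q → s k ⟨$⟩ʳ i ≡ i
    s-other {i} i≢p i≢q rewrite dec-false (i Fin.≟ p) i≢p | dec-false (i Fin.≟ q) i≢q = refl

    s-cases : ∀ i → (i ≡ p × s k ⟨$⟩ʳ i ≡ q) ⊎ (i ≡ q × s k ⟨$⟩ʳ i ≡ p)
                  ⊎ (i ≢ p × i ≢ q × s k ⟨$⟩ʳ i ≡ i)
    s-cases i with i Fin.≟ p
    ... | yes refl = inj₁ (refl , refl)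
    ... | no i≢p with i Fin.≟ q
    ...   | yes refl = inj₂ (inj₁ (refl , refl))
    ...   | no i≢q   = inj₂ (inj₂ (i≢p , i≢q , refl))

    s-involutive : ∀ i → s k ⟨$⟩ʳ (s k ⟨$⟩ʳ i) ≡ i
    s-involutive i with s-cases i
    ... | inj₁ (refl , e)              = trans (cong (s k ⟨$⟩ʳ_) e) s-q
    ... | inj₂ (inj₁ (refl , e))       = trans (cong (s k ⟨$⟩ʳ_) e) s-p
    ... | inj₂ (inj₂ (_ , _ , e))      = trans (cong (s k ⟨$⟩ʳ_) e) e

    private
      ≢⇒toℕ≢ : ∀ {i j : Fin (suc m)} → i ≢ j → toℕ i ≢ toℕ j
      ≢⇒toℕ≢ i≢j e = i≢j (Fin.toℕ-injective e)

      toℕ-p : toℕ p ≡ toℕ k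
      toℕ-p = Fin.toℕ-inject₁ k

      above : ∀ {j} → p Fin.< j → j ≢ q → q Fin.< j
      above p<j j≢q =
        ℕ.≤∧≢⇒< (subst (λ a → suc a ≤ _) toℕ-p p<j) (≢⇒toℕ≢ (j≢q ∘ sym))

      below : ∀ {i} → i Fin.< q → i ≢ p → i Fin.< p
      below i<q i≢p =
        ℕ.≤∧≢⇒< (subst (_ ≤_) (sym toℕ-p) (ℕ.≤-pred i<q)) (≢⇒toℕ≢ i≢p)

    s-mono : ∀ {i j} → ¬ (i ≡ p × j ≡ q) → i Fin.< j → (s k ⟨$⟩ʳ i) Fin.< (s k ⟨$⟩ʳ j)
    s-mono {i} {j} ne i<j with s-cases i | s-cases j
    ... | inj₁ (refl , _)  | inj₁ (refl , _) = contradiction i<j (ℕ.<-irrefl refl)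
    ... | inj₁ (refl , _)  | inj₂ (inj₁ (refl , _)) = contradiction (refl , refl) ne
    ... | inj₁ (refl , e)  | inj₂ (inj₂ (_ , j≢q , f)) rewrite e | f = above i<j j≢q
    ... | inj₂ (inj₁ (refl , _)) | inj₁ (refl , _) = contradiction i<j (ℕ.<-asym p<q)
    ... | inj₂ (inj₁ (refl , _)) | inj₂ (inj₁ (refl , _)) = contradiction i<j (ℕ.<-irrefl refl)
    ... | inj₂ (inj₁ (refl , e)) | inj₂ (inj₂ (_ , _ , f)) rewrite e | f = ℕ.<-trans p<q i<j
    ... | inj₂ (inj₂ (_ , _ , e)) | inj₁ (refl , f) rewrite e | f = ℕ.<-trans i<j p<q
    ... | inj₂ (inj₂ (i≢p , _ , e)) | inj₂ (inj₁ (refl , f)) rewrite e | f = below i<j i≢p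
    ... | inj₂ (inj₂ (_ , _ , e)) | inj₂ (inj₂ (_ , _ , f)) rewrite e | f = i<j

    s-mono⁻ : ∀ {i j} → ¬ (i ≡ q × j ≡ p) → (s k ⟨$⟩ʳ i) Fin.< (s k ⟨$⟩ʳ j) → i Fin.< j
    s-mono⁻ {i} {j} ne si<sj =
      subst (Fin._< j) (s-involutive i) (subst (_ Fin.<_) (s-involutive j) (s-mono ne′ si<sj))
      where
      ne′ : ¬ (s k ⟨$⟩ʳ i ≡ p × s k ⟨$⟩ʳ j ≡ q)
      ne′ (e , f) = ne ( trans (sym (s-involutive i)) (trans (cong (s k ⟨$⟩ʳ_) e) s-p)
                       , trans (sym (s-involutive j)) (trans (cong (s k ⟨$⟩ʳ_) f) s-q))

    ℓ-ascent : ∀ (w : Permutation′ (suc m)) → (w ⟨$⟩ʳ p) Fin.< (w ⟨$⟩ʳ q) →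
               ℓ (w · s k) ≡ suc (ℓ w)
    ℓ-ascent w wp<wq = begin
      ∑∑ (λ i j → 𝟙 (inversion? (w · s k) i j))
        ≡⟨ ∑∑-cong (λ i j → cong₂ (λ a c → 𝟙 ((a Fin.<? c) ×-dec
             ((w ⟨$⟩ʳ (s k ⟨$⟩ʳ j)) Fin.<? (w ⟨$⟩ʳ (s k ⟨$⟩ʳ i)))))
             (sym (s-involutive i)) (sym (s-involutive j))) ⟩
      ∑∑ (λ i j → G (s k ⟨$⟩ʳ i) (s k ⟨$⟩ʳ j))
        ≡⟨ ℕΣ.sum-cong-≗ (λ i → ℕΣ.sum-permute (G (s k ⟨$⟩ʳ i)) (s k)) ⟨
      ℕΣ.sum (λ i → ℕΣ.sum (G (s k ⟨$⟩ʳ i)))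
        ≡⟨ ℕΣ.sum-permute (λ i → ℕΣ.sum (G i)) (s k) ⟨
      ∑∑ G
        ≡⟨ ∑∑-cong pointwise ⟩
      ∑∑ (λ i j → Δ i j + 𝟙 (inversion? w i j))
        ≡⟨ ℕΣ.sum-cong-≗ (λ i → ℕΣ.∑-distrib-+ (Δ i) (λ j → 𝟙 (inversion? w i j))) ⟩
      ℕΣ.sum (λ i → ℕΣ.sum (Δ i) + ℕΣ.sum (λ j → 𝟙 (inversion? w i j)))
        ≡⟨ ℕΣ.∑-distrib-+ (λ i → ℕΣ.sum (Δ i)) (λ i → ℕΣ.sum (λ j → 𝟙 (inversion? w i j))) ⟩
      ∑∑ Δ + ℓ w
        ≡⟨ cong (_+ ℓ w) ∑∑Δ ⟩
      suc (ℓ w) ∎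
      where
      open ≡-Reasoning

      G? : ∀ i j → Dec ((s k ⟨$⟩ʳ i) Fin.< (s k ⟨$⟩ʳ j) × (w ⟨$⟩ʳ j) Fin.< (w ⟨$⟩ʳ i))
      G? i j = ((s k ⟨$⟩ʳ i) Fin.<? (s k ⟨$⟩ʳ j)) ×-dec ((w ⟨$⟩ʳ j) Fin.<? (w ⟨$⟩ʳ i))

      G Δ : Fin (suc m) → Fin (suc m) → ℕ
      G i j = 𝟙 (G? i j)
      Δ i j = 𝟙 ((i Fin.≟ q) ×-dec (j Fin.≟ p))

      pointwise : ∀ i j → G i j ≡ Δ i j + 𝟙 (inversion? w i j)
      pointwise i j = case (i Fin.≟ q) ×-dec (j Fin.≟ p) of λ where
        (yes (refl , refl)) → trans
          (𝟙-yes (G? q p) (subst₂ Fin._<_ (sym s-q) (sym s-p) p<q , wp<wq))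
          (sym (cong₂ _+_ (𝟙-yes ((q Fin.≟ q) ×-dec (p Fin.≟ p)) (refl , refl))
                          (𝟙-no (inversion? w q p) λ (q<p , _) → ℕ.<-asym p<q q<p)))
        (no ne) → trans
          (𝟙-⇔ (G? i j) (inversion? w i j)
            (λ (si<sj , d) → s-mono⁻ ne si<sj , d)
            (λ (i<j , d) → s-mono (λ { (refl , refl) → ℕ.<-asym wp<wq d }) i<j , d))
          (cong (_+ 𝟙 (inversion? w i j)) (sym (𝟙-no ((i Fin.≟ q) ×-dec (j Fin.≟ p)) ne)))

      ∑∑Δ : ∑∑ Δ ≡ 1
      ∑∑Δ = trans
        (sum-δ (λ i → ℕΣ.sum (Δ i)) q (λ i i≢q → sum-0 (Δ i) λ j →
          𝟙-no ((i Fin.≟ q) ×-dec (j Fin.≟ p)) (i≢q ∘ proj₁)))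
        (trans (sum-δ (Δ q) p (λ j j≢p → 𝟙-no ((q Fin.≟ q) ×-dec (j Fin.≟ p)) (j≢p ∘ proj₂)))
               (𝟙-yes ((q Fin.≟ q) ×-dec (p Fin.≟ p)) (refl , refl)))

    ·s·s : ∀ (w : Permutation′ (suc m)) → w · s k · s k Perm.≈ w
    ·s·s w i = cong (w ⟨$⟩ʳ_) (s-involutive i)

    ℓ-descent : ∀ (w : Permutation′ (suc m)) → (w ⟨$⟩ʳ q) Fin.< (w ⟨$⟩ʳ p) →
                ℓ w ≡ suc (ℓ (w · s k))
    ℓ-descent w wq<wp = trans (sym (ℓ-cong {u = w · s k · s k} {v = w} (·s·s w)))
      (ℓ-ascent (w · s k) (subst (Fin._< (w ⟨$⟩ʳ (s k ⟨$⟩ʳ q))) (sym (cong (w ⟨$⟩ʳ_) s-p))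
        (subst ((w ⟨$⟩ʳ q) Fin.<_) (sym (cong (w ⟨$⟩ʳ_) s-q)) wq<wp)))

    ascent⊎descent : ∀ (w : Permutation′ (suc m)) →
      (w ⟨$⟩ʳ p) Fin.< (w ⟨$⟩ʳ q) ⊎ (w ⟨$⟩ʳ q) Fin.< (w ⟨$⟩ʳ p)
    ascent⊎descent w with Fin.<-cmp (w ⟨$⟩ʳ p) (w ⟨$⟩ʳ q)
    ... | tri< a _ _ = inj₁ a
    ... | tri> _ _ c = inj₂ c
    ... | tri≈ _ e _ = contradiction
      (trans (sym (Perm.inverseˡ w)) (trans (cong (w Perm.⟨$⟩ˡ_) e) (Perm.inverseˡ w))) p≢q

  increasing⇒id : ∀ {m} (f : Fin (suc m) → Fin (suc m)) →
    (∀ k → f (inject₁ k) Fin.< f (suc k)) → ∀ i → f i ≡ i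
  increasing⇒id {m} f inc i = Fin.toℕ-injective (ℕ.≤-antisym (hi i) (lo i))
    where
    lo : ∀ i → toℕ i ≤ toℕ (f i)
    lo = <-weakInduction (λ i → toℕ i ≤ toℕ (f i)) z≤n λ k ih →
      ℕ.≤-trans (s≤s (subst (_≤ toℕ (f (inject₁ k))) (Fin.toℕ-inject₁ k) ih)) (inc k)
    hi : ∀ i → toℕ (f i) ≤ toℕ i
    hi = >-weakInduction (λ i → toℕ (f i) ≤ toℕ i)
      (subst (toℕ (f (fromℕ m)) ≤_) (sym (Fin.toℕ-fromℕ m)) (Fin.toℕ≤pred[n] (f (fromℕ m))))
      λ k ih → subst (toℕ (f (inject₁ k)) ≤_) (sym (Fin.toℕ-inject₁ k)) (ℕ.≤-pred (ℕ.≤-trans (inc k) ih))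

  opposite-anti : ∀ {n} {i j : Fin n} → i Fin.< j → opposite j Fin.< opposite i
  opposite-anti {n} {i} {j} i<j rewrite Fin.opposite-prop i | Fin.opposite-prop j =
    ℕ.∸-monoʳ-< (s≤s i<j) (Fin.toℕ<n j)

  decreasing⇒reverse : ∀ {m} (w : Permutation′ (suc m)) →
    (∀ k → (w ⟨$⟩ʳ suc k) Fin.< (w ⟨$⟩ʳ inject₁ k)) → w Perm.≈ reverse
  decreasing⇒reverse w dec i = trans (sym (Fin.opposite-involutive (w ⟨$⟩ʳ i)))
    (cong opposite (increasing⇒id (λ i → opposite (w ⟨$⟩ʳ i)) (opposite-anti ∘ dec) i))

open Inversions

ℓ-isCoxeterLength : ∀ {m} (w : Permutation′ (suc m)) → IsCoxeterLength w (ℓ w)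
ℓ-isCoxeterLength {m} w = reduced (ℓ w) w refl , minimal
  where
  reduced : ∀ k (w : Permutation′ (suc m)) → ℓ w ≡ k →
            ∃ λ is → wordProduct is Perm.≈ w × length is ≡ k
  reduced k w e with Fin.any? (λ i → (w ⟨$⟩ʳ suc i) Fin.<? (w ⟨$⟩ʳ inject₁ i))
  reduced k w e | no noDescent =
    [] , (λ i → sym (w≈id i)) , trans (sym (ℓ-id {suc m})) (trans (sym (ℓ-cong {u = w} {v = Perm.id} w≈id)) e)
    where
    ascent : ∀ i → (w ⟨$⟩ʳ inject₁ i) Fin.< (w ⟨$⟩ʳ suc i)
    ascent i with ascent⊎descent i w
    ... | inj₁ wp<wq = wp<wq
    ... | inj₂ wq<wp = contradiction (i , wq<wp) noDescent

    w≈id : w Perm.≈ Perm.id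
    w≈id = increasing⇒id (w ⟨$⟩ʳ_) ascent
  reduced zero    w e | yes (i , wq<wp) = contradiction (trans (sym (ℓ-descent i w wq<wp)) e) λ ()
  reduced (suc k) w e | yes (i , wq<wp)
    with is , is≈ , len ← reduced k (w · s i)
                            (ℕ.suc-injective (trans (sym (ℓ-descent i w wq<wp)) e)) =
    is ++ [ i ] ,
    (λ j → trans (cong (_⟨$⟩ʳ j) (List.foldl-++ (λ u i → u · s i) Perm.id is [ i ]))
                 (trans (is≈ (s i ⟨$⟩ʳ j)) (·s·s i w j))) ,
    trans (List.length-++ is) (trans (ℕ.+-comm (length is) 1) (cong suc len))

  bound : ∀ (u : Permutation′ (suc m)) is → ℓ (foldl (λ u i → u · s i) u is) ≤ ℓ u + length is
  bound u []       = ℕ.m≤m+n (ℓ u) 0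
  bound u (i ∷ is) = ℕ.≤-trans (bound (u · s i) is)
    (subst (ℓ (u · s i) + length is ≤_) (sym (ℕ.+-suc (ℓ u) (length is)))
      (ℕ.+-monoˡ-≤ (length is) (case ascent⊎descent i u of λ where
        (inj₁ wp<wq) → ℕ.≤-reflexive (ℓ-ascent i u wp<wq)
        (inj₂ wq<wp) → ℕ.≤-trans (ℕ.n≤1+n _)
          (ℕ.≤-trans (ℕ.≤-reflexive (sym (ℓ-descent i u wq<wp))) (ℕ.n≤1+n _)))))

  minimal : ∀ is → wordProduct is Perm.≈ w → ℓ w ≤ length is
  minimal is is≈w = subst (_≤ length is) (ℓ-cong {u = wordProduct is} {v = w} is≈w)
    (subst (λ l → ℓ (wordProduct is) ≤ l + length is) (ℓ-id {suc m}) (bound Perm.id is))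

------------------------------------------------------------------------
-- Double Grothendieck polynomials

module _ {m : ℕ} where

  private n = suc m

  π-numerator : Fin m → Poly n → Poly n
  π-numerator i g = (1ᴾ +ᴾ β *ᴾ x (suc i)) *ᴾ g
                 -ᴾ (1ᴾ +ᴾ β *ᴾ x (inject₁ i)) *ᴾ permuteX (s i) g

  π : Fin m → Poly n → Poly n
  π i g = Division.quotient (inject₁ i) (suc i) (π-numerator i g)

  -- The division is exact; by Division.quotient-exact, π i g is
  -- characterized by this equation.
  π-exact : ∀ i g → π-numerator i g ≈ᴾ (x (inject₁ i) -ᴾ x (suc i)) *ᴾ π i g
  π-exact i g = ≈-trans (quotient-merge (π-numerator i g))
    (≈-trans (+-cong merge-numerator ≈-refl) (+-identityˡ _))
    where
    open Division (inject₁ i) (suc i)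

    q≢p : suc i ≢ inject₁ i
    q≢p = p≢q i ∘ sym

    merge-permute : ∀ g → merge (permuteX (s i) g) ≡ merge g
    merge-permute β = refl
    merge-permute (x k) with s-cases i k
    ... | inj₁ (refl , e) rewrite e | dec-true (inject₁ i Fin.≟ inject₁ i) refl
                                    | dec-false (suc i Fin.≟ inject₁ i) q≢p = refl
    ... | inj₂ (inj₁ (refl , e)) rewrite e | dec-true (inject₁ i Fin.≟ inject₁ i) refl
                                           | dec-false (suc i Fin.≟ inject₁ i) q≢p = refl
    ... | inj₂ (inj₂ (_ , _ , e)) rewrite e = refl
    merge-permute (b k)    = refl
    merge-permute 0ᴾ       = refl
    merge-permute 1ᴾ       = refl
    merge-permute (p +ᴾ q) = cong₂ _+ᴾ_ (merge-permute p) (merge-permute q)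
    merge-permute (p *ᴾ q) = cong₂ _*ᴾ_ (merge-permute p) (merge-permute q)
    merge-permute (-ᴾ p)   = cong -ᴾ_ (merge-permute p)

    merge-numerator : merge (π-numerator i g) ≈ᴾ 0ᴾ
    merge-numerator rewrite merge-permute g | dec-true (inject₁ i Fin.≟ inject₁ i) refl
                          | dec-false (suc i Fin.≟ inject₁ i) q≢p =
      CommutativeRing.-‿inverseʳ (polyRing n) _

  𝔊-longest : Poly n
  𝔊-longest = ∏ (filter (λ (i , j) → suc (toℕ i) + suc (toℕ j) ℕ.≤? n)
                        (cartesianProduct (allFin n) (allFin n)))
                (λ (i , j) → x i ⊕ b j)

  -- The successive choices of i made in descending from w₀ to w.
  data Choices : Permutation′ n → Set where
    longest : ∀ {w} → w Perm.≈ reverse → Choices w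
    step    : ∀ {w} i → ℓ (w · s i) ≡ suc (ℓ w) → Choices (w · s i) → Choices w

  𝔊-by : ∀ {w} → Choices w → Poly n
  𝔊-by (longest _)  = 𝔊-longest
  𝔊-by (step i _ c) = π i (𝔊-by c)

  choices : ∀ w → Choices w
  choices w = go (n * (n * 1)) w (ℕ.m≤n+m _ (ℓ w))
    where
    go : ∀ k w → n * (n * 1) ≤ ℓ w + k → Choices w
    go k w h with Fin.any? (λ i → (w ⟨$⟩ʳ inject₁ i) Fin.<? (w ⟨$⟩ʳ suc i))
    go k w h | no noAscent = longest (decreasing⇒reverse w λ i → case ascent⊎descent i w of λ where
      (inj₁ wp<wq) → contradiction (i , wp<wq) noAscent
      (inj₂ wq<wp) → wq<wp)
    go zero w h | yes (i , wp<wq) = contradiction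
      (ℕ.≤-trans (ℕ.≤-reflexive (sym (ℓ-ascent i w wp<wq)))
        (ℕ.≤-trans (ℓ-bound (w · s i)) (subst (n * (n * 1) ≤_) (ℕ.+-identityʳ (ℓ w)) h)))
      (ℕ.<-irrefl refl)
    go (suc k) w h | yes (i , wp<wq) = step i (ℓ-ascent i w wp<wq)
      (go k (w · s i) (subst (n * (n * 1) ≤_)
        (trans (ℕ.+-suc (ℓ w) k) (cong (_+ k) (sym (ℓ-ascent i w wp<wq)))) h))

  -- For the sequence of choices produced by choices; the polynomial does
  -- not depend on it up to ≈ᴾ.
  𝔊 : Permutation′ n → Poly n
  𝔊 w = 𝔊-by (choices w)

------------------------------------------------------------------------
-- Set-valued tableaux

-- The box (i , p) lies in row i and column μᵢ + p + 1 (with p counted from 0).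
module Tableaux {r : ℕ} (lam mu : Fin r → ℕ) where

  Box : Set
  Box = Σ (Fin r) λ i → Fin (lam i ∸ mu i)

  row : Box → Fin r
  row = proj₁

  col : Box → ℕ
  col (i , p) = suc (mu i + toℕ p)

  boxes : List Box
  boxes = concatMap (λ i → map (i ,_) (allFin (lam i ∸ mu i))) (allFin r)

  size : ℕ
  size = length boxes

  box : Fin size → Box
  box = lookup boxes

module _ {n : ℕ} where

  val : Fin n → ℕ
  val v = suc (toℕ v)

  elements : Subset n → List (Fin n)
  elements A = filter (_∈? A) (allFin n)

  -- The default arguments of max and min are irrelevant for nonempty sets.
  maximum minimum : Subset n → ℕ
  maximum A = max 0 (map val (elements A))
  minimum A = min (suc n) (map val (elements A))

vectorsOver : {A : Set} → List A → ∀ k → List (Vec A k)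
vectorsOver as zero    = [ Vec.[] ]
vectorsOver as (suc k) = cartesianProductWith Vec._∷_ as (vectorsOver as k)

module SetValued {r : ℕ} (lam mu flag : Fin r → ℕ) (n : ℕ) where

  open Tableaux lam mu

  -- A filling of the boxes by subsets of {1,…,n}.
  Filling : Set
  Filling = Vec (Subset n) size

  IsSVT : Filling → Set
  IsSVT T =
      (∀ t → Nonempty (T ! t))
    × (∀ t u → row (box t) ≡ row (box u) → col (box t) < col (box u) →
         maximum (T ! t) ≤ minimum (T ! u))
    × (∀ t u → col (box t) ≡ col (box u) → row (box t) Fin.< row (box u) →
         maximum (T ! t) < minimum (T ! u))
    × (∀ t v → v ∈ T ! t → val v ≤ flag (row (box t)))
    where
    infix 5 _!_
    _!_ = Vec.lookup

  isSVT? : ∀ T → Dec (IsSVT T)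
  isSVT? T = Fin.all? (λ t → nonempty? _)
    ×-dec Fin.all? (λ t → Fin.all? λ u →
      (row (box t) Fin.≟ row (box u)) →-dec ((col (box t) ℕ.<? col (box u)) →-dec (_ ℕ.≤? _)))
    ×-dec Fin.all? (λ t → Fin.all? λ u →
      (col (box t) ℕ.≟ col (box u)) →-dec ((row (box t) Fin.<? row (box u)) →-dec (_ ℕ.<? _)))
    ×-dec Fin.all? (λ t → Fin.all? λ v → (v ∈? _) →-dec (_ ℕ.≤? _))

  SVT : List Filling
  SVT = filter isSVT? (vectorsOver (vectorsOver (inside ∷ outside ∷ []) n) size)

  entries : Filling → List (Box × Fin n)
  entries T = concatMap (λ t → map (box t ,_) (elements (Vec.lookup T t))) (allFin size)

------------------------------------------------------------------------
-- The flagged skew shape of a 321-avoiding permutation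

module _ {n : ℕ} (w : Permutation′ n) where

  excedances : List (Fin n)
  excedances = filter (λ i → i Fin.<? (w ⟨$⟩ʳ i)) (allFin n)

  #exc : ℕ
  #exc = length excedances

  f wf : Fin #exc → ℕ
  f k  = val (lookup excedances k)
  wf k = val (w ⟨$⟩ʳ lookup excedances k)

  -- w(fᵣ); the value 0 for r = 0 is never used.
  wfᵣ : ℕ
  wfᵣ = maybe′ (λ i → val (w ⟨$⟩ʳ i)) 0 (last excedances)

  -- No subtraction is truncated if w avoids 321: fᵢ ≥ i, and w(fᵢ) - i is
  -- weakly increasing in i.
  λ′ μ′ : Fin #exc → ℕ
  λ′ k = wfᵣ ∸ #exc ∸ (f k ∸ val k)
  μ′ k = wfᵣ ∸ #exc ∸ (wf k ∸ val k)

  open Tableaux λ′ μ′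

  f<wf : ∀ k → f k < wf k
  f<wf k = s≤s (proj₂ (∈-filter⁻ (λ i → i Fin.<? (w ⟨$⟩ʳ i)) {xs = allFin n}
                                 (∈-lookup {xs = excedances} k)))

  λ′≤μ′+ : ∀ k → λ′ k ≤ μ′ k + (wf k ∸ f k)
  λ′≤μ′+ k = lemma (wfᵣ ∸ #exc) (f k) (wf k) (val k) (ℕ.<⇒≤ (f<wf k))
    where
    lemma : ∀ a c d e → c ≤ d → a ∸ (c ∸ e) ≤ a ∸ (d ∸ e) + (d ∸ c)
    lemma a c d e c≤d = begin
      a ∸ (c ∸ e)                     ≤⟨ ℕ.m≤n+m∸n (a ∸ (c ∸ e)) (d ∸ c) ⟩
      d ∸ c + (a ∸ (c ∸ e) ∸ (d ∸ c)) ≡⟨ cong (d ∸ c +_) (ℕ.∸-+-assoc a (c ∸ e) (d ∸ c)) ⟩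
      d ∸ c + (a ∸ (c ∸ e + (d ∸ c))) ≤⟨ ℕ.+-monoʳ-≤ (d ∸ c) (ℕ.∸-monoʳ-≤ a d∸e≤) ⟩
      d ∸ c + (a ∸ (d ∸ e))           ≡⟨ ℕ.+-comm (d ∸ c) _ ⟩
      a ∸ (d ∸ e) + (d ∸ c)           ∎
      where
      open ℕ.≤-Reasoning
      d∸e≤ : d ∸ e ≤ c ∸ e + (d ∸ c)
      d∸e≤ = ℕ.m≤n+o⇒m∸n≤o d e (begin
        d                     ≡⟨ ℕ.m+[n∸m]≡n c≤d ⟨
        c + (d ∸ c)           ≤⟨ ℕ.+-monoˡ-≤ (d ∸ c) (ℕ.m≤n+m∸n c e) ⟩
        e + (c ∸ e) + (d ∸ c) ≡⟨ ℕ.+-assoc e (c ∸ e) (d ∸ c) ⟩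
        e + (c ∸ e + (d ∸ c)) ∎)

  b-index<n : ∀ (t : Box) (v : Fin n) → λ′ (row t) + f (row t) ∸ (col t + val v) < n
  b-index<n (k , p) v = ℕ.≤-<-trans (ℕ.m≤n+o⇒m∸n≤o _ (col (k , p) + val v) (begin
      λ′ k + f k                        ≤⟨ ℕ.+-monoˡ-≤ (f k) (λ′≤μ′+ k) ⟩
      μ′ k + (wf k ∸ f k) + f k         ≡⟨ ℕ.+-assoc (μ′ k) _ (f k) ⟩
      μ′ k + (wf k ∸ f k + f k)         ≡⟨ cong (μ′ k +_) (ℕ.m∸n+n≡m (ℕ.<⇒≤ (f<wf k))) ⟩
      μ′ k + suc wfᵢ                    ≡⟨ ℕ.+-suc (μ′ k) wfᵢ ⟩
      suc (μ′ k) + wfᵢ                  ≤⟨ ℕ.+-monoˡ-≤ wfᵢ (s≤s (ℕ.m≤m+n (μ′ k) (toℕ p))) ⟩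
      col (k , p) + wfᵢ                 ≤⟨ ℕ.+-monoˡ-≤ wfᵢ (ℕ.m≤m+n (col (k , p)) (val v)) ⟩
      col (k , p) + val v + wfᵢ         ∎))
    (Fin.toℕ<n (w ⟨$⟩ʳ lookup excedances k))
    where
    open ℕ.≤-Reasoning
    wfᵢ = toℕ (w ⟨$⟩ʳ lookup excedances k)

  -- The index λ + f - c - v + 1, that is, λ + f - c - v counted from 0.
  -- The subtraction is not truncated when c ≤ λ and v ≤ f.
  b-index : Box × Fin n → Fin n
  b-index (t , v) = fromℕ< (b-index<n t v)

module Submission where

-- Let u₁, …, uₘ generate the 0-Hecke algebra with uₖ² = β uₖ.  Both sides of
-- the formula are the coefficient of u_w in the Fomin–Kirillov product of the
-- factors 1 + (xᵥ ⊕ b₍ₖ₋ᵥ₊₁₎) uₖ over v ≤ k, with v increasing and, for each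
-- v, k decreasing.
--
-- By the Yang–Baxter equation, the product times
-- (1 + β xᵢ) + (xᵢ₊₁ - xᵢ) uᵢ is 1 + β xᵢ times the product with xᵢ and xᵢ₊₁
-- exchanged.  For an ascent i of w the coefficients of u_{w sᵢ} in this
-- identity say that πᵢ takes the coefficient at w sᵢ to the one at w, whence
-- the coefficients agree with 𝔊 along every sequence of choices.
--
-- Let w avoid 321, and label the box (i , c) of σ(w) by λᵢ + fᵢ - c.  The
-- shape is the heap of w: the elements below w in weak order are the shapes
-- with corners removed, and k is a descent exactly when there is a corner
-- labelled k.  Reading the product from its last factor, an entry v in a box
-- labelled k records that uₖ was chosen from the factor (v , k).  It removes
-- a corner, or multiplies by β if the corner stays for an earlier factor.
-- The row and column conditions on a tableau say that the factors chosen in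
-- comparable boxes come in the order of the heap, and the flagging says v ≤ k.

open import Defs
open import Algebra.Bundles using (CommutativeMonoid; CommutativeRing)
import Algebra.Properties.CommutativeMonoid.Sum as Sum
import Algebra.Properties.Ring as RingProperties
import Algebra.Solver.Ring.NaturalCoefficients.Default as Solver
open import Data.Bool.Base using (T; true; false; if_then_else_)
open import Data.Fin.Base as Fin using (Fin; zero; suc; fromℕ<; inject₁; inject≤; opposite; toℕ)
open import Data.Fin.Permutation as Perm using (Permutation′; _⟨$⟩ʳ_; _⟨$⟩ˡ_; flip; reverse)
import Data.Fin.Properties as Fin
open import Data.Fin.Subset as Subset
  using (Subset; inside; outside; Nonempty) renaming (_∈_ to _∈ˢ_; _∉_ to _∉ˢ_)
import Data.Fin.Subset.Properties as Subset
open import Data.List.Base as List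
  using (List; []; _∷_; [_]; _++_; allFin; cartesianProduct; concatMap; filter; foldr; last; length;
         map; tabulate)
import Data.List.Extrema.Nat as Extrema
open import Data.List.Membership.Propositional using (_∈_)
import Data.List.Membership.Propositional.Properties as ∈
open import Data.List.Membership.Propositional.Properties.WithK using (unique∧set⇒bag)
import Data.List.Properties as List
open import Data.List.Relation.Binary.BagAndSetEquality using (∼bag⇒↭)
open import Data.List.Relation.Binary.Permutation.Propositional as ↭ using (_↭_)
open import Data.List.Relation.Unary.All as All using (All; []; _∷_)
import Data.List.Relation.Unary.All.Properties as All
open import Data.List.Relation.Unary.AllPairs as AllPairs using (AllPairs; []; _∷_)
import Data.List.Relation.Unary.AllPairs.Properties as AllPairs
open import Data.List.Relation.Unary.Any as Any using (here; there)
import Data.List.Relation.Unary.Any.Properties as Any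
open import Data.List.Relation.Unary.Unique.Propositional using (Unique)
import Data.List.Relation.Unary.Unique.Propositional.Properties as Unique
open import Data.Maybe.Base using (just; maybe′)
open import Data.Nat.Base
  using (ℕ; zero; suc; pred; _+_; _∸_; _≤_; _<_; _<ᵇ_; _≡ᵇ_; z≤n; s≤s; >-nonZero)
import Data.Nat.Properties as ℕ
open import Data.Nat.Solver using (module +-*-Solver)
open import Data.Product.Base as Product using (∃; _×_; _,_; map₁; map₂; proj₁; proj₂)
open import Data.Sum.Base using (_⊎_; inj₁; inj₂)
open import Data.Unit.Base using (tt)
open import Data.Vec.Base as Vec using (Vec; []; _∷_; _[_]≔_; lookup)
open import Data.Vec.Functional using (updateAt)
import Data.Vec.Functional.Properties as Vector
import Data.Vec.Properties as Vec
open import Function.Base using (_∘_; case_of_; const; id)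
open import Function.Bundles using (mk⇔)
open import Relation.Binary.Definitions using (tri<; tri≈; tri>)
open import Relation.Binary.PropositionalEquality
  using (_≡_; _≢_; refl; sym; trans; cong; cong₂; subst; subst₂; module ≡-Reasoning)
open import Relation.Nullary using (Dec; yes; no; does; contradiction; ¬_)
open import Relation.Nullary.Decidable using (_×-dec_; dec-false; dec-true; does-⇔)
open import Relation.Unary using (Decidable)
open +-*-Solver using () renaming (solve to solveℕ; _:+_ to _⊹_; _:=_ to _≐_; con to conℕ)

-- The labels of row `i` of the heap have a direct meaning: the value `y i = w(fᵢ)` starts at
-- position `fᵢ`, is carried to the right one place at a time and stops at position `y i`. An
-- element below `w` is thus recorded by the current positions `g` of these values, the remaining
-- shape by the same `g`, and removing a corner raises one `g i` by 1. Avoidance of 321 enters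
-- through two facts only: `w` increases on the excedances, and it increases on the other positions.
--
-- The factor (1 + β xᵢ) + (xᵢ₊₁ - xᵢ) uᵢ is 1 + ((xᵢ₊₁ - xᵢ) / (1 + β xᵢ)) uᵢ cleared of its
-- denominator, so that every identity stays between polynomials. The fraction is the difference of
-- xᵢ₊₁ and xᵢ for the law ⊕, the amount by which xᵢ₊₁ ⊕ b exceeds xᵢ ⊕ b; this is what the
-- Yang-Baxter equation asks of the third factor.

module ≈-Reasoning {N : ℕ} where
  open import Relation.Binary.Reasoning.Setoid (CommutativeRing.setoid (polyRing N)) public

module _ {N : ℕ} where
  private
    module R = CommutativeRing (polyRing N)

  open R public using (+-identityʳ; *-identityʳ; zeroˡ; zeroʳ)
  open Solver R.commutativeSemiring public using (solve; _:+_; _:*_; _:=_; con)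

  ≡⇒≈ : ∀ {p q : Poly N} → p ≡ q → p ≈ᴾ q
  ≡⇒≈ refl = ≈-refl

-- One-line notation with arbitrary letters. The tail of a permutation word need not be a
-- permutation of an initial segment, so words are left unrestricted; this lets `U (suc k)` and the
-- later recursions pass to the tail.
Word : ℕ → Set
Word = Vec ℕ

<ᵇ-asym : ∀ i j → (i <ᵇ j) ≡ true → (j <ᵇ i) ≡ false
<ᵇ-asym i j e with j <ᵇ i in e′
... | false = refl
... | true  = contradiction (ℕ.<ᵇ⇒< j i (subst T (sym e′) _))
    (ℕ.<-asym (ℕ.<ᵇ⇒< i j (subst T (sym e) _)))

<ᵇ-trans : ∀ i j k → (i <ᵇ j) ≡ true → (j <ᵇ k) ≡ true → (i <ᵇ k) ≡ true
<ᵇ-trans i j k e e′ = dec-true (i ℕ.<? k)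
  (ℕ.<-trans (ℕ.<ᵇ⇒< i j (subst T (sym e) _)) (ℕ.<ᵇ⇒< j k (subst T (sym e′) _)))

≮ᵇ-trans : ∀ i j k → (i <ᵇ j) ≡ false → (j <ᵇ k) ≡ false → (i <ᵇ k) ≡ false
≮ᵇ-trans i j k e e′ = dec-false (i ℕ.<? k) λ i<k →
  contradiction (ℕ.≤-trans (≮ j k e′) (≮ i j e)) (ℕ.<⇒≱ i<k)
  where
  ≮ : ∀ i j → (i <ᵇ j) ≡ false → j ≤ i
  ≮ i j e = ℕ.≮⇒≥ λ i<j → subst T e (ℕ.<⇒<ᵇ i<j)

-- The 0-Hecke algebra acting on coefficients, and the Yang-Baxter equation.

module Hecke {N : ℕ} where

  Fun : ℕ → Set
  Fun l = Word l → Poly N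

  -- If c gives the coefficients of an element h of the 0-Hecke algebra, then
  -- U k c gives those of h uₖ.
  U : ∀ {l} → Fin l → Fun (suc l) → Fun (suc l)
  U zero    c (a ∷ a′ ∷ w) =
    if (a′ <ᵇ a) then c (a′ ∷ a ∷ w) +ᴾ β *ᴾ c (a ∷ a′ ∷ w) else 0ᴾ
  U (suc k) c (a ∷ w)      = U k (λ v → c (a ∷ v)) w

  -- Right multiplication by `p + q uₖ`; in a composite, the outer operator is the later factor.
  H : ∀ {l} → Fin l → Poly N → Poly N → Fun (suc l) → Fun (suc l)
  H k p q c w = p *ᴾ c w +ᴾ q *ᴾ U k c w

  U-cong : ∀ {l} (k : Fin l) {c d : Fun (suc l)} → (∀ w → c w ≈ᴾ d w) → ∀ w → U k c w ≈ᴾ U k d w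
  U-cong zero e (a ∷ a′ ∷ w) with a′ <ᵇ a
  ... | true  = +-cong (e _) (*-cong ≈-refl (e _))
  ... | false = ≈-refl
  U-cong (suc k) e (a ∷ w) = U-cong k (λ v → e (a ∷ v)) w

  H-cong : ∀ {l} (k : Fin l) p q {c d : Fun (suc l)} → (∀ w → c w ≈ᴾ d w) →
           ∀ w → H k p q c w ≈ᴾ H k p q d w
  H-cong k p q e w = +-cong (*-cong ≈-refl (e w)) (*-cong ≈-refl (U-cong k e w))

  U-linear : ∀ {l} (k : Fin l) p q (c d : Fun (suc l)) w →
             U k (λ v → p *ᴾ c v +ᴾ q *ᴾ d v) w ≈ᴾ p *ᴾ U k c w +ᴾ q *ᴾ U k d w
  U-linear zero p q c d (a ∷ a′ ∷ w) with a′ <ᵇ a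
  ... | true  = solve 7 (λ p q β c c′ d d′ →
                    (p :* c :+ q :* d) :+ β :* (p :* c′ :+ q :* d′) :=
                    p :* (c :+ β :* c′) :+ q :* (d :+ β :* d′))
                  ≈-refl p q β (c (a′ ∷ a ∷ w)) (c (a ∷ a′ ∷ w)) (d (a′ ∷ a ∷ w)) (d (a ∷ a′ ∷ w))
  ... | false = solve 2 (λ p q → con 0 := p :* con 0 :+ q :* con 0) ≈-refl p q
  U-linear (suc k) p q c d (a ∷ w) = U-linear k p q (λ v → c (a ∷ v)) (λ v → d (a ∷ v)) w

  U-zero : ∀ {l} (k : Fin l) w → U k (λ _ → 0ᴾ) w ≈ᴾ 0ᴾ
  U-zero zero (a ∷ a′ ∷ w) with a′ <ᵇ a
  ... | true  = solve 1 (λ β → con 0 :+ β :* con 0 := con 0) ≈-refl β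
  ... | false = ≈-refl
  U-zero (suc k) (a ∷ w) = U-zero k w

  U-idem : ∀ {l} (k : Fin l) (c : Fun (suc l)) w → U k (U k c) w ≈ᴾ β *ᴾ U k c w
  U-idem zero c (a ∷ a′ ∷ w) with a′ <ᵇ a in e
  ... | false = ≈-sym (zeroʳ β)
  ... | true rewrite <ᵇ-asym a′ a e = +-identityˡ _
  U-idem (suc k) c (a ∷ w) = U-idem k (λ v → c (a ∷ v)) w

  private
    0+β0 : 0ᴾ +ᴾ β *ᴾ 0ᴾ ≈ᴾ 0ᴾ {N}
    0+β0 = ≈-trans (+-identityˡ _) (zeroʳ β)

  U-comm : ∀ {l} (k : Fin l) (c : Fun (suc (suc (suc l)))) w →
           U zero (U (suc (suc k)) c) w ≈ᴾ U (suc (suc k)) (U zero c) w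
  U-comm k c (a ∷ a′ ∷ w) with a′ <ᵇ a
  ... | false = ≈-sym (U-zero k w)
  ... | true  = ≈-sym (≈-trans (U-cong k (λ v → +-cong (≈-sym (*-identityˡ _)) ≈-refl) w)
                  (≈-trans (U-linear k 1ᴾ β _ _ w) (+-cong (*-identityˡ _) ≈-refl)))

  -- Only the relative order of the first three letters matters. Unless they strictly decrease, both
  -- sides vanish, equal letters counting as an ascent; if they do, each side is the same polynomial
  -- in β and the six rearrangements.
  U-braid : ∀ {l} (c : Fun (suc (suc (suc l)))) w →
            U zero (U (suc zero) (U zero c)) w ≈ᴾ U (suc zero) (U zero (U (suc zero) c)) w
  U-braid c (a ∷ a′ ∷ a″ ∷ w) with a′ <ᵇ a in e | a″ <ᵇ a′ in e′ | a″ <ᵇ a in e″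
  ... | true  | true  | false = contradiction (trans (sym (<ᵇ-trans a″ a′ a e′ e)) e″) λ ()
  ... | false | false | true  = contradiction (trans (sym e″) (≮ᵇ-trans a″ a′ a e′ e)) λ ()
  ... | false | false | false = ≈-refl
  ... | false | true  | false = ≈-sym 0+β0
  ... | false | true  | true  rewrite <ᵇ-asym a″ a′ e′ = ≈-sym (≈-trans (+-cong 0+β0 ≈-refl) 0+β0)
  ... | true  | false | false = 0+β0
  ... | true  | false | true  rewrite <ᵇ-asym a′ a e = ≈-trans (+-cong 0+β0 ≈-refl) 0+β0
  ... | true  | true  | true  rewrite <ᵇ-asym a′ a e | <ᵇ-asym a″ a′ e′ =
    solve 7 (λ β c₁ c₂ c₃ c₄ c₅ c₆ →
        ((c₁ :+ β :* c₂) :+ β :* con 0) :+ β :* ((c₃ :+ β :* c₄) :+ β :* (c₅ :+ β :* c₆)) :=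
        ((c₁ :+ β :* c₃) :+ β :* con 0) :+ β :* ((c₂ :+ β :* c₅) :+ β :* (c₄ :+ β :* c₆)))
      ≈-refl β (c (a″ ∷ a′ ∷ a ∷ w)) (c (a′ ∷ a″ ∷ a ∷ w)) (c (a″ ∷ a ∷ a′ ∷ w))
        (c (a ∷ a″ ∷ a′ ∷ w)) (c (a′ ∷ a ∷ a″ ∷ w)) (c (a ∷ a′ ∷ a″ ∷ w))

  H-expand : ∀ {l} (i j : Fin l) p q p′ q′ (c : Fun (suc l)) w →
    H i p q (H j p′ q′ c) w ≈ᴾ
    p *ᴾ (p′ *ᴾ c w +ᴾ q′ *ᴾ U j c w) +ᴾ q *ᴾ (p′ *ᴾ U i c w +ᴾ q′ *ᴾ U i (U j c) w)
  H-expand i j p q p′ q′ c w = +-cong ≈-refl (*-cong ≈-refl (U-linear i p′ q′ c (U j c) w))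

  H-comm : ∀ {l} (k : Fin l) p q p′ q′ (c : Fun (suc (suc (suc l)))) w →
           H zero p q (H (suc (suc k)) p′ q′ c) w ≈ᴾ H (suc (suc k)) p′ q′ (H zero p q c) w
  H-comm k p q p′ q′ c w = begin
    H zero p q (H (suc (suc k)) p′ q′ c) w ≈⟨ H-expand zero (suc (suc k)) p q p′ q′ c w ⟩
    _ ≈⟨ +-cong ≈-refl (*-cong ≈-refl (+-cong ≈-refl (*-cong ≈-refl (U-comm k c w)))) ⟩
    _ ≈⟨ solve 8 (λ p q p′ q′ c₀ c₁ c₂ c₁₂ →
           p :* (p′ :* c₀ :+ q′ :* c₂) :+ q :* (p′ :* c₁ :+ q′ :* c₁₂) :=
           p′ :* (p :* c₀ :+ q :* c₁) :+ q′ :* (p :* c₂ :+ q :* c₁₂))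
         ≈-refl p q p′ q′ (c w) (U zero c w) (U (suc (suc k)) c w) (U (suc (suc k)) (U zero c) w) ⟩
    _ ≈⟨ H-expand (suc (suc k)) zero p′ q′ p q c w ⟨
    H (suc (suc k)) p′ q′ (H zero p q c) w ∎
    where open ≈-Reasoning

  -- When both products are expanded, the constant terms and the terms of length two agree as they
  -- stand, and those of length three by the braid relation. The generators u₀ and u₁ remain: one
  -- side has `u (p + β d) + d` at u₀ and `p v` at u₁, the other side the reverse. The hypothesis
  -- equates these two, and is used once in each direction.
  yang-baxter : ∀ {l} p d u v → u *ᴾ (p +ᴾ β *ᴾ d) +ᴾ d ≈ᴾ p *ᴾ v →
    ∀ (c : Fun (suc (suc (suc l)))) w →
    H zero p d (H (suc zero) 1ᴾ v (H zero 1ᴾ u c)) w ≈ᴾ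
    H (suc zero) 1ᴾ u (H zero 1ᴾ v (H (suc zero) p d c)) w
  yang-baxter p d u v e c w = begin
    H zero p d (H (suc zero) 1ᴾ v (H zero 1ᴾ u c)) w
      ≈⟨ H-expand zero (suc zero) p d 1ᴾ v (H zero 1ᴾ u c) w ⟩
    p *ᴾ (1ᴾ *ᴾ H zero 1ᴾ u c w +ᴾ v *ᴾ U (suc zero) (H zero 1ᴾ u c) w) +ᴾ
    d *ᴾ (1ᴾ *ᴾ U zero (H zero 1ᴾ u c) w +ᴾ v *ᴾ U zero (U (suc zero) (H zero 1ᴾ u c)) w)
      ≈⟨ +-cong
           (*-cong ≈-refl (+-cong ≈-refl (*-cong ≈-refl (U-linear (suc zero) 1ᴾ u c (U zero c) w))))
           (*-cong ≈-refl (+-cong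
             (*-cong ≈-refl (≈-trans (U-linear zero 1ᴾ u c (U zero c) w)
               (+-cong ≈-refl (*-cong ≈-refl (U-idem zero c w)))))
             (*-cong ≈-refl (≈-trans (U-cong zero (U-linear (suc zero) 1ᴾ u c (U zero c)) w)
               (U-linear zero 1ᴾ u _ _ w))))) ⟩
    p *ᴾ (1ᴾ *ᴾ (1ᴾ *ᴾ c₀ +ᴾ u *ᴾ c₁) +ᴾ v *ᴾ (1ᴾ *ᴾ c₂ +ᴾ u *ᴾ c₂₁)) +ᴾ
    d *ᴾ (1ᴾ *ᴾ (1ᴾ *ᴾ c₁ +ᴾ u *ᴾ (β *ᴾ c₁)) +ᴾ v *ᴾ (1ᴾ *ᴾ c₁₂ +ᴾ u *ᴾ c₁₂₁))
      ≈⟨ solve 11 (λ p d u v β c₀ c₁ c₂ c₁₂ c₂₁ c₁₂₁ →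
           p :* (con 1 :* (con 1 :* c₀ :+ u :* c₁) :+ v :* (con 1 :* c₂ :+ u :* c₂₁)) :+
           d :* (con 1 :* (con 1 :* c₁ :+ u :* (β :* c₁)) :+ v :* (con 1 :* c₁₂ :+ u :* c₁₂₁)) :=
           (u :* (p :+ β :* d) :+ d) :* c₁ :+ (p :* v) :* c₂ :+
           (p :* c₀ :+ p :* v :* u :* c₂₁ :+ d :* v :* c₁₂ :+ d :* v :* u :* c₁₂₁))
         ≈-refl p d u v β c₀ c₁ c₂ c₁₂ c₂₁ c₁₂₁ ⟩
    (u *ᴾ (p +ᴾ β *ᴾ d) +ᴾ d) *ᴾ c₁ +ᴾ (p *ᴾ v) *ᴾ c₂ +ᴾ
    (p *ᴾ c₀ +ᴾ p *ᴾ v *ᴾ u *ᴾ c₂₁ +ᴾ d *ᴾ v *ᴾ c₁₂ +ᴾ d *ᴾ v *ᴾ u *ᴾ c₁₂₁)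
      ≈⟨ +-cong (+-cong (*-cong e ≈-refl) (*-cong (≈-sym e) ≈-refl))
                (+-cong ≈-refl (*-cong ≈-refl (U-braid c w))) ⟩
    (p *ᴾ v) *ᴾ c₁ +ᴾ (u *ᴾ (p +ᴾ β *ᴾ d) +ᴾ d) *ᴾ c₂ +ᴾ
    (p *ᴾ c₀ +ᴾ p *ᴾ v *ᴾ u *ᴾ c₂₁ +ᴾ d *ᴾ v *ᴾ c₁₂ +ᴾ d *ᴾ v *ᴾ u *ᴾ c₂₁₂)
      ≈⟨ solve 11 (λ p d u v β c₀ c₁ c₂ c₁₂ c₂₁ c₂₁₂ →
           (p :* v) :* c₁ :+ (u :* (p :+ β :* d) :+ d) :* c₂ :+
           (p :* c₀ :+ p :* v :* u :* c₂₁ :+ d :* v :* c₁₂ :+ d :* v :* u :* c₂₁₂) :=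
           con 1 :* (con 1 :* (p :* c₀ :+ d :* c₂) :+ v :* (p :* c₁ :+ d :* c₁₂)) :+
           u :* (con 1 :* (p :* c₂ :+ d :* (β :* c₂)) :+ v :* (p :* c₂₁ :+ d :* c₂₁₂)))
         ≈-refl p d u v β c₀ c₁ c₂ c₁₂ c₂₁ c₂₁₂ ⟩
    1ᴾ *ᴾ (1ᴾ *ᴾ (p *ᴾ c₀ +ᴾ d *ᴾ c₂) +ᴾ v *ᴾ (p *ᴾ c₁ +ᴾ d *ᴾ c₁₂)) +ᴾ
    u *ᴾ (1ᴾ *ᴾ (p *ᴾ c₂ +ᴾ d *ᴾ (β *ᴾ c₂)) +ᴾ v *ᴾ (p *ᴾ c₂₁ +ᴾ d *ᴾ c₂₁₂))
      ≈⟨ +-cong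
           (*-cong ≈-refl (+-cong ≈-refl (*-cong ≈-refl (U-linear zero p d c (U (suc zero) c) w))))
           (*-cong ≈-refl (+-cong
             (*-cong ≈-refl (≈-trans (U-linear (suc zero) p d c (U (suc zero) c) w)
               (+-cong ≈-refl (*-cong ≈-refl (U-idem (suc zero) c w)))))
             (*-cong ≈-refl (≈-trans (U-cong (suc zero) (U-linear zero p d c (U (suc zero) c)) w)
               (U-linear (suc zero) p d _ _ w))))) ⟨
    1ᴾ *ᴾ (1ᴾ *ᴾ H (suc zero) p d c w +ᴾ v *ᴾ U zero (H (suc zero) p d c) w) +ᴾ
    u *ᴾ (1ᴾ *ᴾ U (suc zero) (H (suc zero) p d c) w +ᴾ v *ᴾ U (suc zero)
        (U zero (H (suc zero) p d c)) w)
      ≈⟨ H-expand (suc zero) zero 1ᴾ u 1ᴾ v (H (suc zero) p d c) w ⟨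
    H (suc zero) 1ᴾ u (H zero 1ᴾ v (H (suc zero) p d c)) w ∎
    where
    open ≈-Reasoning
    c₀   = c w
    c₁   = U zero c w
    c₂   = U (suc zero) c w
    c₁₂  = U zero (U (suc zero) c) w
    c₂₁  = U (suc zero) (U zero c) w
    c₁₂₁ = U zero (U (suc zero) (U zero c)) w
    c₂₁₂ = U (suc zero) (U zero (U (suc zero) c)) w

-- The simple transposition, by the same recursion as `U` and `stair`; `swapped≗s` identifies it
-- with `s`.
swapped : ∀ {l} → Fin l → Fin (suc l) → Fin (suc l)
swapped zero    zero          = suc zero
swapped zero    (suc zero)    = zero
swapped zero    (suc (suc j)) = suc (suc j)
swapped (suc i) zero          = zero
swapped (suc i) (suc j)       = suc (swapped i j)

-- The Fomin-Kirillov product and the exchange of two neighbouring variables.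

module HeckeWords {N : ℕ} where

  open Hecke {N}

  Factors : ℕ → Set
  Factors l = List (Fin l × Poly N)

  lift : ∀ {l} → Factors l → Factors (suc l)
  lift = map (map₁ suc)

  -- The head of the list is the last factor of the product.
  act : ∀ {l} → Factors l → Fun (suc l) → Fun (suc l)
  act []            c = c
  act ((k , t) ∷ L) c = H k 1ᴾ t (act L c)

  act-cong : ∀ {l} (L : Factors l) {c d : Fun (suc l)} → (∀ w → c w ≈ᴾ d w) → ∀ w →
      act L c w ≈ᴾ act L d w
  act-cong []            e = e
  act-cong ((k , t) ∷ L) e = H-cong k 1ᴾ t (act-cong L e)

  act-++ : ∀ {l} (L M : Factors l) c w → act (L ++ M) c w ≈ᴾ act L (act M c) w
  act-++ []            M c w = ≈-refl
  act-++ ((k , t) ∷ L) M c w = H-cong k 1ᴾ t (act-++ L M c) w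

  act-lift : ∀ {l} (L : Factors l) c a w → act (lift L) c (a ∷ w) ≈ᴾ act L (λ v → c (a ∷ v)) w
  act-lift []            c a w = ≈-refl
  act-lift ((k , t) ∷ L) c a w = H-cong k 1ᴾ t (act-lift L c a) w

  H-act-comm : ∀ {l} p q (L : Factors l) c w →
               H zero p q (act (lift (lift L)) c) w ≈ᴾ act (lift (lift L)) (H zero p q c) w
  H-act-comm p q []            c w = ≈-refl
  H-act-comm p q ((k , t) ∷ L) c w = ≈-trans (H-comm k p q 1ᴾ t (act (lift (lift L)) c) w)
    (H-cong (suc (suc k)) 1ᴾ t (H-act-comm p q L c) w)

  H-scale : ∀ {l} (k : Fin l) p q r c w → H k p q (λ v → r *ᴾ c v) w ≈ᴾ r *ᴾ H k p q c w
  H-scale k p q r c w = ≈-trans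
    (+-cong ≈-refl (*-cong ≈-refl
      (≈-trans (U-cong k (λ v → ≈-sym (≈-trans (+-cong ≈-refl (zeroˡ _)) (+-identityʳ _))) w)
               (U-linear k r 0ᴾ c c w))))
    (solve 5 (λ p q r c₀ c₁ → p :* (r :* c₀) :+ q :* (r :* c₁ :+ con 0 :* c₁) := r :* (p :* c₀ :+ q :* c₁))
      ≈-refl p q r (c w) (U k c w))

  act-scale : ∀ {l} (L : Factors l) r c w → act L (λ v → r *ᴾ c v) w ≈ᴾ r *ᴾ act L c w
  act-scale []            r c w = ≈-refl
  act-scale ((k , t) ∷ L) r c w =
    ≈-trans (H-cong k 1ᴾ t (act-scale L r c) w) (H-scale k 1ᴾ t r (act L c) w)

  row : ∀ l → Poly N → (ℕ → Poly N) → Factors l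
  row zero    z B = []
  row (suc l) z B = (zero , z ⊕ B 0) ∷ lift (row l z (B ∘ suc))

  stair : ∀ l → (Fin (suc l) → Poly N) → (ℕ → Poly N) → Factors l
  stair zero    X B = []
  stair (suc l) X B = lift (stair l (X ∘ suc) B) ++ row (suc l) (X zero) B

  -- This is the hypothesis of `yang-baxter` for two factors that share the `b`-variable `u`. Since
  -- `p + β d` is `1 + β y`, both sides equal `(1 + β z) y + (1 + β y) (1 + β z) u`.
  ⊕-exchange : ∀ y z u →
      (z ⊕ u) *ᴾ ((1ᴾ +ᴾ β *ᴾ z) +ᴾ β *ᴾ (y -ᴾ z)) +ᴾ (y -ᴾ z) ≈ᴾ (1ᴾ +ᴾ β *ᴾ z) *ᴾ (y ⊕ u)
  ⊕-exchange y z u = begin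
    (z ⊕ u) *ᴾ ((1ᴾ +ᴾ β *ᴾ z) +ᴾ β *ᴾ (y -ᴾ z)) +ᴾ (y -ᴾ z)
      ≈⟨ solve 5 (λ β y z z⁻ u →
           (z :+ u :+ β :* z :* u) :* ((con 1 :+ β :* z) :+ β :* (y :+ z⁻)) :+ (y :+ z⁻) :=
           (con 1 :+ β :* z) :* (y :+ u :+ β :* y :* u) :+
           (z :+ z⁻) :* (con 1 :+ β :* (z :+ u :+ β :* z :* u)))
         ≈-refl β y z (-ᴾ z) u ⟩
    (1ᴾ +ᴾ β *ᴾ z) *ᴾ (y ⊕ u) +ᴾ (z -ᴾ z) *ᴾ (1ᴾ +ᴾ β *ᴾ (z ⊕ u))
      ≈⟨ +-cong ≈-refl (≈-trans (*-cong (CommutativeRing.-‿inverseʳ (polyRing N) z) ≈-refl)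
          (zeroˡ _)) ⟩
    (1ᴾ +ᴾ β *ᴾ z) *ᴾ (y ⊕ u) +ᴾ 0ᴾ ≈⟨ +-identityʳ _ ⟩
    (1ᴾ +ᴾ β *ᴾ z) *ᴾ (y ⊕ u) ∎
    where open ≈-Reasoning

  -- The factor `p + d u₀` at the end travels backwards through both rows. Once the factor of the
  -- row of `z` with index 0 has been commuted to its neighbours, `yang-baxter` passes `p + d u₀`
  -- through the two factors with `B 0`, exchanges `y` and `z` there and leaves `p + d u₁`: the same
  -- situation with all indices raised by one. In the end a single factor absorbs it, and the scalar
  -- `p` is left.
  exchange-rows : ∀ l y z B c w →
    H zero (1ᴾ +ᴾ β *ᴾ z) (y -ᴾ z) (act (lift (row l y B)) (act (row (suc l) z B) c)) w ≈ᴾ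
    (1ᴾ +ᴾ β *ᴾ z) *ᴾ act (lift (row l z B)) (act (row (suc l) y B) c) w
  exchange-rows zero y z B c w = begin
    H zero p d (H zero 1ᴾ u c) w ≈⟨ H-expand zero zero p d 1ᴾ u c w ⟩
    p *ᴾ (1ᴾ *ᴾ c w +ᴾ u *ᴾ U zero c w) +ᴾ d *ᴾ (1ᴾ *ᴾ U zero c w +ᴾ u *ᴾ U zero (U zero c) w)
      ≈⟨ +-cong ≈-refl (*-cong ≈-refl (+-cong ≈-refl (*-cong ≈-refl (U-idem zero c w)))) ⟩
    p *ᴾ (1ᴾ *ᴾ c w +ᴾ u *ᴾ U zero c w) +ᴾ d *ᴾ (1ᴾ *ᴾ U zero c w +ᴾ u *ᴾ (β *ᴾ U zero c w))
      ≈⟨ solve 6 (λ p d u β c₀ c₁ →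
           p :* (con 1 :* c₀ :+ u :* c₁) :+ d :* (con 1 :* c₁ :+ u :* (β :* c₁)) :=
           p :* c₀ :+ (u :* (p :+ β :* d) :+ d) :* c₁)
         ≈-refl p d u β (c w) (U zero c w) ⟩
    p *ᴾ c w +ᴾ (u *ᴾ (p +ᴾ β *ᴾ d) +ᴾ d) *ᴾ U zero c w
      ≈⟨ +-cong ≈-refl (*-cong (⊕-exchange y z (B 0)) ≈-refl) ⟩
    p *ᴾ c w +ᴾ (p *ᴾ v) *ᴾ U zero c w
      ≈⟨ solve 4 (λ p v c₀ c₁ → p :* c₀ :+ (p :* v) :* c₁ := p :* (con 1 :* c₀ :+ v :* c₁))
           ≈-refl p v (c w) (U zero c w) ⟩
    p *ᴾ H zero 1ᴾ v c w ∎
    where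
    open ≈-Reasoning
    p = 1ᴾ +ᴾ β *ᴾ z
    d = y -ᴾ z
    u = z ⊕ B 0
    v = y ⊕ B 0
  exchange-rows (suc l) y z B c w = begin
    H zero p d (H (suc zero) 1ᴾ v (act (lift (lift (R y))) (H zero 1ᴾ u (act (lift (R′ z)) c)))) w
      ≈⟨ H-cong zero p d (H-cong (suc zero) 1ᴾ v (H-act-comm 1ᴾ u (R y) (act (lift (R′ z)) c))) w ⟨
    H zero p d (H (suc zero) 1ᴾ v (H zero 1ᴾ u (act (lift (lift (R y))) (act (lift (R′ z)) c)))) w
      ≈⟨ yang-baxter p d u v (⊕-exchange y z (B 0)) _ w ⟩
    H (suc zero) 1ᴾ u (H zero 1ᴾ v (H (suc zero) p d
        (act (lift (lift (R y))) (act (lift (R′ z)) c)))) w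
      ≈⟨ H-cong (suc zero) 1ᴾ u (H-cong zero 1ᴾ v tail) w ⟩
    H (suc zero) 1ᴾ u (H zero 1ᴾ v (λ w → p *ᴾ act (lift (lift (R z))) (act (lift (R′ y)) c) w)) w
      ≈⟨ H-cong (suc zero) 1ᴾ u (H-scale zero 1ᴾ v p _) w ⟩
    H (suc zero) 1ᴾ u (λ w → p *ᴾ H zero 1ᴾ v (act (lift (lift (R z))) (act (lift (R′ y)) c)) w) w
      ≈⟨ H-scale (suc zero) 1ᴾ u p _ w ⟩
    p *ᴾ H (suc zero) 1ᴾ u (H zero 1ᴾ v (act (lift (lift (R z))) (act (lift (R′ y)) c))) w
      ≈⟨ *-cong ≈-refl (H-cong (suc zero) 1ᴾ u (H-act-comm 1ᴾ v (R z) (act (lift (R′ y)) c)) w) ⟩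
    p *ᴾ H (suc zero) 1ᴾ u (act (lift (lift (R z))) (H zero 1ᴾ v (act (lift (R′ y)) c))) w ∎
    where
    open ≈-Reasoning
    p = 1ᴾ +ᴾ β *ᴾ z
    d = y -ᴾ z
    u = z ⊕ B 0
    v = y ⊕ B 0
    R : Poly N → Factors l
    R t = row l t (B ∘ suc)
    R′ : Poly N → Factors (suc l)
    R′ t = row (suc l) t (B ∘ suc)

    unlift : ∀ t t′ a w → act (lift (lift (R t))) (act (lift (R′ t′)) c) (a ∷ w) ≈ᴾ
             act (lift (R t)) (act (R′ t′) (λ v → c (a ∷ v))) w
    unlift t t′ a w = ≈-trans (act-lift (lift (R t)) (act (lift (R′ t′)) c) a w)
                              (act-cong (lift (R t)) (act-lift (R′ t′) c a) w)

    tail : ∀ w → H (suc zero) p d (act (lift (lift (R y))) (act (lift (R′ z)) c)) w ≈ᴾ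
           p *ᴾ act (lift (lift (R z))) (act (lift (R′ y)) c) w
    tail (a ∷ w) = ≈-trans (H-cong zero p d (unlift y z a) w)
      (≈-trans (exchange-rows l y z (B ∘ suc) (λ v → c (a ∷ v)) w)
               (*-cong ≈-refl (≈-sym (unlift z y a w))))

  -- The rows after the two exchanged ones involve only generators that commute with uᵢ. The rows
  -- before them stand at the beginning of the product and are absorbed into `c`, which is why `c`
  -- is arbitrary.
  exchange : ∀ {l} (i : Fin l) X B c w →
    H i (1ᴾ +ᴾ β *ᴾ X (inject₁ i)) (X (suc i) -ᴾ X (inject₁ i)) (act (stair l X B) c) w ≈ᴾ
    (1ᴾ +ᴾ β *ᴾ X (inject₁ i)) *ᴾ act (stair l (X ∘ swapped i) B) c w
  exchange {suc zero} zero X B c w = exchange-rows zero (X (suc zero)) (X zero) B c w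
  exchange {suc (suc l)} zero X B c w = begin
    H zero p d (act (stair (suc (suc l)) X B) c) w
      ≈⟨ H-cong zero p d (split X) w ⟩
    H zero p d (act (lift (lift S)) (rows (X (suc zero)) (X zero))) w
      ≈⟨ H-act-comm p d S _ w ⟩
    act (lift (lift S)) (H zero p d (rows (X (suc zero)) (X zero))) w
      ≈⟨ act-cong (lift (lift S)) (exchange-rows (suc l) (X (suc zero)) (X zero) B c) w ⟩
    act (lift (lift S)) (λ w → p *ᴾ rows (X zero) (X (suc zero)) w) w
      ≈⟨ act-scale (lift (lift S)) p _ w ⟩
    p *ᴾ act (lift (lift S)) (rows (X zero) (X (suc zero))) w
      ≈⟨ *-cong ≈-refl (split (X ∘ swapped zero) w) ⟨
    p *ᴾ act (stair (suc (suc l)) (X ∘ swapped zero) B) c w ∎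
    where
    open ≈-Reasoning
    p = 1ᴾ +ᴾ β *ᴾ X zero
    d = X (suc zero) -ᴾ X zero
    S = stair l (λ j → X (suc (suc j))) B
    rows : Poly N → Poly N → Fun (suc (suc (suc l)))
    rows y z = act (lift (row (suc l) y B)) (act (row (suc (suc l)) z B) c)
    split : ∀ X w → act (stair (suc (suc l)) X B) c w ≈ᴾ
      act (lift (lift (stair l (λ j → X (suc (suc j))) B)))
          (act (lift (row (suc l) (X (suc zero)) B)) (act (row (suc (suc l)) (X zero) B) c)) w
    split X w = ≈-trans (act-++ (lift (stair (suc l) (X ∘ suc) B)) _ c w)
      (≈-trans (≡⇒≈ (cong (λ L → act L (act (row (suc (suc l)) (X zero) B) c) w)
                 (List.map-++ (map₁ suc) (lift (stair l (λ j → X (suc (suc j))) B)) _)))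
        (act-++ (lift (lift (stair l (λ j → X (suc (suc j))) B))) _ _ w))
  exchange {suc (suc l)} (suc i) X B c (a ∷ w) = begin
    H (suc i) p d (act (stair (suc (suc l)) X B) c) (a ∷ w)
      ≈⟨ H-cong i p d (split X) w ⟩
    H i p d (act (stair (suc l) (X ∘ suc) B) c′) w
      ≈⟨ exchange i (X ∘ suc) B c′ w ⟩
    p *ᴾ act (stair (suc l) (X ∘ suc ∘ swapped i) B) c′ w
      ≈⟨ *-cong ≈-refl (split (X ∘ swapped (suc i)) w) ⟨
    p *ᴾ act (stair (suc (suc l)) (X ∘ swapped (suc i)) B) c (a ∷ w) ∎
    where
    open ≈-Reasoning
    p = 1ᴾ +ᴾ β *ᴾ X (suc (inject₁ i))
    d = X (suc (suc i)) -ᴾ X (suc (inject₁ i))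
    c′ : Fun (suc (suc l))
    c′ v = act (row (suc (suc l)) (X zero) B) c (a ∷ v)
    split : ∀ X w → act (stair (suc (suc l)) X B) c (a ∷ w) ≈ᴾ
      act (stair (suc l) (X ∘ suc) B) (λ v → act (row (suc (suc l)) (X zero) B) c (a ∷ v)) w
    split X w = ≈-trans (act-++ (lift (stair (suc l) (X ∘ suc) B)) _ c (a ∷ w))
      (act-lift (stair (suc l) (X ∘ suc) B) _ a w)

  -- Coefficients at the identity and at the longest element.

  δ : ∀ {l} → ℕ → Fun l
  δ a []       = 1ᴾ
  δ a (a′ ∷ w) = if (a ≡ᵇ a′) then δ (suc a) w else 0ᴾ

  act-zero : ∀ {l} (L : Factors l) w → act L (λ _ → 0ᴾ) w ≈ᴾ 0ᴾ
  act-zero []            w = ≈-refl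
  act-zero ((k , t) ∷ L) w = ≈-trans (H-cong k 1ᴾ t (act-zero L) w)
    (≈-trans (+-cong (zeroʳ _) (≈-trans (*-cong ≈-refl (U-zero k w)) (zeroʳ _))) (+-identityˡ _))

  ∏-lift : ∀ {l} (L : Factors l) → ∏ (lift L) proj₂ ≡ ∏ L proj₂
  ∏-lift []      = refl
  ∏-lift ((k , t) ∷ L) = cong (t *ᴾ_) (∏-lift L)

  ∏-++ : {A : Set} (L M : List A) (h : A → Poly N) → ∏ (L ++ M) h ≈ᴾ ∏ L h *ᴾ ∏ M h
  ∏-++ []      M h = ≈-sym (*-identityˡ _)
  ∏-++ (t ∷ L) M h = ≈-trans (*-cong ≈-refl (∏-++ L M h)) (≈-sym (*-assoc _ _ _))

  lift-δ : ∀ {l} (L : Factors l) a a′ w →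
           act (lift L) (δ a) (a′ ∷ w) ≈ᴾ (if (a ≡ᵇ a′) then act L (δ (suc a)) w else 0ᴾ)
  lift-δ L a a′ w with a ≡ᵇ a′ | act-lift L (δ a) a′ w
  ... | true  | h = h
  ... | false | h = ≈-trans h (act-zero L w)

  lift-δ-≢ : ∀ {l} (L : Factors l) {a a′} w → a ≢ a′ → act (lift L) (δ a) (a′ ∷ w) ≈ᴾ 0ᴾ
  lift-δ-≢ L {a} {a′} w a≢a′ = ≈-trans (lift-δ L a a′ w)
    (≡⇒≈ (cong (λ t → if t then act L (δ (suc a)) w else 0ᴾ) (dec-false (a ℕ.≟ a′) a≢a′)))

  -- `δ a` is the unit of the algebra on the letters `a`, `a + 1`, and so on. To bring the largest
  -- letter `a + l` to the front, every factor of the row has to contribute its generator; the other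
  -- letters then keep their order. In the recursion the last factor takes the letter `a` out of the
  -- front, and the rest of the row acts on the letters from `suc a` on.
  row-δ : ∀ l a z B (w : Word l) →
          act (row l z B) (δ a) (a + l ∷ w) ≈ᴾ ∏ (row l z B) proj₂ *ᴾ δ a w
  row-δ zero a z B [] rewrite ℕ.+-identityʳ a | dec-true (a ℕ.≟ a) refl = ≈-sym (*-identityˡ 1ᴾ)
  row-δ (suc l) a z B (a′ ∷ w) with a ≡ᵇ a′ in e
  ... | true with refl ← ℕ.≡ᵇ⇒≡ a a′ (subst T (sym e) tt)
             rewrite dec-true (a ℕ.<? a + suc l) (ℕ.m<m+n a ℕ.0<1+n) = begin
    1ᴾ *ᴾ G (a + suc l ∷ a ∷ w) +ᴾ u *ᴾ (G (a ∷ a + suc l ∷ w) +ᴾ β *ᴾ G (a + suc l ∷ a ∷ w))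
      ≈⟨ +-cong (*-cong ≈-refl G-top) (*-cong ≈-refl (+-cong G-bottom (*-cong ≈-refl G-top))) ⟩
    1ᴾ *ᴾ 0ᴾ +ᴾ u *ᴾ (∏ R proj₂ *ᴾ δ (suc a) w +ᴾ β *ᴾ 0ᴾ)
      ≈⟨ solve 4 (λ u p d β → con 1 :* con 0 :+ u :* (p :* d :+ β :* con 0) := u :* p :* d)
           ≈-refl u (∏ R proj₂) (δ (suc a) w) β ⟩
    u *ᴾ ∏ R proj₂ *ᴾ δ (suc a) w
      ≈⟨ *-cong (*-cong ≈-refl (≡⇒≈ (∏-lift R))) ≈-refl ⟨
    u *ᴾ ∏ (lift R) proj₂ *ᴾ δ (suc a) w ∎
    where
    open ≈-Reasoning
    u = z ⊕ B 0
    R = row l z (B ∘ suc)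
    G : Fun (suc (suc l))
    G = act (lift R) (δ a)

    G-top : G (a + suc l ∷ a ∷ w) ≈ᴾ 0ᴾ
    G-top = lift-δ-≢ R (a ∷ w) (ℕ.<⇒≢ (ℕ.m<m+n a ℕ.0<1+n))

    G-bottom : G (a ∷ a + suc l ∷ w) ≈ᴾ ∏ R proj₂ *ᴾ δ (suc a) w
    G-bottom = ≈-trans (lift-δ R a a (a + suc l ∷ w))
      (≈-trans (≡⇒≈ (cong₂ (if_then_else 0ᴾ) (dec-true (a ℕ.≟ a) refl)
                 (cong (λ a″ → act R (δ (suc a)) (a″ ∷ w)) (ℕ.+-suc a l))))
        (row-δ l (suc a) z (B ∘ suc) w))
  row-δ (suc l) a z B (a′ ∷ w) | false = begin
    1ᴾ *ᴾ G (a + suc l ∷ a′ ∷ w) +ᴾ u *ᴾ U zero G (a + suc l ∷ a′ ∷ w)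
      ≈⟨ +-cong (*-cong ≈-refl G-top) (*-cong ≈-refl G-swap) ⟩
    1ᴾ *ᴾ 0ᴾ +ᴾ u *ᴾ 0ᴾ
      ≈⟨ solve 2 (λ u p → con 1 :* con 0 :+ u :* con 0 := p :* con 0) ≈-refl u
          (∏ (row (suc l) z B) proj₂) ⟩
    ∏ (row (suc l) z B) proj₂ *ᴾ 0ᴾ ∎
    where
    open ≈-Reasoning
    u = z ⊕ B 0
    R = row l z (B ∘ suc)
    G : Fun (suc (suc l))
    G = act (lift R) (δ a)

    G-top : G (a + suc l ∷ a′ ∷ w) ≈ᴾ 0ᴾ
    G-top = lift-δ-≢ R (a′ ∷ w) (ℕ.<⇒≢ (ℕ.m<m+n a ℕ.0<1+n))

    G-swap : U zero G (a + suc l ∷ a′ ∷ w) ≈ᴾ 0ᴾ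
    G-swap with a′ <ᵇ a + suc l
    ... | false = ≈-refl
    ... | true  = ≈-trans
      (+-cong (≈-trans (lift-δ R a a′ (a + suc l ∷ w))
          (≡⇒≈ (cong (λ t → if t then act R (δ (suc a)) (a + suc l ∷ w) else 0ᴾ) e)))
              (≈-trans (*-cong ≈-refl G-top) (zeroʳ β)))
      (+-identityˡ _)

  decreasing : ∀ l → Word l
  decreasing zero    = []
  decreasing (suc l) = l ∷ decreasing l

  -- The first row has to bring the largest letter to the front. It leaves the unit on the remaining
  -- letters, which are treated by the later rows in the same way.
  stair-δ : ∀ l X B → act (stair l X B) (δ 0) (decreasing (suc l)) ≈ᴾ ∏ (stair l X B) proj₂
  stair-δ zero    X B = ≈-refl
  stair-δ (suc l) X B = begin
    act (stair (suc l) X B) (δ 0) (suc l ∷ w)        ≈⟨ act-++ (lift S) R (δ 0) (suc l ∷ w) ⟩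
    act (lift S) (act R (δ 0)) (suc l ∷ w)           ≈⟨ act-lift S (act R (δ 0)) (suc l) w ⟩
    act S (λ v → act R (δ 0) (suc l ∷ v)) w          ≈⟨ act-cong S (row-δ (suc l) 0 (X zero) B) w ⟩
    act S (λ v → ∏ R proj₂ *ᴾ δ 0 v) w               ≈⟨ act-scale S (∏ R proj₂) (δ 0) w ⟩
    ∏ R proj₂ *ᴾ act S (δ 0) w                       ≈⟨ *-cong ≈-refl (stair-δ l (X ∘ suc) B) ⟩
    ∏ R proj₂ *ᴾ ∏ S proj₂                           ≈⟨ *-comm _ _ ⟩
    ∏ S proj₂ *ᴾ ∏ R proj₂                           ≈⟨ *-cong (≡⇒≈ (∏-lift S)) ≈-refl ⟨
    ∏ (lift S) proj₂ *ᴾ ∏ R proj₂                    ≈⟨ ∏-++ (lift S) R proj₂ ⟨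
    ∏ (stair (suc l) X B) proj₂                      ∎
    where
    open ≈-Reasoning
    w = decreasing (suc l)
    S = stair l (X ∘ suc) B
    R = row (suc l) (X zero) B

  row-cong : ∀ l {z z′} {B B′ : ℕ → Poly N} → z ≡ z′ → (∀ j → B j ≡ B′ j) → row l z B ≡ row l z′ B′
  row-cong zero    e f = refl
  row-cong (suc l) e f = cong₂ (λ u L → (zero , u) ∷ lift L) (cong₂ _⊕_ e (f 0))
      (row-cong l e (f ∘ suc))

  stair-cong : ∀ l {X X′ : Fin (suc l) → Poly N} {B B′ : ℕ → Poly N} →
               (∀ i → X i ≡ X′ i) → (∀ j → B j ≡ B′ j) → stair l X B ≡ stair l X′ B′
  stair-cong zero    e f = refl
  stair-cong (suc l) e f = cong₂ (λ S R → lift S ++ R) (stair-cong l (e ∘ suc) f)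
      (row-cong (suc l) (e zero) f)

  module _ (ρ : Fin N → Poly N) where

    private
      ψ : Poly N → Poly N
      ψ = substX ρ

    substX-U : ∀ {l} (k : Fin l) (c : Fun (suc l)) w → ψ (U k c w) ≡ U k (ψ ∘ c) w
    substX-U zero c (a ∷ a′ ∷ w) with a′ <ᵇ a
    ... | true  = refl
    ... | false = refl
    substX-U (suc k) c (a ∷ w) = substX-U k (λ v → c (a ∷ v)) w

    -- `U` only adds and multiplies by β, which the substitution fixes, so substituting in a
    -- coefficient amounts to substituting in the weights.
    substX-act : ∀ {l} (L : Factors l) (c : Fun (suc l)) w →
                 ψ (act L c w) ≈ᴾ act (map (map₂ ψ) L) (ψ ∘ c) w
    substX-act []            c w = ≈-refl
    substX-act ((k , t) ∷ L) c w = ≈-trans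
      (≡⇒≈ (cong (λ q → 1ᴾ *ᴾ ψ (act L c w) +ᴾ ψ t *ᴾ q) (substX-U k (act L c) w)))
      (H-cong k 1ᴾ (ψ t) (substX-act L c) w)

    substX-δ : ∀ {l} a (w : Word l) → ψ (δ a w) ≡ δ a w
    substX-δ a [] = refl
    substX-δ a (a′ ∷ w) with a ≡ᵇ a′
    ... | true  = substX-δ (suc a) w
    ... | false = refl

    map-lift : ∀ {l} (L : Factors l) → map (map₂ ψ) (lift L) ≡ lift (map (map₂ ψ) L)
    map-lift L = trans (sym (List.map-∘ L)) (List.map-∘ L)

    substX-row : ∀ l z B → map (map₂ ψ) (row l z B) ≡ row l (ψ z) (ψ ∘ B)
    substX-row zero    z B = refl
    substX-row (suc l) z B = cong ((zero , ψ (z ⊕ B 0)) ∷_)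
        (trans (map-lift (row l z (B ∘ suc))) (cong lift (substX-row l z (B ∘ suc))))

    substX-stair : ∀ l X B → map (map₂ ψ) (stair l X B) ≡ stair l (ψ ∘ X) (ψ ∘ B)
    substX-stair zero    X B = refl
    substX-stair (suc l) X B = trans (List.map-++ (map₂ ψ) (lift (stair l (X ∘ suc) B)) _)
      (cong₂ _++_ (trans (map-lift (stair l (X ∘ suc) B)) (cong lift (substX-stair l (X ∘ suc) B)))
                  (substX-row (suc l) (X zero) B))

-- Sums and products over lists and finite index sets.

module BigOperator {c ℓ} (M : CommutativeMonoid c ℓ) where

  open CommutativeMonoid M renaming (refl to ≋-refl; sym to ≋-sym; trans to ≋-trans)
  open Sum M using (sum)

  -- In the two monoids of `polyRing N` this unfolds to the `∑` and `∏` of the statement; in ℕ it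
  -- serves for counting.
  ⨀ : {A : Set} → List A → (A → Carrier) → Carrier
  ⨀ as h = foldr (λ a p → h a ∙ p) ε as

  module _ {A : Set} where

    ⨀-cong : ∀ (as : List A) {h h′ : A → Carrier} → (∀ {a} → a ∈ as → h a ≈ h′ a) → ⨀ as h ≈ ⨀ as h′
    ⨀-cong []       e = ≋-refl
    ⨀-cong (a ∷ as) e = ∙-cong (e (here refl)) (⨀-cong as (e ∘ there))

    ⨀-++ : ∀ (as as′ : List A) h → ⨀ (as ++ as′) h ≈ ⨀ as h ∙ ⨀ as′ h
    ⨀-++ []       as′ h = ≋-sym (identityˡ _)
    ⨀-++ (a ∷ as) as′ h = ≋-trans (∙-congˡ (⨀-++ as as′ h)) (≋-sym (assoc _ _ _))

    ⨀-↭ : ∀ {as as′ : List A} h → as ↭ as′ → ⨀ as h ≈ ⨀ as′ h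
    ⨀-↭ h ↭.refl          = ≋-refl
    ⨀-↭ h (↭.prep a e)    = ∙-congˡ (⨀-↭ h e)
    ⨀-↭ h (↭.swap a a′ e) = ≋-trans (∙-congˡ (∙-congˡ (⨀-↭ h e)))
      (≋-trans (≋-sym (assoc _ _ _)) (≋-trans (∙-congʳ (comm _ _)) (assoc _ _ _)))
    ⨀-↭ h (↭.trans e e′)  = ≋-trans (⨀-↭ h e) (⨀-↭ h e′)

    ⨀-filter : ∀ {P : A → Set} (P? : Decidable P) as h →
               ⨀ (filter P? as) h ≈ ⨀ as (λ a → if does (P? a) then h a else ε)
    ⨀-filter P? []       h = ≋-refl
    ⨀-filter P? (a ∷ as) h with does (P? a)
    ... | true  = ∙-congˡ (⨀-filter P? as h)
    ... | false = ≋-trans (⨀-filter P? as h) (≋-sym (identityˡ _))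

    ⨀-tabulate : ∀ {k} (g : Fin k → A) h → ⨀ (tabulate g) h ≡ sum (h ∘ g)
    ⨀-tabulate {zero}  g h = refl
    ⨀-tabulate {suc k} g h = cong (h (g zero) ∙_) (⨀-tabulate (g ∘ suc) h)

  ⨀-map : {A A′ : Set} (g : A → A′) (as : List A) (h : A′ → Carrier) → ⨀ (map g as) h ≡ ⨀ as (h ∘ g)
  ⨀-map g []       h = refl
  ⨀-map g (a ∷ as) h = cong (h (g a) ∙_) (⨀-map g as h)

  ⨀-concatMap : {A A′ : Set} (g : A → List A′) (as : List A) (h : A′ → Carrier) →
                ⨀ (concatMap g as) h ≈ ⨀ as (λ a → ⨀ (g a) h)
  ⨀-concatMap g []       h = ≋-refl
  ⨀-concatMap g (a ∷ as) h = ≋-trans (⨀-++ (g a) (concatMap g as) h) (∙-congˡ (⨀-concatMap g as h))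

  sum-modify : ∀ {k} (h h′ : Fin k → Carrier) i c → h′ i ≈ c ∙ h i → (∀ j → j ≢ i → h′ j ≈ h j) →
               sum h′ ≈ c ∙ sum h
  sum-modify h h′ zero c e e′ = ≋-trans
    (∙-cong e (Sum.sum-cong-≋ M (λ j → e′ (suc j) λ ()))) (assoc _ _ _)
  sum-modify h h′ (suc i) c e e′ = ≋-trans
    (∙-cong (e′ zero λ ()) (sum-modify (h ∘ suc) (h′ ∘ suc) i c e
        (λ j j≢i → e′ (suc j) (j≢i ∘ Fin.suc-injective))))
    (≋-trans (≋-sym (assoc _ _ _)) (≋-trans (∙-congʳ (comm _ _)) (assoc _ _ _)))

module ℕ-Big = BigOperator ℕ.+-0-commutativeMonoid
module +-Big {N : ℕ} = BigOperator (CommutativeRing.+-commutativeMonoid (polyRing N))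
module ×-Big {N : ℕ} = BigOperator (CommutativeRing.*-commutativeMonoid (polyRing N))

unique-↭ : {A : Set} {as as′ : List A} → Unique as → Unique as′ →
           (∀ {a} → a ∈ as → a ∈ as′) → (∀ {a} → a ∈ as′ → a ∈ as) → as ↭ as′
unique-↭ u u′ f g = ∼bag⇒↭ (unique∧set⇒bag u u′ (mk⇔ f g))

unique-map : {A A′ : Set} (g : A → A′) {as : List A} →
             (∀ {a a′} → a ∈ as → a′ ∈ as → g a ≡ g a′ → a ≡ a′) → Unique as → Unique (map g as)
unique-map g {[]}     inj []       = []
unique-map g {a ∷ as} inj (a∉ ∷ u) =
  All.map⁺ (All.tabulate λ a′∈ e → All.lookup a∉ a′∈ (inj (here refl) (there a′∈) e))
  ∷ unique-map g (λ p q → inj (there p) (there q)) u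

-- The factors of a row run through decreasing reflections, and the list
-- starts with the last factor of the last row.
positions : ∀ l → List (Fin (suc l) × Fin l)
positions zero    = []
positions (suc l) = map (Product.map suc suc) (positions l) ++ map (zero ,_) (allFin (suc l))

-- The order in which the factors `(v , k)` stand in the product.
_⊏_ : ∀ {n m} → Fin n × Fin m → Fin n × Fin m → Set
(v , k) ⊏ (v′ , k′) = v Fin.< v′ ⊎ (v ≡ v′ × k′ Fin.< k)

⊏-irrefl : ∀ {n m} (p : Fin n × Fin m) → ¬ p ⊏ p
⊏-irrefl p (inj₁ v<v)       = ℕ.<-irrefl refl v<v
⊏-irrefl p (inj₂ (_ , k<k)) = ℕ.<-irrefl refl k<k

⊏-trans : ∀ {n m} {p q r : Fin n × Fin m} → p ⊏ q → q ⊏ r → p ⊏ r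
⊏-trans (inj₁ e)          (inj₁ e′)          = inj₁ (ℕ.<-trans e e′)
⊏-trans (inj₁ e)          (inj₂ (refl , _))  = inj₁ e
⊏-trans (inj₂ (refl , _)) (inj₁ e′)          = inj₁ e′
⊏-trans (inj₂ (refl , e)) (inj₂ (refl , e′)) = inj₂ (refl , ℕ.<-trans e′ e)

positions-sorted : ∀ l → AllPairs (λ p q → q ⊏ p) (positions l)
positions-sorted zero    = []
positions-sorted (suc l) = AllPairs.++⁺
  (AllPairs.map⁺ (AllPairs.map shift (positions-sorted l)))
  (AllPairs.map⁺ (AllPairs.tabulate⁺-< λ i<j → inj₂ (refl , i<j)))
  (All.map⁺ (All.universal (λ _ → All.map⁺ (All.universal (λ _ → inj₁ (s≤s z≤n)) _)) _))
  where
  shift : ∀ {p q : Fin (suc l) × Fin l} → q ⊏ p → Product.map suc suc q ⊏ Product.map suc suc p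
  shift (inj₁ e)          = inj₁ (s≤s e)
  shift (inj₂ (refl , e)) = inj₂ (refl , s≤s e)

positions-unique : ∀ l → Unique (positions l)
positions-unique l = AllPairs.map (λ { {p} q⊏p refl → ⊏-irrefl p q⊏p }) (positions-sorted l)

∈-positions⁺ : ∀ l {v k} → toℕ v ≤ toℕ k → (v , k) ∈ positions l
∈-positions⁺ (suc l) {zero}  {k}     _       =
  ∈.∈-++⁺ʳ _ (∈.∈-map⁺ (zero ,_) (∈.∈-allFin k))
∈-positions⁺ (suc l) {suc v} {suc k} (s≤s h) =
  ∈.∈-++⁺ˡ (∈.∈-map⁺ (Product.map suc suc) (∈-positions⁺ l h))

∈-positions⁻ : ∀ l {v k} → (v , k) ∈ positions l → toℕ v ≤ toℕ k
∈-positions⁻ (suc l) p with ∈.∈-++⁻ (map (Product.map suc suc) (positions l)) p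
... | inj₁ q with (_ , r , refl) ← ∈.∈-map⁻ (Product.map suc suc) q = s≤s (∈-positions⁻ l r)
... | inj₂ q with (_ , _ , refl) ← ∈.∈-map⁻ (zero ,_) q = z≤n

-- The product as a list indexed by pairs `(v , k)`.

module _ {N : ℕ} where

  open HeckeWords {N}

  weigh : ∀ {l} → (Fin (suc l) → Poly N) → (ℕ → Poly N) → Fin (suc l) × Fin l → Poly N
  weigh X B (v , k) = X v ⊕ B (toℕ k ∸ toℕ v)

  factor : ∀ {l} → (Fin (suc l) → Poly N) → (ℕ → Poly N) → Fin (suc l) × Fin l → Fin l × Poly N
  factor X B (v , k) = k , weigh X B (v , k)

  row-tabulate : ∀ l z B → row l z B ≡ tabulate (λ k → k , z ⊕ B (toℕ k))
  row-tabulate zero    z B = refl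
  row-tabulate (suc l) z B = cong ((zero , z ⊕ B 0) ∷_)
    (trans (cong lift (row-tabulate l z (B ∘ suc)))
           (List.map-tabulate (λ k → k , z ⊕ B (suc (toℕ k))) (map₁ suc)))

  stair-positions : ∀ l X B → stair l X B ≡ map (factor X B) (positions l)
  stair-positions zero    X B = refl
  stair-positions (suc l) X B = sym (trans
      (List.map-++ (factor X B) (map (Product.map suc suc) (positions l)) _)
    (cong₂ _++_
      (trans (sym (List.map-∘ (positions l)))
        (trans (List.map-∘ (positions l)) (cong lift (sym (stair-positions l (X ∘ suc) B)))))
      (trans (sym (List.map-∘ (allFin (suc l))))
        (trans (List.map-tabulate id (λ k → factor X B (zero , k)))
            (sym (row-tabulate (suc l) (X zero) B))))))

swapped≗s : ∀ {m} (k : Fin m) j → swapped k j ≡ s k ⟨$⟩ʳ j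
swapped≗s {m} k j with Inversions.s-cases k j
... | inj₁ (refl , e)              = trans (lower k) (sym e)
  where
  lower : ∀ {l} (k : Fin l) → swapped k (inject₁ k) ≡ suc k
  lower zero    = refl
  lower (suc k) = cong suc (lower k)
... | inj₂ (inj₁ (refl , e))       = trans (upper k) (sym e)
  where
  upper : ∀ {l} (k : Fin l) → swapped k (suc k) ≡ inject₁ k
  upper zero    = refl
  upper (suc k) = cong suc (upper k)
... | inj₂ (inj₂ (j≢p , j≢q , e)) = trans (other k j j≢p j≢q) (sym e)
  where
  other : ∀ {l} (k : Fin l) j → j ≢ inject₁ k → j ≢ suc k → swapped k j ≡ j
  other zero    zero          p q = contradiction refl p
  other zero    (suc zero)    p q = contradiction refl q
  other zero    (suc (suc j)) p q = refl
  other (suc k) zero          p q = refl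
  other (suc k) (suc j)       p q = cong suc (other k j (p ∘ cong suc) (q ∘ cong suc))

U-tabulate : ∀ {N l} (k : Fin l) (c : Hecke.Fun {N} (suc l)) (g : Fin (suc l) → ℕ) →
  Hecke.U k c (Vec.tabulate g) ≡
  (if g (suc k) <ᵇ g (inject₁ k)
   then c (Vec.tabulate (g ∘ swapped k)) +ᴾ β *ᴾ c (Vec.tabulate g)
   else 0ᴾ)
U-tabulate {l = suc l} zero    c g = refl
U-tabulate {l = suc l} (suc k) c g = U-tabulate k (λ v → c (g zero ∷ v)) (g ∘ suc)

word : ∀ {n} → Permutation′ n → Word n
word w = Vec.tabulate (λ j → toℕ (w ⟨$⟩ʳ j))

word-cong : ∀ {n} (u w : Permutation′ n) → u Perm.≈ w → word u ≡ word w
word-cong u w e = Vec.tabulate-cong (cong toℕ ∘ e)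

-- Divided differences of the coefficients, and their agreement with 𝔊.

module Coefficients (m : ℕ) where

  open Hecke {suc m}
  open HeckeWords {suc m}

  -- The rows shift their `b`-variables by `B ∘ suc`, which calls for a sequence indexed by ℕ. Only
  -- indices below `m` occur in the product, and these `clamp` leaves unchanged.
  clamp : ℕ → Fin (suc m)
  clamp j = fromℕ< (s≤s (ℕ.m⊓n≤n j m))

  toℕ-clamp : ∀ {j} → j ≤ m → toℕ (clamp j) ≡ j
  toℕ-clamp j≤m = trans (Fin.toℕ-fromℕ< _) (ℕ.m≤n⇒m⊓n≡m j≤m)

  B : ℕ → Poly (suc m)
  B j = b (clamp j)

  coefficient : Factors m → Permutation′ (suc m) → Poly (suc m)
  coefficient L w = act L (δ 0) (word w)

  U-word : ∀ k c (w : Permutation′ (suc m)) → U k c (word w) ≡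
    (if does ((w ⟨$⟩ʳ suc k) Fin.<? (w ⟨$⟩ʳ inject₁ k))
     then c (word (w · s k)) +ᴾ β *ᴾ c (word w) else 0ᴾ)
  U-word k c w = trans (U-tabulate k c (λ j → toℕ (w ⟨$⟩ʳ j)))
    (cong (λ v → if does ((w ⟨$⟩ʳ suc k) Fin.<? (w ⟨$⟩ʳ inject₁ k))
                 then c v +ᴾ β *ᴾ c (word w) else 0ᴾ)
      (Vec.tabulate-cong (λ j → cong (λ i → toℕ (w ⟨$⟩ʳ i)) (swapped≗s k j))))

  -- The word of `w sₖ` has a descent at `k`, so `exchange` read there involves both `g₀` and `g₁`.
  -- Solved for the multiple `(p - q) g₀`, it yields the numerator of πₖ at `g₁`, and
  -- `quotient-exact` divides.
  π-coefficient : ∀ k w → (w ⟨$⟩ʳ inject₁ k) Fin.< (w ⟨$⟩ʳ suc k) →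
    π k (coefficient (stair m x B) (w · s k)) ≈ᴾ coefficient (stair m x B) w
  π-coefficient k w wp<wq = quotient-exact (Inversions.p≢q k) g₀ numerator
    where
    open ≈-Reasoning
    open Division (inject₁ k) (suc k) using (quotient-exact)
    module P = RingProperties (CommutativeRing.ring (polyRing (suc m)))
    F : Fun (suc m)
    F = act (stair m x B) (δ 0)
    p q : Poly (suc m)
    p = x (inject₁ k)
    q = x (suc k)
    g₀ g₁ : Poly (suc m)
    g₀ = F (word w)
    g₁ = F (word (w · s k))

    permuted : permuteX (s k) g₁ ≈ᴾ act (stair m (x ∘ swapped k) B) (δ 0) (word (w · s k))
    permuted = begin
      substX ρ g₁
        ≈⟨ substX-act ρ (stair m x B) (δ 0) _ ⟩
      act (map (map₂ (substX ρ)) (stair m x B)) (substX ρ ∘ δ 0) _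
        ≈⟨ act-cong (map (map₂ (substX ρ)) (stair m x B)) (λ v → ≡⇒≈ (substX-δ ρ 0 v)) _ ⟩
      act (map (map₂ (substX ρ)) (stair m x B)) (δ 0) _
        ≡⟨ cong (λ L → act L (δ 0) (word (w · s k))) (trans (substX-stair ρ m x B)
             (stair-cong m (λ i → cong x (sym (swapped≗s k i))) (λ _ → refl))) ⟩
      act (stair m (x ∘ swapped k) B) (δ 0) _ ∎
      where
      ρ : Fin (suc m) → Poly (suc m)
      ρ i = x (s k ⟨$⟩ʳ i)

    U-descent : U k F (word (w · s k)) ≡ g₀ +ᴾ β *ᴾ g₁
    U-descent = trans (U-word k F (w · s k)) (cong₂ (λ t v → if t then F v +ᴾ β *ᴾ g₁ else 0ᴾ)
      (dec-true ((w · s k ⟨$⟩ʳ suc k) Fin.<? (w · s k ⟨$⟩ʳ inject₁ k))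
        (subst₂ (λ i j → (w ⟨$⟩ʳ i) Fin.< (w ⟨$⟩ʳ j)) (sym (Inversions.s-q k))
            (sym (Inversions.s-p k)) wp<wq))
      (word-cong (w · s k · s k) w (λ j → cong (w ⟨$⟩ʳ_) (Inversions.s-involutive k j))))

    exchanged : (1ᴾ +ᴾ β *ᴾ p) *ᴾ permuteX (s k) g₁
        ≈ᴾ (1ᴾ +ᴾ β *ᴾ p) *ᴾ g₁ +ᴾ (q -ᴾ p) *ᴾ (g₀ +ᴾ β *ᴾ g₁)
    exchanged = begin
      (1ᴾ +ᴾ β *ᴾ p) *ᴾ permuteX (s k) g₁ ≈⟨ *-cong ≈-refl permuted ⟩
      (1ᴾ +ᴾ β *ᴾ p) *ᴾ act (stair m (x ∘ swapped k) B) (δ 0) _ ≈⟨ exchange k x B (δ 0) _ ⟨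
      H k (1ᴾ +ᴾ β *ᴾ p) (q -ᴾ p) F (word (w · s k)) ≡⟨ cong
          (λ t → (1ᴾ +ᴾ β *ᴾ p) *ᴾ g₁ +ᴾ (q -ᴾ p) *ᴾ t) U-descent ⟩
      (1ᴾ +ᴾ β *ᴾ p) *ᴾ g₁ +ᴾ (q -ᴾ p) *ᴾ (g₀ +ᴾ β *ᴾ g₁) ∎

    numerator : π-numerator k g₁ ≈ᴾ (p -ᴾ q) *ᴾ g₀
    numerator = begin
      (1ᴾ +ᴾ β *ᴾ q) *ᴾ g₁ -ᴾ C
        ≈⟨ +-cong cancelled ≈-refl ⟨
      ((p -ᴾ q) *ᴾ g₀ +ᴾ C) -ᴾ C
        ≈⟨ +-assoc _ _ _ ⟩
      (p -ᴾ q) *ᴾ g₀ +ᴾ (C -ᴾ C)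
        ≈⟨ +-cong ≈-refl (CommutativeRing.-‿inverseʳ (polyRing (suc m)) C) ⟩
      (p -ᴾ q) *ᴾ g₀ +ᴾ 0ᴾ
        ≈⟨ +-identityʳ _ ⟩
      (p -ᴾ q) *ᴾ g₀ ∎
      where
      C = (1ᴾ +ᴾ β *ᴾ p) *ᴾ permuteX (s k) g₁
      0≈ : ∀ (r : Poly (suc m)) → r -ᴾ r ≈ᴾ 0ᴾ
      0≈ = CommutativeRing.-‿inverseʳ (polyRing (suc m))
      cancelled : (p -ᴾ q) *ᴾ g₀ +ᴾ C ≈ᴾ (1ᴾ +ᴾ β *ᴾ q) *ᴾ g₁
      cancelled = begin
        (p -ᴾ q) *ᴾ g₀ +ᴾ C ≈⟨ +-cong ≈-refl exchanged ⟩
        (p -ᴾ q) *ᴾ g₀ +ᴾ ((1ᴾ +ᴾ β *ᴾ p) *ᴾ g₁ +ᴾ (q -ᴾ p) *ᴾ (g₀ +ᴾ β *ᴾ g₁))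
          ≈⟨ solve 7 (λ β p p⁻ q q⁻ g₀ g₁ →
               (p :+ q⁻) :* g₀ :+ ((con 1 :+ β :* p) :* g₁ :+ (q :+ p⁻) :* (g₀ :+ β :* g₁)) :=
               (con 1 :+ β :* q) :* g₁ :+ ((p :+ p⁻) :* (g₀ :+ β :* g₁) :+ (q :+ q⁻) :* g₀))
             ≈-refl β p (-ᴾ p) q (-ᴾ q) g₀ g₁ ⟩
        (1ᴾ +ᴾ β *ᴾ q) *ᴾ g₁ +ᴾ ((p -ᴾ p) *ᴾ (g₀ +ᴾ β *ᴾ g₁) +ᴾ (q -ᴾ q) *ᴾ g₀)
          ≈⟨ +-cong ≈-refl (≈-trans (+-cong (≈-trans (*-cong (0≈ p) ≈-refl) (zeroˡ _))
                                            (≈-trans (*-cong (0≈ q) ≈-refl) (zeroˡ _)))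
                                                (+-identityˡ _)) ⟩
        (1ᴾ +ᴾ β *ᴾ q) *ᴾ g₁ +ᴾ 0ᴾ ≈⟨ +-identityʳ _ ⟩
        (1ᴾ +ᴾ β *ᴾ q) *ᴾ g₁ ∎

  π-cong : ∀ k {g g′ : Poly (suc m)} → g ≈ᴾ g′ → π k g ≈ᴾ π k g′
  π-cong k e = Division.quotient-cong (inject₁ k) (suc k)
    (+-cong (*-cong (≈-refl {p = 1ᴾ +ᴾ β *ᴾ x (suc k)}) e)
      (neg-cong (*-cong (≈-refl {p = 1ᴾ +ᴾ β *ᴾ x (inject₁ k)}) (substX-cong _ e))))

  reverse-word : word (reverse {suc m}) ≡ decreasing (suc m)
  reverse-word = go (suc m)
    where
    go : ∀ l → Vec.tabulate {n = l} (toℕ ∘ opposite) ≡ decreasing l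
    go zero    = refl
    go (suc l) = cong₂ _∷_ (Fin.toℕ-fromℕ l)
      (trans (Vec.tabulate-cong (λ j → Fin.toℕ-inject₁ (opposite j))) (go l))

  -- By `stair-δ` all factors contribute. Counted from 0, the change of index `j = k - v` turns the
  -- range `v ≤ k < m` into `i + j < m`, the staircase of the definition.
  longest-coefficient : 𝔊-longest ≈ᴾ coefficient (stair m x B) reverse
  longest-coefficient = begin
    ∏ staircase (λ (i , j) → x i ⊕ b j)
      ≈⟨ ×-Big.⨀-↭ _ (unique-↭ staircase-unique κ-unique to from) ⟩
    ∏ (map κ (positions m)) (λ (i , j) → x i ⊕ b j)
      ≡⟨ ×-Big.⨀-map κ (positions m) _ ⟩
    ∏ (positions m) (weigh x B)
      ≡⟨ ×-Big.⨀-map (factor x B) (positions m) proj₂ ⟨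
    ∏ (map (factor x B) (positions m)) proj₂
      ≡⟨ cong (λ L → ∏ L proj₂) (stair-positions m x B) ⟨
    ∏ (stair m x B) proj₂
      ≈⟨ stair-δ m x B ⟨
    act (stair m x B) (δ 0) (decreasing (suc m))
      ≡⟨ cong (act (stair m x B) (δ 0)) reverse-word ⟨
    coefficient (stair m x B) reverse ∎
    where
    open ≈-Reasoning
    Index : Set
    Index = Fin (suc m) × Fin (suc m)

    In : Index → Set
    In (i , j) = suc (toℕ i) + suc (toℕ j) ≤ suc m

    in? : Decidable In
    in? (i , j) = suc (toℕ i) + suc (toℕ j) ℕ.≤? suc m

    staircase : List Index
    staircase = filter in? (cartesianProduct (allFin (suc m)) (allFin (suc m)))

    staircase-unique : Unique staircase
    staircase-unique = Unique.filter⁺ in?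
        (Unique.cartesianProduct⁺ (Unique.allFin⁺ _) (Unique.allFin⁺ _))

    κ : Fin (suc m) × Fin m → Index
    κ (v , k) = v , clamp (toℕ k ∸ toℕ v)

    toℕ-κ : ∀ (v : Fin (suc m)) (k : Fin m) → toℕ (clamp (toℕ k ∸ toℕ v)) ≡ toℕ k ∸ toℕ v
    toℕ-κ v k = toℕ-clamp (ℕ.≤-trans (ℕ.m∸n≤m (toℕ k) (toℕ v)) (ℕ.<⇒≤ (Fin.toℕ<n k)))

    κ-unique : Unique (map κ (positions m))
    κ-unique = unique-map κ
      (λ { {v , k} {v′ , k′} p p′ e → case cong proj₁ e of λ { refl →
        cong (v ,_) (Fin.toℕ-injective (ℕ.∸-cancelʳ-≡ (∈-positions⁻ m p) (∈-positions⁻ m p′)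
          (trans (sym (toℕ-κ v k)) (trans (cong (toℕ ∘ proj₂) e) (toℕ-κ v k′))))) } })
      (positions-unique m)

    to : ∀ {a} → a ∈ staircase → a ∈ map κ (positions m)
    to {i , j} a∈ = subst (_∈ map κ (positions m)) (cong (i ,_) (Fin.toℕ-injective eq))
      (∈.∈-map⁺ κ (∈-positions⁺ m (subst (toℕ i ≤_) (sym toℕ-k) (ℕ.m≤m+n (toℕ i) (toℕ j)))))
      where
      k<m : toℕ i + toℕ j < m
      k<m = ℕ.≤-pred (subst (_≤ suc m) (ℕ.+-suc (suc (toℕ i)) (toℕ j))
          (proj₂ (∈.∈-filter⁻ in? {xs = cartesianProduct (allFin (suc m)) (allFin (suc m))} a∈)))
      k : Fin m
      k = fromℕ< k<m
      toℕ-k : toℕ k ≡ toℕ i + toℕ j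
      toℕ-k = Fin.toℕ-fromℕ< k<m
      eq : toℕ (clamp (toℕ k ∸ toℕ i)) ≡ toℕ j
      eq = trans (toℕ-κ i k) (trans (cong (_∸ toℕ i) toℕ-k) (ℕ.m+n∸m≡n (toℕ i) (toℕ j)))

    from : ∀ {a} → a ∈ map κ (positions m) → a ∈ staircase
    from a∈ with ((v , k) , p , refl) ← ∈.∈-map⁻ κ a∈ =
      ∈.∈-filter⁺ in? (∈.∈-cartesianProduct⁺ (∈.∈-allFin v) (∈.∈-allFin _))
        (subst (λ d → suc (toℕ v) + suc d ≤ suc m) (sym (toℕ-κ v k))
          (subst (_≤ suc m) (sym (trans (ℕ.+-suc (suc (toℕ v)) _)
              (cong (λ j → suc (suc j)) (ℕ.m+[n∸m]≡n (∈-positions⁻ m p)))))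
            (s≤s (Fin.toℕ<n k))))

  𝔊-by-coefficient : ∀ {w} (cs : Choices w) → 𝔊-by cs ≈ᴾ coefficient (stair m x B) w
  𝔊-by-coefficient {w} (longest e) = ≈-trans longest-coefficient
    (≡⇒≈ (cong (act (stair m x B) (δ 0)) (word-cong reverse w (sym ∘ e))))
  𝔊-by-coefficient {w} (step k ℓ≡ cs) =
    ≈-trans (π-cong k (𝔊-by-coefficient cs)) (π-coefficient k w ascent)
    where
    ascent : (w ⟨$⟩ʳ inject₁ k) Fin.< (w ⟨$⟩ʳ suc k)
    ascent with Inversions.ascent⊎descent k w
    ... | inj₁ a = a
    ... | inj₂ d = contradiction (trans (Inversions.ℓ-descent k w d) (cong suc ℓ≡))
        (ℕ.<⇒≢ (s≤s (ℕ.n≤1+n _)))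

-- Monotonicity of 321-avoiding permutations.

module _ {n : ℕ} where

  perm-injective : ∀ (u : Permutation′ n) {i j} → u ⟨$⟩ʳ i ≡ u ⟨$⟩ʳ j → i ≡ j
  perm-injective u e = trans (sym (Perm.inverseˡ u)) (trans (cong (u ⟨$⟩ˡ_) e) (Perm.inverseˡ u))

  perm-≮ : ∀ (u : Permutation′ n) {i j} → i ≢ j → ¬ (u ⟨$⟩ʳ i) Fin.< (u ⟨$⟩ʳ j) →
      (u ⟨$⟩ʳ j) Fin.< (u ⟨$⟩ʳ i)
  perm-≮ u {i} {j} i≢j ≮ = ℕ.≤∧≢⇒< (ℕ.≮⇒≥ ≮)
      (λ e → i≢j (sym (perm-injective u (Fin.toℕ-injective e))))

  -- Pigeonhole: a position from `a` on with a value below `a` would, together with the `a`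
  -- positions below, inject `a + 1` positions into `a` values.
  preserves-below⇒above : ∀ (u : Permutation′ n) a → (∀ j → toℕ j < a → toℕ (u ⟨$⟩ʳ j) < a) →
                          ∀ j → a ≤ toℕ j → a ≤ toℕ (u ⟨$⟩ʳ j)
  preserves-below⇒above u a below j a≤j = ℕ.≮⇒≥ λ uj<a →
    contradiction (Fin.injective⇒≤ {f = g uj<a} (g-injective uj<a)) (ℕ.<-irrefl refl)
    where
    a≤n : a ≤ n
    a≤n = ℕ.<⇒≤ (ℕ.≤-<-trans a≤j (Fin.toℕ<n j))

    emb : Fin a → Fin n
    emb i = inject≤ i a≤n

    emb<a : ∀ i → toℕ (emb i) < a
    emb<a i = subst (_< a) (sym (Fin.toℕ-inject≤ i a≤n)) (Fin.toℕ<n i)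

    g : toℕ (u ⟨$⟩ʳ j) < a → Fin (suc a) → Fin a
    g uj<a zero    = fromℕ< uj<a
    g uj<a (suc i) = fromℕ< (below (emb i) (emb<a i))

    back : ∀ {i k} (p : toℕ (u ⟨$⟩ʳ i) < a) (q : toℕ (u ⟨$⟩ʳ k) < a) → fromℕ< p ≡ fromℕ< q → i ≡ k
    back p q e = perm-injective u (Fin.toℕ-injective (Fin.fromℕ<-injective _ _ p q e))

    g-injective : ∀ p {i k} → g p i ≡ g p k → i ≡ k
    g-injective p {zero}  {zero}  e = refl
    g-injective p {zero}  {suc k} e = contradiction
        (subst (a ≤_) (cong toℕ (back p (below (emb k) (emb<a k)) e)) a≤j) (ℕ.<⇒≱ (emb<a k))
    g-injective p {suc i} {zero}  e = contradiction
        (subst (a ≤_) (cong toℕ (back p (below (emb i) (emb<a i)) (sym e))) a≤j) (ℕ.<⇒≱ (emb<a i))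
    g-injective p {suc i} {suc k} e = cong suc
        (Fin.inject≤-injective a≤n a≤n i k
        (back (below (emb i) (emb<a i)) (below (emb k) (emb<a k)) e))

  preserves-above⇒below : ∀ (u : Permutation′ n) a → (∀ j → a ≤ toℕ j → a ≤ toℕ (u ⟨$⟩ʳ j)) →
                          ∀ j → toℕ j < a → toℕ (u ⟨$⟩ʳ j) < a
  preserves-above⇒below u a above j j<a = ℕ.≰⇒> λ a≤uj → contradiction j<a (ℕ.≤⇒≯
    (subst (a ≤_) (cong toℕ (Perm.inverseˡ u))
        (preserves-below⇒above (flip u) a below (u ⟨$⟩ʳ j) a≤uj)))
    where
    below : ∀ i → toℕ i < a → toℕ (u ⟨$⟩ˡ i) < a
    below i i<a = ℕ.≰⇒> λ a≤ → contradiction i<a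
      (ℕ.≤⇒≯ (subst (a ≤_) (cong toℕ (Perm.inverseʳ u)) (above _ a≤)))

  module _ (w : Permutation′ n) (avoids : Avoids321 w) where

    -- Suppose w(k) < w(j). By avoidance no i < j has w(i) > w(j). As w(j) ≤ j, the positions below
    -- w(j) then keep values below w(j), so w sends the later position k to a value of at least
    -- w(j).
    nonexcedances-increase : ∀ {j k} → toℕ (w ⟨$⟩ʳ j) ≤ toℕ j → j Fin.< k →
        (w ⟨$⟩ʳ j) Fin.< (w ⟨$⟩ʳ k)
    nonexcedances-increase {j} {k} wj≤j j<k with (w ⟨$⟩ʳ k) Fin.<? (w ⟨$⟩ʳ j)
    ... | no wk≮wj = perm-≮ w (λ e → ℕ.<⇒≢ j<k (cong toℕ (sym e))) wk≮wj
    ... | yes wk<wj with Fin.any? (λ i → (i Fin.<? j) ×-dec ((w ⟨$⟩ʳ j) Fin.<? (w ⟨$⟩ʳ i)))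
    ...   | yes (i , i<j , wj<wi) = contradiction (wj<wi , wk<wj) (avoids i j k i<j j<k)
    ...   | no none = contradiction wk<wj (ℕ.≤⇒≯ (preserves-below⇒above w (toℕ (w ⟨$⟩ʳ j))
      (λ i i<wj → let i<j = ℕ.<-≤-trans i<wj wj≤j in
        perm-≮ w (λ e → ℕ.<⇒≢ i<j (cong toℕ (sym e))) (λ wj<wi → none (i , i<j , wj<wi)))
      k (ℕ.≤-trans wj≤j (ℕ.<⇒≤ j<k))))

    -- The mirror image: if w(j) < w(i), avoidance makes w preserve the set of positions above w(j),
    -- hence also its complement, which contains i.
    excedances-increase : ∀ {i j} → j Fin.< (w ⟨$⟩ʳ j) → i Fin.< j → (w ⟨$⟩ʳ i) Fin.< (w ⟨$⟩ʳ j)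
    excedances-increase {i} {j} j<wj i<j with (w ⟨$⟩ʳ j) Fin.<? (w ⟨$⟩ʳ i)
    ... | no wj≮wi = perm-≮ w (λ e → ℕ.<⇒≢ i<j (cong toℕ (sym e))) wj≮wi
    ... | yes wj<wi with Fin.any? (λ k → (j Fin.<? k) ×-dec ((w ⟨$⟩ʳ k) Fin.<? (w ⟨$⟩ʳ j)))
    ...   | yes (k , j<k , wk<wj) = contradiction (wj<wi , wk<wj) (avoids i j k i<j j<k)
    ...   | no none = contradiction (preserves-above⇒below w (suc (toℕ (w ⟨$⟩ʳ j)))
      (λ k wj<k → let j<k = ℕ.<-trans j<wj wj<k in
        perm-≮ w (λ e → ℕ.<⇒≢ j<k (cong toℕ (sym e))) (λ wk<wj → none (k , j<k , wk<wj)))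
      i (ℕ.<-trans (ℕ.<-trans i<j j<wj) (ℕ.n<1+n _))) (ℕ.≤⇒≯ wj<wi)

mono-gap : ∀ {r n} (g : Fin r → Fin n) → (∀ {i j} → i Fin.< j → g i Fin.< g j) →
           ∀ d {i j} → toℕ j ≡ toℕ i + d → toℕ (g i) + d ≤ toℕ (g j)
mono-gap g mono zero e =
  ℕ.≤-reflexive (trans (ℕ.+-identityʳ _) (cong (toℕ ∘ g)
      (Fin.toℕ-injective (sym (trans e (ℕ.+-identityʳ _))))))
mono-gap {r} g mono (suc d) {i} {j} e = subst (_≤ toℕ (g j)) (sym (ℕ.+-suc _ d))
  (ℕ.≤-<-trans (mono-gap g mono d (Fin.toℕ-fromℕ< lt))
      (mono (subst (_< toℕ j) (sym (Fin.toℕ-fromℕ< lt)) i+d<j)))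
  where
  i+d<j : toℕ i + d < toℕ j
  i+d<j = ℕ.≤-reflexive (trans (sym (ℕ.+-suc (toℕ i) d)) (sym e))
  lt : toℕ i + d < r
  lt = ℕ.<-trans i+d<j (Fin.toℕ<n j)

-- The permutations below w in the left-to-right weak order: those that send
-- the positions g to the values y and are increasing elsewhere.
record Shuffle {n r : ℕ} (y : Fin r → Fin n) (g : Fin r → Fin n) (u : Permutation′ n) : Set where
  field
    on   : ∀ i → u ⟨$⟩ʳ g i ≡ y i
    off  : ∀ {j k} → (∀ i → g i ≢ j) → (∀ i → g i ≢ k) → j Fin.< k → (u ⟨$⟩ʳ j) Fin.< (u ⟨$⟩ʳ k)
    mono : ∀ {i j} → i Fin.< j → g i Fin.< g j
    ≤y   : ∀ i → toℕ (g i) ≤ toℕ (y i)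

  mono⁻ : ∀ {i j} → g i Fin.< g j → i Fin.< j
  mono⁻ {i} {j} gi<gj with Fin.<-cmp i j
  ... | tri< i<j _ _  = i<j
  ... | tri≈ _ refl _ = contradiction gi<gj (ℕ.<-irrefl refl)
  ... | tri> _ _ j<i  = contradiction gi<gj (ℕ.<-asym (mono j<i))

  g-injective : ∀ {i j} → g i ≡ g j → i ≡ j
  g-injective {i} {j} e with Fin.<-cmp i j
  ... | tri< i<j _ _ = contradiction (cong toℕ e) (ℕ.<⇒≢ (mono i<j))
  ... | tri≈ _ i≡j _ = i≡j
  ... | tri> _ _ j<i = contradiction (cong toℕ (sym e)) (ℕ.<⇒≢ (mono j<i))

  mono⁻-≤ : ∀ {i j} → toℕ (g i) ≤ toℕ (g j) → i ≡ j ⊎ i Fin.< j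
  mono⁻-≤ {i} {j} gi≤gj with ℕ.m≤n⇒m<n∨m≡n gi≤gj
  ... | inj₁ lt = inj₂ (mono⁻ lt)
  ... | inj₂ e  = inj₁ (g-injective (Fin.toℕ-injective e))

-- Descents and removable corners.

module _ {m r : ℕ} {y : Fin r → Fin (suc m)} (y-mono : ∀ {i j} → i Fin.< j → y i Fin.< y j) where

  module _ {g u} (R : Shuffle y g u) (k : Fin m) where

    open Shuffle R

    private
      p q : Fin (suc m)
      p = inject₁ k
      q = suc k

      p<q : p Fin.< q
      p<q = Inversions.p<q k

      toℕ-p : toℕ p ≡ toℕ k
      toℕ-p = Fin.toℕ-inject₁ k

    -- A corner labelled `k` in row `i` of the shape whose row `i` has the labels from `g i` up to
    -- `y i - 1`: nothing stands to its right, as `g i` is `k`, and nothing below it, as no `g j` is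
    -- `k + 1`.
    Removable : Fin r → Set
    Removable i = g i ≡ p × toℕ k < toℕ (y i) × (∀ j → g j ≢ q)

    private
      member? : ∀ j → Dec (∃ λ i → g i ≡ j)
      member? j = Fin.any? (λ i → g i Fin.≟ j)

      -- The positions of `g` from `q` on have values of at least `q` because `g i ≤ y i`. With the
      -- hypothesis for the others, the set of positions from `q` on is preserved, and so is its
      -- complement, where `p` lies.
      above : (∀ {j} → (∀ i → g i ≢ j) → toℕ q ≤ toℕ j → toℕ q ≤ toℕ (u ⟨$⟩ʳ j)) →
              toℕ (u ⟨$⟩ʳ p) < toℕ q
      above h = preserves-above⇒below u (toℕ q) go p p<q
        where
        go : ∀ j → toℕ q ≤ toℕ j → toℕ q ≤ toℕ (u ⟨$⟩ʳ j)
        go j q≤j with member? j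
        ... | yes (i , refl) = ℕ.≤-trans q≤j (subst (λ v → toℕ (g i) ≤ toℕ v) (sym (on i)) (≤y i))
        ... | no j∉g = h (λ i e → j∉g (i , e)) q≤j

    -- If both or neither of `p` and `q` are positions of `g`, monotonicity forces an ascent. If
    -- only `q` is, the descent puts the value at `p` above `q`, while `above` puts it below. If
    -- only `p` is, then `y i ≤ k` would make `u` preserve the positions up to `k`, so that the
    -- value at `q` would be at least `q` and there would be no descent.
    descent⇒removable : (u ⟨$⟩ʳ q) Fin.< (u ⟨$⟩ʳ p) → ∃ Removable
    descent⇒removable uq<up with member? p | member? q
    ... | yes (i , gi≡p) | yes (j , gj≡q) = contradiction uq<up (ℕ.<-asym
      (subst₂ Fin._<_ (trans (sym (on i)) (cong (u ⟨$⟩ʳ_) gi≡p))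
          (trans (sym (on j)) (cong (u ⟨$⟩ʳ_) gj≡q))
        (y-mono (mono⁻ (subst₂ Fin._<_ (sym gi≡p) (sym gj≡q) p<q)))))
    ... | no p∉g | no q∉g =
      contradiction uq<up (ℕ.<-asym (off (λ i e → p∉g (i , e)) (λ i e → q∉g (i , e)) p<q))
    ... | no p∉g | yes (i , gi≡q) = contradiction
      (above λ {j} j∉g q≤j → ℕ.<⇒≤ (ℕ.≤-<-trans q≤up
          (off (λ i e → p∉g (i , e)) j∉g (ℕ.<-≤-trans p<q q≤j))))
      (ℕ.≤⇒≯ q≤up)
      where
      q≤up : toℕ q ≤ toℕ (u ⟨$⟩ʳ p)
      q≤up = ℕ.≤-trans (subst₂ (λ a v → toℕ a ≤ toℕ v) gi≡q
          (trans (sym (on i)) (cong (u ⟨$⟩ʳ_) gi≡q)) (≤y i))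
                       (ℕ.<⇒≤ uq<up)
    ... | yes (i , gi≡p) | no q∉g = i , gi≡p , ℕ.≰⇒> ¬y≤k , (λ j e → q∉g (j , e))
      where
      up≡y : u ⟨$⟩ʳ p ≡ y i
      up≡y = trans (cong (u ⟨$⟩ʳ_) (sym gi≡p)) (on i)

      ¬y≤k : ¬ toℕ (y i) ≤ toℕ k
      ¬y≤k yi≤k = contradiction
        (preserves-below⇒above u (toℕ q) below q ℕ.≤-refl)
        (ℕ.<⇒≱ (ℕ.<-trans (ℕ.<-≤-trans uq<up (subst (λ v → toℕ v ≤ toℕ k) (sym up≡y) yi≤k))
            (ℕ.n<1+n _)))
        where
        below : ∀ j → toℕ j < toℕ q → toℕ (u ⟨$⟩ʳ j) < toℕ q
        below j (s≤s j≤k) with member? j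
        ... | yes (i′ , refl) = s≤s (ℕ.≤-trans (subst (λ v → toℕ v ≤ toℕ (y i)) (sym (on i′))
                (case mono⁻-≤ (subst (toℕ (g i′) ≤_)
                    (trans (sym toℕ-p) (cong toℕ (sym gi≡p))) j≤k) of λ
                  { (inj₁ refl) → ℕ.≤-refl ; (inj₂ lt) → ℕ.<⇒≤ (y-mono lt) })) yi≤k)
        ... | no j∉g = ℕ.<-trans (off (λ i e → j∉g (i , e)) (λ i e → q∉g (i , e)) (s≤s j≤k))
                (ℕ.<-≤-trans uq<up (ℕ.≤-trans (subst (λ v → toℕ v ≤ toℕ k) (sym up≡y) yi≤k)
                    (ℕ.n≤1+n _)))

    -- With an ascent at `k`, all positions outside `g` from `q` on would have values above that of
    -- `p`, which is `y i ≥ q`; then `above` would put the value at `p` below `q`.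
    removable⇒descent : ∃ Removable → (u ⟨$⟩ʳ q) Fin.< (u ⟨$⟩ʳ p)
    removable⇒descent (i , gi≡p , k<yi , q∉g) with (u ⟨$⟩ʳ q) Fin.<? (u ⟨$⟩ʳ p)
    ... | yes d = d
    ... | no ¬d = contradiction (above h) (ℕ.≤⇒≯ q≤up)
      where
      up<uq : (u ⟨$⟩ʳ p) Fin.< (u ⟨$⟩ʳ q)
      up<uq = perm-≮ u (λ e → Inversions.p≢q k (sym e)) ¬d

      q≤up : toℕ q ≤ toℕ (u ⟨$⟩ʳ p)
      q≤up = subst (λ v → toℕ k < toℕ v) (trans (sym (on i)) (cong (u ⟨$⟩ʳ_) gi≡p)) k<yi

      h : ∀ {j} → (∀ i → g i ≢ j) → toℕ q ≤ toℕ j → toℕ q ≤ toℕ (u ⟨$⟩ʳ j)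
      h {j} j∉g q≤j with ℕ.m≤n⇒m<n∨m≡n q≤j
      ... | inj₁ q<j = ℕ.<⇒≤ (ℕ.≤-<-trans q≤up (ℕ.<-trans up<uq (off q∉g j∉g q<j)))
      ... | inj₂ e with refl ← Fin.toℕ-injective {i = q} {j} e = ℕ.<⇒≤ (ℕ.≤-<-trans q≤up up<uq)

    -- The shape without the corner: the value `y i` moves from position `k` to `k + 1`.
    advance : Fin r → Fin r → Fin (suc m)
    advance i = updateAt g i (const q)

    advance-shuffle : ∀ {i} → Removable i → Shuffle y (advance i) (u · s k)
    advance-shuffle {i} (gi≡p , k<yi , q∉g) = record
      { on = on′ ; off = off′ ; mono = mono′ ; ≤y = ≤y′ }
      where
      at : advance i i ≡ q
      at = Vector.updateAt-updates i g

      away : ∀ {j} → j ≢ i → advance i j ≡ g j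
      away {j} j≢i = Vector.updateAt-minimal j i g j≢i

      g≢p : ∀ {j} → j ≢ i → g j ≢ p
      g≢p j≢i e = j≢i (g-injective (trans e (sym gi≡p)))

      s-g : ∀ {j} → j ≢ i → s k ⟨$⟩ʳ g j ≡ g j
      s-g {j} j≢i = Inversions.s-other k (g≢p j≢i) (q∉g j)

      on′ : ∀ j → (u · s k) ⟨$⟩ʳ advance i j ≡ y j
      on′ j with j Fin.≟ i
      ... | yes refl = trans (cong ((u · s k) ⟨$⟩ʳ_) at)
              (trans (cong (u ⟨$⟩ʳ_) (trans (Inversions.s-q k) (sym gi≡p))) (on i))
      ... | no j≢i = trans (cong ((u · s k) ⟨$⟩ʳ_) (away j≢i))
          (trans (cong (u ⟨$⟩ʳ_) (s-g j≢i)) (on j))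

      mono′ : ∀ {a c} → a Fin.< c → advance i a Fin.< advance i c
      mono′ {a} {c} a<c with a Fin.≟ i | c Fin.≟ i
      ... | yes refl | yes refl = contradiction a<c (ℕ.<-irrefl refl)
      ... | yes refl | no c≢i = subst₂ Fin._<_ (sym at) (sym (away c≢i))
              (ℕ.≤∧≢⇒< (subst (λ v → suc v ≤ toℕ (g c)) (trans (cong toℕ gi≡p) toℕ-p) (mono a<c))
                       (λ e → q∉g c (Fin.toℕ-injective (sym e))))
      ... | no a≢i | yes refl = subst₂ Fin._<_ (sym (away a≢i)) (sym at)
              (ℕ.<-trans (subst (g a Fin.<_) gi≡p (mono a<c)) p<q)
      ... | no a≢i | no c≢i = subst₂ Fin._<_ (sym (away a≢i)) (sym (away c≢i)) (mono a<c)

      ≤y′ : ∀ j → toℕ (advance i j) ≤ toℕ (y j)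
      ≤y′ j with j Fin.≟ i
      ... | yes refl = subst (λ v → toℕ v ≤ toℕ (y i)) (sym at) k<yi
      ... | no j≢i   = subst (λ v → toℕ v ≤ toℕ (y j)) (sym (away j≢i)) (≤y j)

      off-s : ∀ {j} → (∀ a → advance i a ≢ j) → ∀ a → g a ≢ s k ⟨$⟩ʳ j
      off-s {j} j∉ a e with a Fin.≟ i
      ... | yes refl = j∉ i (trans at (trans (sym (Inversions.s-p k))
              (trans (cong (s k ⟨$⟩ʳ_) (trans (sym gi≡p) e)) (Inversions.s-involutive k j))))
      ... | no a≢i   = j∉ a (trans (away a≢i) (trans (sym (s-g a≢i))
              (trans (cong (s k ⟨$⟩ʳ_) e) (Inversions.s-involutive k j))))

      off′ : ∀ {j c} → (∀ a → advance i a ≢ j) → (∀ a → advance i a ≢ c) → j Fin.< c →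
             ((u · s k) ⟨$⟩ʳ j) Fin.< ((u · s k) ⟨$⟩ʳ c)
      off′ {j} {c} j∉ c∉ j<c = off (off-s j∉) (off-s c∉)
        (Inversions.s-mono k (λ (_ , e) → c∉ i (trans at (sym e))) j<c)

  -- A corner in row `i` needs `g i < y i`. With none there are no descents.
  shuffle-id : ∀ {g u} → Shuffle y g u → (∀ i → g i ≡ y i) → ∀ j → u ⟨$⟩ʳ j ≡ j
  shuffle-id {g} {u} R g≡y = Inversions.increasing⇒id (u ⟨$⟩ʳ_) λ k →
    case Inversions.ascent⊎descent k u of λ where
      (inj₁ a) → a
      (inj₂ d) → case descent⇒removable R k d of λ where
        (i , gi≡p , k<yi , _) → contradiction k<yi (ℕ.<-irrefl
          (trans (sym (Fin.toℕ-inject₁ k)) (cong toℕ (trans (sym gi≡p) (g≡y i)))))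

-- Fillings, insertion and deletion of an entry, and weights.

module Fillings {n size : ℕ} where

  Filling : Set
  Filling = Vec (Subset n) size

  insert delete : Fin size → Fin n → Filling → Filling
  insert t v T = T [ t ]≔ (lookup T t [ v ]≔ inside)
  delete t v T = T [ t ]≔ (lookup T t [ v ]≔ outside)

  private
    ∈-[]≔ : ∀ (A : Subset n) {v v′} a → v′ ≢ v → lookup (A [ v ]≔ a) v′ ≡ lookup A v′
    ∈-[]≔ A a v′≢v = Vec.lookup∘update′ v′≢v A a

    same : ∀ t (T : Filling) A → lookup (T [ t ]≔ A) t ≡ A
    same t T A = Vec.lookup∘update t T A

    other : ∀ {t t′} (T : Filling) A → t′ ≢ t → lookup (T [ t ]≔ A) t′ ≡ lookup T t′
    other T A t′≢t = Vec.lookup∘update′ t′≢t T A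

  module _ (t : Fin size) (v : Fin n) (T : Filling) where

    insert-new : v ∈ˢ lookup (insert t v T) t
    insert-new = subst (v ∈ˢ_) (sym (same t T _)) (Vec.[]≔-updates (lookup T t) v)

    insert-old : ∀ {t′ v′} → v′ ∈ˢ lookup T t′ → v′ ∈ˢ lookup (insert t v T) t′
    insert-old {t′} {v′} h with t′ Fin.≟ t | v′ Fin.≟ v
    ... | no t′≢t  | _        = subst (v′ ∈ˢ_) (sym (other T _ t′≢t)) h
    ... | yes refl | yes refl = insert-new
    ... | yes refl | no v′≢v  = subst (v′ ∈ˢ_) (sym (same t T _))
      (Vec.lookup⇒[]= v′ _ (trans (∈-[]≔ (lookup T t) inside v′≢v) (Vec.[]=⇒lookup h)))

    insert-∈⁻ : ∀ {t′ v′} → v′ ∈ˢ lookup (insert t v T) t′ → (t′ ≡ t × v′ ≡ v) ⊎ v′ ∈ˢ lookup T t′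
    insert-∈⁻ {t′} {v′} h with t′ Fin.≟ t | v′ Fin.≟ v
    ... | no t′≢t  | _        = inj₂ (subst (v′ ∈ˢ_) (other T _ t′≢t) h)
    ... | yes refl | yes refl = inj₁ (refl , refl)
    ... | yes refl | no v′≢v  = inj₂ (Vec.lookup⇒[]= v′ _
      (trans (sym (∈-[]≔ (lookup T t) inside v′≢v))
          (Vec.[]=⇒lookup (subst (v′ ∈ˢ_) (same t T _) h))))

    delete-gone : v ∉ˢ lookup (delete t v T) t
    delete-gone h = contradiction
      (trans (sym (Vec.[]=⇒lookup (subst (v ∈ˢ_) (same t T _) h)))
          (Vec.lookup∘update v (lookup T t) outside)) λ ()

    delete-keeps : ∀ {t′ v′} → ¬ (t′ ≡ t × v′ ≡ v) → v′ ∈ˢ lookup T t′ →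
        v′ ∈ˢ lookup (delete t v T) t′
    delete-keeps {t′} {v′} ne h with t′ Fin.≟ t | v′ Fin.≟ v
    ... | no t′≢t  | _        = subst (v′ ∈ˢ_) (sym (other T _ t′≢t)) h
    ... | yes refl | yes refl = contradiction (refl , refl) ne
    ... | yes refl | no v′≢v  = subst (v′ ∈ˢ_) (sym (same t T _))
      (Vec.lookup⇒[]= v′ _ (trans (∈-[]≔ (lookup T t) outside v′≢v) (Vec.[]=⇒lookup h)))

    delete-∈⁻ : ∀ {t′ v′} → v′ ∈ˢ lookup (delete t v T) t′ → ¬ (t′ ≡ t × v′ ≡ v) × v′ ∈ˢ lookup T t′
    delete-∈⁻ {t′} {v′} h with t′ Fin.≟ t | v′ Fin.≟ v
    ... | no t′≢t  | _        = (t′≢t ∘ proj₁) , subst (v′ ∈ˢ_) (other T _ t′≢t) h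
    ... | yes refl | yes refl = contradiction h delete-gone
    ... | yes refl | no v′≢v  = (v′≢v ∘ proj₂) , Vec.lookup⇒[]= v′ _
      (trans (sym (∈-[]≔ (lookup T t) outside v′≢v))
          (Vec.[]=⇒lookup (subst (v′ ∈ˢ_) (same t T _) h)))

  filling-ext : ∀ {T T′ : Filling} → (∀ {t v} → v ∈ˢ lookup T t → v ∈ˢ lookup T′ t) →
                (∀ {t v} → v ∈ˢ lookup T′ t → v ∈ˢ lookup T t) → T ≡ T′
  filling-ext {T} {T′} f g = trans (sym (Vec.tabulate∘lookup T))
    (trans (Vec.tabulate-cong (λ t → Subset.⊆-antisym f g)) (Vec.tabulate∘lookup T′))

  insert-delete : ∀ t v T → v ∈ˢ lookup T t → insert t v (delete t v T) ≡ T
  insert-delete t v T h = filling-ext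
    (λ h′ → case insert-∈⁻ t v (delete t v T) h′ of λ where
      (inj₁ (refl , refl)) → h
      (inj₂ h″) → proj₂ (delete-∈⁻ t v T h″))
    (λ {t′} {v′} h′ → case ((t′ Fin.≟ t) , (v′ Fin.≟ v)) of λ where
      (yes refl , yes refl) → insert-new t v (delete t v T)
      (no t′≢t , _) → insert-old t v (delete t v T) (delete-keeps t v T (t′≢t ∘ proj₁) h′)
      (_ , no v′≢v) → insert-old t v (delete t v T) (delete-keeps t v T (v′≢v ∘ proj₂) h′))

  delete-insert : ∀ t v T → v ∉ˢ lookup T t → delete t v (insert t v T) ≡ T
  delete-insert t v T v∉ = filling-ext
    (λ h′ → let ne , h″ = delete-∈⁻ t v (insert t v T) h′ in case insert-∈⁻ t v T h″ of λ where
      (inj₁ e)  → contradiction e ne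
      (inj₂ h‴) → h‴)
    (λ h′ → delete-keeps t v (insert t v T) (λ { (refl , refl) → v∉ h′ }) (insert-old t v T h′))

module Cardinality {n : ℕ} where

  module ℕΣ = Sum ℕ.+-0-commutativeMonoid

  card : Subset n → ℕ
  card A = ℕΣ.sum (λ v → 𝟙 (v Subset.∈? A))

  card-empty : ∀ {A} → ¬ Nonempty A → card A ≡ 0
  card-empty {A} ¬ne = Inversions.sum-0 (λ v → 𝟙 (v Subset.∈? A))
    (λ v → Inversions.𝟙-no (v Subset.∈? A) (λ h → ¬ne (v , h)))

  card-insert : ∀ {A A′ : Subset n} v → v ∉ˢ A → v ∈ˢ A′ → (∀ {v′} → v′ ≢ v → v′ ∈ˢ A → v′ ∈ˢ A′) →
                (∀ {v′} → v′ ≢ v → v′ ∈ˢ A′ → v′ ∈ˢ A) → card A′ ≡ suc (card A)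
  card-insert {A} {A′} v v∉ v∈ f g = ℕ-Big.sum-modify (λ v′ → 𝟙 (v′ Subset.∈? A)) _ v 1
    (trans (Inversions.𝟙-yes (v Subset.∈? A′) v∈)
        (cong suc (sym (Inversions.𝟙-no (v Subset.∈? A) v∉))))
    (λ v′ v′≢v → Inversions.𝟙-⇔ (v′ Subset.∈? A′) (v′ Subset.∈? A) (g v′≢v) (f v′≢v))

  card-nonempty : ∀ {A} → Nonempty A → 1 ≤ card A
  card-nonempty {A} (v , h) = ℕ.≤-trans (ℕ.≤-reflexive (sym (Inversions.𝟙-yes (v Subset.∈? A) h)))
      (term≤sum _ v)
    where
    term≤sum : ∀ {k} (g : Fin k → ℕ) i → g i ≤ ℕΣ.sum g
    term≤sum g zero    = ℕ.m≤m+n _ _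
    term≤sum g (suc i) = ℕ.≤-trans (term≤sum (g ∘ suc) i) (ℕ.m≤n+m _ _)

  length-⨀ : ∀ {A : Set} (as : List A) → length as ≡ ℕ-Big.⨀ as (λ _ → 1)
  length-⨀ []       = refl
  length-⨀ (a ∷ as) = cong suc (length-⨀ as)

  length-elements : ∀ A → length (elements A) ≡ card A
  length-elements A = trans (length-⨀ (elements A))
      (trans (ℕ-Big.⨀-filter (Subset._∈? A) (allFin n) (λ _ → 1))
    (ℕ-Big.⨀-tabulate id (λ v → 𝟙 (v Subset.∈? A))))

module Weights {N n size : ℕ} (ω : Fin size → Fin n → Poly N) where

  open Fillings {n} {size}
  open Cardinality {n}
  module ×Π = Sum (CommutativeRing.*-commutativeMonoid (polyRing N))

  -- `×Π.sum` is a product. It runs over all values, with `1ᴾ` for absent ones, so that an insertion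
  -- changes exactly one factor.
  box-weight : Fin size → Subset n → Poly N
  box-weight t A = ×Π.sum (λ v → if does (v Subset.∈? A) then ω t v else 1ᴾ)

  excess : Filling → ℕ
  excess T = ℕΣ.sum (λ t → card (lookup T t) ∸ 1)

  weight : Filling → Poly N
  weight T = β ^ᴾ excess T *ᴾ ×Π.sum (λ t → box-weight t (lookup T t))

  module _ (t : Fin size) (v : Fin n) (T : Filling) (v∉ : v ∉ˢ lookup T t) where

    private
      T′ : Filling
      T′ = insert t v T

      untouched : ∀ t′ → t′ ≢ t → lookup T′ t′ ≡ lookup T t′
      untouched t′ t′≢t = Vec.lookup∘update′ t′≢t T _

      box⁺ : ∀ {v′} → v′ ≢ v → v′ ∈ˢ lookup T t → v′ ∈ˢ lookup T′ t
      box⁺ _ = insert-old t v T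

      box⁻ : ∀ {v′} → v′ ≢ v → v′ ∈ˢ lookup T′ t → v′ ∈ˢ lookup T t
      box⁻ v′≢v h with insert-∈⁻ t v T h
      ... | inj₁ (_ , e) = contradiction e v′≢v
      ... | inj₂ h′      = h′

      card-box : card (lookup T′ t) ≡ suc (card (lookup T t))
      card-box = card-insert v v∉ (insert-new t v T) box⁺ box⁻

      product : ×Π.sum (λ t → box-weight t (lookup T′ t)) ≈ᴾ ω t v *ᴾ ×Π.sum (λ t →
          box-weight t (lookup T t))
      product = ×-Big.sum-modify _ _ t (ω t v)
        (×-Big.sum-modify _ _ v (ω t v)
          (≡⇒≈′ (cong₂ (λ c c′ → (if c then ω t v else 1ᴾ) , (if c′ then ω t v else 1ᴾ))
            (dec-true (v Subset.∈? lookup T′ t) (insert-new t v T))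
                (dec-false (v Subset.∈? lookup T t) v∉)))
          (λ v′ v′≢v → ≡⇒≈ (cong (λ c → if c then ω t v′ else 1ᴾ)
            (does-⇔ (mk⇔ (box⁻ v′≢v) (box⁺ v′≢v)) (v′ Subset.∈? lookup T′ t)
                (v′ Subset.∈? lookup T t)))))
        (λ t′ t′≢t → ≡⇒≈ (cong (box-weight t′) (untouched t′ t′≢t)))
        where
        ≡⇒≈′ : ∀ {p q r : Poly N} → (p , q) ≡ (r , 1ᴾ) → p ≈ᴾ r *ᴾ q
        ≡⇒≈′ refl = ≈-sym (*-identityʳ _)

      excess-by : ∀ e → card (lookup T′ t) ∸ 1 ≡ e + (card (lookup T t) ∸ 1) →
          excess T′ ≡ e + excess T
      excess-by e h = ℕ-Big.sum-modify _ _ t e h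
          (λ t′ t′≢t → cong (λ A → card A ∸ 1) (untouched t′ t′≢t))

    weight-insert-empty : ¬ Nonempty (lookup T t) → weight T′ ≈ᴾ ω t v *ᴾ weight T
    weight-insert-empty ¬ne = ≈-trans (*-cong (≡⇒≈ (cong (β ^ᴾ_) e)) product)
      (solve 3 (λ p q r → p :* (q :* r) := q :* (p :* r)) ≈-refl (β ^ᴾ excess T) (ω t v) _)
      where
      e : excess T′ ≡ excess T
      e = excess-by 0 (trans (cong (_∸ 1) card-box)
          (trans (card-empty ¬ne) (cong (_∸ 1) (sym (card-empty ¬ne)))))

    weight-insert-nonempty : Nonempty (lookup T t) → weight T′ ≈ᴾ ω t v *ᴾ (β *ᴾ weight T)
    weight-insert-nonempty ne = ≈-trans (*-cong (≡⇒≈ (cong (β ^ᴾ_) e)) product)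
      (solve 4 (λ p q r β → (β :* p) :* (q :* r) := q :* (β :* (p :* r))) ≈-refl (β ^ᴾ excess T)
          (ω t v) _ β)
      where
      e : excess T′ ≡ suc (excess T)
      e = excess-by 1 (trans (cong (_∸ 1) card-box) (sym (ℕ.m+[n∸m]≡n (card-nonempty ne))))

  weight-empty : ∀ {T} → (∀ t → ¬ Nonempty (lookup T t)) → weight T ≈ᴾ 1ᴾ
  weight-empty {T} e = ≈-trans
    (*-cong (≡⇒≈ (cong (β ^ᴾ_) (Inversions.sum-0 _ (λ t → cong (_∸ 1) (card-empty (e t))))))
            (ones _ (λ t → ones _ (λ v → ≡⇒≈ (cong (λ c → if c then ω t v else 1ᴾ)
              (dec-false (v Subset.∈? lookup T t) (λ h → e t (v , h))))))))
    (*-identityˡ _)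
    where
    ones : ∀ {k} (h : Fin k → Poly N) → (∀ i → h i ≈ᴾ 1ᴾ) → ×Π.sum h ≈ᴾ 1ᴾ
    ones {zero}  h e = ≈-refl
    ones {suc k} h e = ≈-trans (*-cong (e zero) (ones (h ∘ suc) (e ∘ suc))) (*-identityˡ _)

δ-tabulate : ∀ {N l} a → HeckeWords.δ {N} a (Vec.tabulate {n = l} (λ j → a + toℕ j)) ≈ᴾ 1ᴾ
δ-tabulate {l = zero}  a = ≈-refl
δ-tabulate {N} {suc l} a rewrite dec-true (a ℕ.≟ a + 0) (sym (ℕ.+-identityʳ a)) =
  ≈-trans (≡⇒≈ (cong (HeckeWords.δ (suc a)) (Vec.tabulate-cong {n = l} (λ j → ℕ.+-suc a (toℕ j)))))
          (δ-tabulate {N} {l} (suc a))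

δ-other : ∀ {N l} a (w : Word l) j → lookup w j ≢ a + toℕ j → HeckeWords.δ {N} a w ≈ᴾ 0ᴾ
δ-other a (a′ ∷ w) zero    ne rewrite dec-false (a ℕ.≟ a′)
    (λ e → ne (trans (sym e) (sym (ℕ.+-identityʳ a)))) = ≈-refl
δ-other a (a′ ∷ w) (suc j) ne with a ≡ᵇ a′
... | false = ≈-refl
... | true  = δ-other (suc a) w j (λ e → ne (trans e (sym (ℕ.+-suc a (toℕ j)))))

-- Row i of the heap has one box for each label k with f₀ i ≤ k < y i; columns
-- join the boxes (i , k) and (i + 1 , k + 1).
record Heap (m r size : ℕ) : Set where
  field
    y f₀   : Fin r → Fin (suc m)
    y-mono : ∀ {i j} → i Fin.< j → y i Fin.< y j
    rowᴴ   : Fin size → Fin r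
    lab    : Fin size → Fin m
    box-≡  : ∀ {t u} → rowᴴ t ≡ rowᴴ u → lab t ≡ lab u → t ≡ u
    box-at : ∀ i (k : Fin m) → toℕ (f₀ i) ≤ toℕ k → toℕ k < toℕ (y i) → ∃ λ t →
        rowᴴ t ≡ i × lab t ≡ k
    lab<y  : ∀ t → toℕ (lab t) < toℕ (y (rowᴴ t))

-- The coefficient as a sum over the fillings of the heap.

module HeapExpansion {m r size : ℕ} (heap : Heap m r size) where

  open Heap heap
  open Coefficients m
  open HeckeWords {suc m}
  open Fillings {suc m} {size}
  open Weights {suc m} {suc m} {size} (λ t v → weigh x B (v , lab t))

  -- Box `u` lies to the right of `t` in its row, where labels fall, or below `t` in its column,
  -- where label minus row index is constant; the latter is written without subtraction.
  _≺_ : Fin size → Fin size → Set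
  t ≺ u = (rowᴴ t ≡ rowᴴ u × lab u Fin.< lab t)
        ⊎ (rowᴴ t Fin.< rowᴴ u × toℕ (lab t) + toℕ (rowᴴ u) ≡ toℕ (lab u) + toℕ (rowᴴ t))

  -- The lower bound on the labels of a row; `lab<y` supplies the upper one.
  In : (Fin r → Fin (suc m)) → Fin size → Set
  In g t = toℕ (g (rowᴴ t)) ≤ toℕ (lab t)

  Positions : Set
  Positions = List (Fin (suc m) × Fin m)

  -- Set-valued tableaux of the shape given by `g` in which an entry `v` in a box labelled `k` uses
  -- up a factor `(v , k)` of `L`. `L` and the shape shrink together in the recursion.
  record Valid (L : Positions) (g : Fin r → Fin (suc m)) (T : Filling) : Set where
    field
      support⁺ : ∀ t → In g t → Nonempty (lookup T t)
      support⁻ : ∀ {t v} → v ∈ˢ lookup T t → In g t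
      order    : ∀ {t u a c} → t ≺ u → a ∈ˢ lookup T t → c ∈ˢ lookup T u → (a , lab t) ⊏ (c , lab u)
      allowed  : ∀ {t v} → v ∈ˢ lookup T t → (v , lab t) ∈ L

  module _ {g u} (R : Shuffle y g u) (f≤g : ∀ i → toℕ (f₀ i) ≤ toℕ (g i)) where

    open Shuffle R

    module _ {v : Fin (suc m)} {k : Fin m} {L : Positions} (last : All (_⊏ (v , k)) L)
             {T : Filling} (V : Valid ((v , k) ∷ L) g T) where

      open Valid V

      private
        nothing-later : ∀ {t c} → c ∈ˢ lookup T t → ¬ (v , k) ⊏ (c , lab t)
        nothing-later h lt with allowed h
        ... | here refl = ⊏-irrefl _ lt
        ... | there h′  = ⊏-irrefl _ (⊏-trans (All.lookup last h′) lt)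

      -- A later box of the shape would contain an entry, and that entry would use a factor after
      -- `(v , k)`, the last one allowed.
      maximal : ∀ {t t′} → lab t ≡ k → v ∈ˢ lookup T t → t ≺ t′ → ¬ In g t′
      maximal refl v∈ t≺t′ t′∈ with (c , c∈) ← support⁺ _ t′∈ = nothing-later c∈ (order t≺t′ v∈ c∈)

      -- Each failure exhibits a box that contradicts `maximal`: the box of row `i` labelled `g i`
      -- if `g i < k`, and the box labelled `k + 1` in row `j` if `g j` is `k + 1`. In the second
      -- case strict monotonicity of `g` leaves only `j = i + 1`, so that this box is directly
      -- below.
      entry⇒removable : ∀ {t} → lab t ≡ k → v ∈ˢ lookup T t → Removable y-mono R k (rowᴴ t)
      entry⇒removable {t} refl v∈ = Fin.toℕ-injective
          (trans gi≡k (sym (Fin.toℕ-inject₁ k))) , lab<y t , q∉g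
        where
        i : Fin r
        i = rowᴴ t

        gi≡k : toℕ (g i) ≡ toℕ k
        gi≡k with ℕ.m≤n⇒m<n∨m≡n (support⁻ v∈)
        ... | inj₂ e = e
        ... | inj₁ gi<k = contradiction in′
            (maximal refl v∈ (inj₁ (sym row′ , subst (_< toℕ k) (sym lab′) gi<k)))
          where
          gi<m : toℕ (g i) < m
          gi<m = ℕ.<-trans gi<k (Fin.toℕ<n k)
          k′ : Fin m
          k′ = fromℕ< gi<m
          toℕ-k′ : toℕ k′ ≡ toℕ (g i)
          toℕ-k′ = Fin.toℕ-fromℕ< gi<m
          found : ∃ λ t′ → rowᴴ t′ ≡ i × lab t′ ≡ k′
          found = box-at i k′ (subst (toℕ (f₀ i) ≤_) (sym toℕ-k′) (f≤g i))
                    (subst (_< toℕ (y i)) (sym toℕ-k′) (ℕ.<-trans gi<k (lab<y t)))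
          row′ : rowᴴ (proj₁ found) ≡ i
          row′ = proj₁ (proj₂ found)
          lab′ : toℕ (lab (proj₁ found)) ≡ toℕ (g i)
          lab′ = trans (cong toℕ (proj₂ (proj₂ found))) toℕ-k′
          in′ : In g (proj₁ found)
          in′ = ℕ.≤-reflexive (trans (cong (toℕ ∘ g) row′) (sym lab′))

        q∉g : ∀ j → g j ≢ suc k
        q∉g j e = contradiction in′ (maximal refl v∈
            (inj₂ (subst (i Fin.<_) (sym row′) i<j , column)))
          where
          gj≡ : toℕ (g j) ≡ suc (toℕ k)
          gj≡ = cong toℕ e
          i<j : i Fin.< j
          i<j = mono⁻ (ℕ.≤-reflexive (trans (cong suc gi≡k) (sym gj≡)))
          j≡suc-i : toℕ j ≡ suc (toℕ i)
          j≡suc-i with ℕ.m≤n⇒∃[o]m+o≡n i<j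
          ... | zero  , e′ = trans (sym e′) (ℕ.+-identityʳ _)
          ... | suc d , e′ = contradiction
              (mono-gap g mono (2 + d) {i} {j} (trans (sym e′) (sym (ℕ.+-suc (toℕ i) (suc d)))))
            (ℕ.<⇒≱ (subst₂ _<_ (sym gj≡) (cong (_+ (2 + d)) (sym gi≡k))
              (subst (suc (toℕ k) <_) (sym
                  (trans (ℕ.+-suc (toℕ k) (suc d)) (cong suc (ℕ.+-suc (toℕ k) d))))
                  (s≤s (s≤s (ℕ.m≤m+n (toℕ k) d))))))
          gj<yj : toℕ (g j) < toℕ (y j)
          gj<yj = subst (_< toℕ (y j)) (sym gj≡) (ℕ.≤-<-trans (lab<y t) (y-mono i<j))
          gj<m : toℕ (g j) < m
          gj<m = ℕ.<-≤-trans gj<yj (ℕ.≤-pred (Fin.toℕ<n (y j)))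
          k′ : Fin m
          k′ = fromℕ< gj<m
          toℕ-k′ : toℕ k′ ≡ toℕ (g j)
          toℕ-k′ = Fin.toℕ-fromℕ< gj<m
          found : ∃ λ t′ → rowᴴ t′ ≡ j × lab t′ ≡ k′
          found = box-at j k′ (subst (toℕ (f₀ j) ≤_) (sym toℕ-k′) (f≤g j))
              (subst (_< toℕ (y j)) (sym toℕ-k′) gj<yj)
          row′ : rowᴴ (proj₁ found) ≡ j
          row′ = proj₁ (proj₂ found)
          lab′ : toℕ (lab (proj₁ found)) ≡ toℕ (g j)
          lab′ = trans (cong toℕ (proj₂ (proj₂ found))) toℕ-k′
          in′ : In g (proj₁ found)
          in′ = ℕ.≤-reflexive (trans (cong (toℕ ∘ g) row′) (sym lab′))
          column : toℕ k + toℕ (rowᴴ (proj₁ found)) ≡ toℕ (lab (proj₁ found)) + toℕ i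
          column = trans (cong (toℕ k +_) (trans (cong toℕ row′) j≡suc-i))
            (trans (ℕ.+-suc (toℕ k) (toℕ i)) (cong (_+ toℕ i) (sym (trans lab′ gj≡))))

      removed-filling : Valid L g T ⊎ (∃ λ t → lab t ≡ k × v ∈ˢ lookup T t)
      removed-filling with Fin.any? (λ t → (lab t Fin.≟ k) ×-dec (v Subset.∈? lookup T t))
      ... | yes found = inj₂ found
      ... | no none = inj₁ record
        { support⁺ = support⁺ ; support⁻ = support⁻ ; order = order
        ; allowed = λ h → case allowed h of λ where
            (here refl) → contradiction (_ , refl , h) none
            (there h′)  → h′ }

    weaken : ∀ {p L T} → Valid L g T → Valid (p ∷ L) g T
    weaken V = record { Valid V ; allowed = there ∘ Valid.allowed V }

    module _ {k : Fin m} {i : Fin r} (rem : Removable y-mono R k i)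
             {t : Fin size} (row≡ : rowᴴ t ≡ i) (lab≡ : lab t ≡ k) where

      private
        gi≡k : toℕ (g i) ≡ toℕ k
        gi≡k = trans (cong toℕ (proj₁ rem)) (Fin.toℕ-inject₁ k)

      corner-in : In g t
      corner-in = ℕ.≤-reflexive (trans (cong (toℕ ∘ g) row≡) (trans gi≡k (cong toℕ (sym lab≡))))

      -- To the right, labels drop below `g i`. Below, `g` exceeds `k + 1` in the next row and grows
      -- by at least one per row, whereas the label in the column grows by exactly one and stays
      -- behind.
      corner-maximal : ∀ {t′} → t ≺ t′ → ¬ In g t′
      corner-maximal {t′} (inj₁ (e , lt)) in′ = contradiction
        (subst (λ i → toℕ (g i) ≤ toℕ (lab t′)) (trans (sym e) row≡) in′)
        (ℕ.<⇒≱ (subst (toℕ (lab t′) <_) (trans (cong toℕ lab≡) (sym gi≡k)) lt))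
      corner-maximal {t′} (inj₂ (lt , e)) in′ with ℕ.m≤n⇒∃[o]m+o≡n (subst (Fin._< rowᴴ t′) row≡ lt)
      ... | d , e′ = contradiction (ℕ.≤-trans
          (mono-gap g mono d {i⁺} {rowᴴ t′}
          (trans (sym e′) (cong (_+ d) (sym (Fin.toℕ-fromℕ< i⁺<r))))) in′)
        (ℕ.<⇒≱ (subst (_< toℕ (g i⁺) + d) lab′ (ℕ.+-monoˡ-< d g⁺)))
        where
        i⁺<r : suc (toℕ i) < r
        i⁺<r = ℕ.≤-<-trans (subst (suc (toℕ i) ≤_) e′ (ℕ.m≤m+n _ d)) (Fin.toℕ<n (rowᴴ t′))
        i⁺ : Fin r
        i⁺ = fromℕ< i⁺<r
        g⁺ : suc (toℕ k) < toℕ (g i⁺)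
        g⁺ = ℕ.≤∧≢⇒< (subst (_< toℕ (g i⁺)) gi≡k (mono (ℕ.≤-reflexive (sym (Fin.toℕ-fromℕ< i⁺<r)))))
                     (λ h → proj₂ (proj₂ rem) i⁺ (Fin.toℕ-injective (sym h)))
        lab′ : suc (toℕ k) + d ≡ toℕ (lab t′)
        lab′ = ℕ.+-cancelʳ-≡ (toℕ i) _ _ (trans shuffle
            (trans (cong₂ _+_ (cong toℕ (sym lab≡)) e′)
            (trans e (cong (λ j → toℕ (lab t′) + toℕ j) row≡))))
          where
          shuffle : suc (toℕ k) + d + toℕ i ≡ toℕ k + (suc (toℕ i) + d)
          shuffle = trans (cong suc (trans (ℕ.+-assoc (toℕ k) d (toℕ i))
              (cong (toℕ k +_) (ℕ.+-comm d (toℕ i)))))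
                          (sym (ℕ.+-suc (toℕ k) (toℕ i + d)))

      corner-unique : ∀ {t′} → rowᴴ t′ ≡ i → lab t′ ≡ k → t′ ≡ t
      corner-unique e e′ = box-≡ (trans e (sym row≡)) (trans e′ (sym lab≡))

      private
        g′ : Fin r → Fin (suc m)
        g′ = advance y-mono R k i

        at : g′ i ≡ suc k
        at = Vector.updateAt-updates i g

        away : ∀ {j} → j ≢ i → g′ j ≡ g j
        away {j} j≢i = Vector.updateAt-minimal j i g j≢i

      In-advance⁺ : ∀ {t′} → In g t′ → t′ ≢ t → In g′ t′
      In-advance⁺ {t′} in′ t′≢t with rowᴴ t′ Fin.≟ i
      ... | no ≢i = subst (λ j → toℕ j ≤ toℕ (lab t′)) (sym (away ≢i)) in′
      ... | yes e = subst (λ j → toℕ j ≤ toℕ (lab t′)) (sym (trans (cong g′ e) at))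
        (ℕ.≤∧≢⇒< (subst (_≤ toℕ (lab t′)) (trans (cong (toℕ ∘ g) e) gi≡k) in′)
                  (λ h → t′≢t (corner-unique e (Fin.toℕ-injective (sym h)))))

      In-advance⁻ : ∀ {t′} → In g′ t′ → In g t′ × t′ ≢ t
      In-advance⁻ {t′} in′ with rowᴴ t′ Fin.≟ i
      ... | no ≢i = subst (λ j → toℕ j ≤ toℕ (lab t′)) (away ≢i) in′ , λ { refl → ≢i row≡ }
      ... | yes e = subst (_≤ toℕ (lab t′)) (sym (trans (cong (toℕ ∘ g) e) gi≡k)) (ℕ.<⇒≤ k<) ,
                    λ { refl → ℕ.<-irrefl (sym (cong toℕ lab≡)) k< }
        where
        k< : toℕ k < toℕ (lab t′)
        k< = subst (λ j → toℕ j ≤ toℕ (lab t′)) (trans (cong g′ e) at) in′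

      module _ {v : Fin (suc m)} {L : Positions} (last : All (_⊏ (v , k)) L) where

        private
          new : (v , lab t) ≡ (v , k)
          new = cong (v ,_) lab≡

        -- The hypotheses are what validity for the full shape and for the shape without the corner
        -- have in common, so the corner may be empty or not. The new entry uses the last factor and
        -- sits in a maximal box, so only comparisons in which `t` is the larger box are new.
        insert-valid : ∀ {T} → (∀ t′ → In g t′ → t′ ≢ t → Nonempty (lookup T t′)) →
          (∀ {t′ v′} → v′ ∈ˢ lookup T t′ → In g t′) →
          (∀ {t′ u′ a c} → t′ ≺ u′ → a ∈ˢ lookup T t′ → c ∈ˢ lookup T u′ → (a , lab t′) ⊏
              (c , lab u′)) →
          (∀ {t′ v′} → v′ ∈ˢ lookup T t′ → (v′ , lab t′) ∈ L) →
          Valid ((v , k) ∷ L) g (insert t v T)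
        insert-valid {T} sup⁺ sup⁻ ord all = record
          { support⁺ = sup⁺′ ; support⁻ = sup⁻′ ; order = ord′ ; allowed = all′ }
          where
          sup⁺′ : ∀ t′ → In g t′ → Nonempty (lookup (insert t v T) t′)
          sup⁺′ t′ in′ with t′ Fin.≟ t
          ... | yes refl = v , insert-new t v T
          ... | no t′≢t with (a , a∈) ← sup⁺ t′ in′ t′≢t = a , insert-old t v T a∈

          sup⁻′ : ∀ {t′ v′} → v′ ∈ˢ lookup (insert t v T) t′ → In g t′
          sup⁻′ h with insert-∈⁻ t v T h
          ... | inj₁ (refl , _) = corner-in
          ... | inj₂ h′         = sup⁻ h′

          all′ : ∀ {t′ v′} → v′ ∈ˢ lookup (insert t v T) t′ → (v′ , lab t′) ∈ (v , k) ∷ L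
          all′ h with insert-∈⁻ t v T h
          ... | inj₁ (refl , refl) = here new
          ... | inj₂ h′            = there (all h′)

          ord′ : ∀ {t′ u′ a c} → t′ ≺ u′ → a ∈ˢ lookup (insert t v T) t′ →
              c ∈ˢ lookup (insert t v T) u′ →
                 (a , lab t′) ⊏ (c , lab u′)
          ord′ t′≺u′ a∈ c∈ with insert-∈⁻ t v T a∈
          ... | inj₁ (refl , refl) = contradiction (sup⁻′ c∈) (corner-maximal t′≺u′)
          ... | inj₂ a∈′ with insert-∈⁻ t v T c∈
          ...   | inj₁ (refl , refl) = subst (_ ⊏_) (sym new) (All.lookup last (all a∈′))
          ...   | inj₂ c∈′           = ord t′≺u′ a∈′ c∈′

        module _ {T : Filling} (V : Valid ((v , k) ∷ L) g T) where

          open Valid V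

          private
            D : Filling
            D = delete t v T

            all′ : ∀ {t′ v′} → v′ ∈ˢ lookup D t′ → (v′ , lab t′) ∈ L
            all′ {t′} h with (ne , h′) ← delete-∈⁻ t v T h | allowed h′
            ... | there h″  = h″
            -- An entry `v` in a box labelled `k` makes that box a corner labelled `k`, hence the
            -- box `t`; but this entry was deleted.
            ... | here refl = contradiction (corner-unique (g-injective
                    (trans (proj₁ (entry⇒removable last V refl h′))
                        (sym (proj₁ rem)))) refl , refl) ne

            ord′ : ∀ {t′ u′ a c} → t′ ≺ u′ → a ∈ˢ lookup D t′ → c ∈ˢ lookup D u′ →
                (a , lab t′) ⊏ (c , lab u′)
            ord′ t′≺u′ a∈ c∈ = order t′≺u′ (proj₂ (delete-∈⁻ t v T a∈)) (proj₂ (delete-∈⁻ t v T c∈))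

            sup⁺′ : ∀ t′ → t′ ≢ t → In g t′ → Nonempty (lookup D t′)
            sup⁺′ t′ t′≢t in′ with (a , a∈) ← support⁺ t′ in′ = a , delete-keeps t v T
                (t′≢t ∘ proj₁) a∈

          delete-valid : Valid L g D ⊎ Valid L g′ D
          delete-valid with Subset.nonempty? (lookup D t)
          ... | yes ne = inj₁ record
            { support⁺ = λ t′ in′ → case t′ Fin.≟ t of λ { (yes refl) → ne ; (no t′≢t) →
                sup⁺′ t′ t′≢t in′ }
            ; support⁻ = λ h → support⁻ (proj₂ (delete-∈⁻ t v T h))
            ; order = ord′ ; allowed = all′ }
          ... | no ¬ne = inj₂ record
            { support⁺ = λ t′ in′ → let in″ , t′≢t = In-advance⁻ in′ in sup⁺′ t′ t′≢t in″
            ; support⁻ = λ {t′} {v′} h → In-advance⁺ (support⁻ (proj₂ (delete-∈⁻ t v T h)))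
                           (λ { refl → ¬ne (v′ , h) })
            ; order = ord′ ; allowed = all′ }

        absent : ∀ {h T} → Valid L h T → v ∉ˢ lookup T t
        absent V v∈ = ⊏-irrefl _ (subst (_⊏ (v , k)) new (All.lookup last (Valid.allowed V v∈)))

  -- The recursion builds its own list of fillings; the first four fields say that it enumerates the
  -- valid ones without repetition, which fixes it up to order.
  record Expansion (L : Positions) (g : Fin r → Fin (suc m)) (u : Permutation′ (suc m)) : Set where
    field
      fillings : List Filling
      unique   : Unique fillings
      sound    : ∀ {T} → T ∈ fillings → Valid L g T
      complete : ∀ {T} → Valid L g T → T ∈ fillings
      expands  : coefficient (map (factor x B) L) u ≈ᴾ ∑ fillings weight

  ∑-scale : ∀ (Ts : List Filling) p (h : Filling → Poly (suc m)) →
      ∑ Ts (λ T → p *ᴾ h T) ≈ᴾ p *ᴾ ∑ Ts h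
  ∑-scale []       p h = ≈-sym (zeroʳ p)
  ∑-scale (T ∷ Ts) p h = ≈-trans (+-cong ≈-refl (∑-scale Ts p h)) (≈-sym (distribˡ _ _ _))

  -- Induction over the factors from the last one. At a descent, `1 + ω uₖ` gives three terms: `c u`
  -- for the fillings without `v` in the corner, `ω c(u sₖ)` for those in which `v` is alone there
  -- and the corner goes, and `ω β c(u)` for those in which `v` joins other entries. Without a
  -- descent there is no corner labelled `k`, and the first term is all. When no factor is left,
  -- only the empty shape has a filling.
  expansion : ∀ L → AllPairs (λ p q → q ⊏ p) L → ∀ {g u} → Shuffle y g u →
              (∀ i → toℕ (f₀ i) ≤ toℕ (g i)) → Expansion L g u
  expansion [] [] {g} {u} R f≤g with Fin.all? (λ i → g i Fin.≟ y i)
  ... | yes g≡y = record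
    { fillings = [ ∅ ]
    ; unique   = [] ∷ []
    ; sound    = λ { (here refl) → record
        { support⁺ = λ t in′ → contradiction in′
            (ℕ.<⇒≱ (subst (λ j → toℕ (lab t) < toℕ j) (sym (g≡y (rowᴴ t))) (lab<y t)))
        ; support⁻ = λ h → contradiction h ∉∅
        ; order    = λ _ h _ → contradiction h ∉∅
        ; allowed  = λ h → contradiction h ∉∅ } }
    ; complete = λ V → here (filling-ext (λ h → case Valid.allowed V h of λ ())
        (λ h → contradiction h ∉∅))
    ; expands  = ≈-trans
        (≡⇒≈ (cong (δ 0) (Vec.tabulate-cong (λ j → cong toℕ (shuffle-id y-mono R g≡y j)))))
        (≈-trans (δ-tabulate {suc m} {suc m} 0)
            (≈-sym (≈-trans (+-identityʳ _) (weight-empty {∅} (λ t (v , h) → ∉∅ h)))))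
    }
    where
    ∅ : Filling
    ∅ = Vec.replicate size Subset.⊥
    ∉∅ : ∀ {t v} → v ∉ˢ lookup ∅ t
    ∉∅ {t} h = Subset.∉⊥ (subst (_ ∈ˢ_) (Vec.lookup-replicate t Subset.⊥) h)
  ... | no g≢y with Fin.¬∀⟶∃¬ r (λ i → g i ≡ y i) (λ i → g i Fin.≟ y i) g≢y
  ...   | i , gi≢yi = record
    { fillings = []
    ; unique   = []
    ; sound    = λ ()
    ; complete = λ V → case Valid.allowed V (proj₂ (Valid.support⁺ V _ in′)) of λ ()
    -- `u` sends `g i` to `y i`, which differs from `g i`, so `u` is not the identity.
    ; expands  = δ-other 0 (word u) (g i) (λ e → gi≢yi (sym (Fin.toℕ-injective
        (trans (cong toℕ (sym (on i))) (trans
            (sym (Vec.lookup∘tabulate (λ j → toℕ (u ⟨$⟩ʳ j)) (g i))) e)))))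
    }
    where
    open Shuffle R
    gi<yi : toℕ (g i) < toℕ (y i)
    gi<yi = ℕ.≤∧≢⇒< (≤y i) (gi≢yi ∘ Fin.toℕ-injective)
    gi<m : toℕ (g i) < m
    gi<m = ℕ.<-≤-trans gi<yi (ℕ.≤-pred (Fin.toℕ<n (y i)))
    toℕ-k : toℕ (fromℕ< gi<m) ≡ toℕ (g i)
    toℕ-k = Fin.toℕ-fromℕ< gi<m
    found : ∃ λ t → rowᴴ t ≡ i × lab t ≡ fromℕ< gi<m
    found = box-at i (fromℕ< gi<m) (subst (toℕ (f₀ i) ≤_) (sym toℕ-k) (f≤g i))
        (subst (_< toℕ (y i)) (sym toℕ-k) gi<yi)
    in′ : In g (proj₁ found)
    in′ = ℕ.≤-reflexive (trans (cong (toℕ ∘ g) (proj₁ (proj₂ found)))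
        (sym (trans (cong toℕ (proj₂ (proj₂ found))) toℕ-k)))
  expansion ((v , k) ∷ L) (last ∷ sorted) {g} {u} R f≤g
    with expansion L sorted R f≤g | (u ⟨$⟩ʳ suc k) Fin.<? (u ⟨$⟩ʳ inject₁ k) in descent?
  ... | E₀ | no ¬descent = record
    { fillings = fillings
    ; unique   = unique
    ; sound    = weaken R f≤g ∘ sound
    ; complete = λ V → case removed-filling R f≤g last V of λ where
        (inj₁ V′) → complete V′
        (inj₂ (t , refl , h)) → contradiction
          (removable⇒descent y-mono R k (rowᴴ t , entry⇒removable R f≤g last V refl h)) ¬descent
    ; expands  = begin
        1ᴾ *ᴾ c (word u) +ᴾ weigh x B (v , k) *ᴾ U k c (word u)
          ≡⟨ cong (λ p → 1ᴾ *ᴾ c (word u) +ᴾ weigh x B (v , k) *ᴾ p)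
               (trans (U-word k c u) (cong
                   (λ d → if does d then c (word (u · s k)) +ᴾ β *ᴾ c (word u) else 0ᴾ) descent?)) ⟩
        1ᴾ *ᴾ c (word u) +ᴾ weigh x B (v , k) *ᴾ 0ᴾ
          ≈⟨ solve 2 (λ p q → con 1 :* p :+ q :* con 0 := p) ≈-refl (c (word u))
              (weigh x B (v , k)) ⟩
        c (word u)
          ≈⟨ expands ⟩
        ∑ fillings weight ∎
    }
    where
    open Hecke {suc m}
    open ≈-Reasoning
    open Expansion E₀
    c : Fun (suc m)
    c = act (map (factor x B) L) (δ 0)
  ... | E₀ | yes descent with descent⇒removable y-mono R k descent
  ...   | i , rem with box-at i k (subst (toℕ (f₀ i) ≤_)
      (trans (cong toℕ (proj₁ rem)) (Fin.toℕ-inject₁ k)) (f≤g i))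
                                  (proj₁ (proj₂ rem))
  ...     | t , row≡ , lab≡ = record
    { fillings = E₀.fillings ++ map (insert t v) (E₁.fillings ++ E₀.fillings)
    ; unique   = Unique.++⁺ E₀.unique
        (unique-map (insert t v) insert-injective (Unique.++⁺ E₁.unique E₀.unique disjoint))
        λ (h , h′) → case ∈.∈-map⁻ (insert t v) h′ of λ where
          (T , _ , refl) → absent R f≤g rem row≡ lab≡ last (E₀.sound h) (insert-new t v T)
    ; sound    = λ h → case ∈.∈-++⁻ E₀.fillings h of λ where
        (inj₁ h₀) → weaken R f≤g (E₀.sound h₀)
        (inj₂ h′) → case ∈.∈-map⁻ (insert t v) h′ of λ where
          (T , T∈ , refl) → case ∈.∈-++⁻ E₁.fillings T∈ of λ where
            (inj₁ h₁) → let open Valid (E₁.sound h₁) in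
              insert-valid R f≤g rem row≡ lab≡ last
                (λ t′ in′ t′≢t → support⁺ t′ (In-advance⁺ R f≤g rem row≡ lab≡ in′ t′≢t))
                (λ a → proj₁ (In-advance⁻ R f≤g rem row≡ lab≡ (support⁻ a))) order allowed
            (inj₂ h₀) → let open Valid (E₀.sound h₀) in
              insert-valid R f≤g rem row≡ lab≡ last
                  (λ t′ in′ _ → support⁺ t′ in′) support⁻ order allowed
    ; complete = complete
    ; expands  = expands
    }
    where
    open Hecke {suc m}
    open ≈-Reasoning
    module E₀ = Expansion E₀
    R₁ : Shuffle y (advance y-mono R k i) (u · s k)
    R₁ = advance-shuffle y-mono R k rem

    f≤g₁ : ∀ j → toℕ (f₀ j) ≤ toℕ (advance y-mono R k i j)
    f≤g₁ j with j Fin.≟ i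
    ... | yes refl = subst (λ q → toℕ (f₀ i) ≤ toℕ q) (sym (Vector.updateAt-updates i g))
            (ℕ.≤-trans (f≤g i) (ℕ.≤-trans
                (ℕ.≤-reflexive (trans (cong toℕ (proj₁ rem)) (Fin.toℕ-inject₁ k))) (ℕ.n≤1+n _)))
    ... | no j≢i   = subst (λ q → toℕ (f₀ j) ≤ toℕ q) (sym (Vector.updateAt-minimal j i g j≢i))
        (f≤g j)

    module E₁ = Expansion (expansion L sorted R₁ f≤g₁)

    corner-empty : ∀ {T} → Valid L (advance y-mono R k i) T → ¬ Nonempty (lookup T t)
    corner-empty V (a , h) = proj₂ (In-advance⁻ R f≤g rem row≡ lab≡ (Valid.support⁻ V h)) refl

    corner-nonempty : ∀ {T} → Valid L g T → Nonempty (lookup T t)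
    corner-nonempty V = Valid.support⁺ V t (corner-in R f≤g rem row≡ lab≡)

    absent′ : ∀ {T} → T ∈ E₁.fillings ++ E₀.fillings → v ∉ˢ lookup T t
    absent′ h with ∈.∈-++⁻ E₁.fillings h
    ... | inj₁ h₁ = absent R f≤g rem row≡ lab≡ last (E₁.sound h₁)
    ... | inj₂ h₀ = absent R f≤g rem row≡ lab≡ last (E₀.sound h₀)

    insert-injective : ∀ {T T′} → T ∈ E₁.fillings ++ E₀.fillings → T′ ∈ E₁.fillings ++ E₀.fillings →
                       insert t v T ≡ insert t v T′ → T ≡ T′
    insert-injective {T} {T′} h h′ e = trans (sym (delete-insert t v T (absent′ h)))
      (trans (cong (delete t v) e) (delete-insert t v T′ (absent′ h′)))

    disjoint : ∀ {T} → ¬ (T ∈ E₁.fillings × T ∈ E₀.fillings)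
    disjoint (h₁ , h₀) = corner-empty (E₁.sound h₁) (corner-nonempty (E₀.sound h₀))

    complete : ∀ {T} → Valid ((v , k) ∷ L) g T →
        T ∈ E₀.fillings ++ map (insert t v) (E₁.fillings ++ E₀.fillings)
    complete {T} V with removed-filling R f≤g last V
    ... | inj₁ V₀ = ∈.∈-++⁺ˡ (E₀.complete V₀)
    ... | inj₂ (t′ , refl , h) = ∈.∈-++⁺ʳ E₀.fillings
      (subst (_∈ map (insert t v) (E₁.fillings ++ E₀.fillings)) (insert-delete t v T v∈)
        (∈.∈-map⁺ (insert t v) deleted))
      where
      v∈ : v ∈ˢ lookup T t
      v∈ = subst (λ t → v ∈ˢ lookup T t) (corner-unique R f≤g rem row≡ lab≡ (Shuffle.g-injective R
        (trans (proj₁ (entry⇒removable R f≤g last V refl h)) (sym (proj₁ rem)))) refl) h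
      deleted : delete t v T ∈ E₁.fillings ++ E₀.fillings
      deleted with delete-valid R f≤g rem row≡ lab≡ last V
      ... | inj₁ V₀ = ∈.∈-++⁺ʳ E₁.fillings (E₀.complete V₀)
      ... | inj₂ V₁ = ∈.∈-++⁺ˡ (E₁.complete V₁)

    c : Fun (suc m)
    c = act (map (factor x B) L) (δ 0)

    ω : Poly (suc m)
    ω = weigh x B (v , k)

    expands : coefficient (map (factor x B) ((v , k) ∷ L)) u ≈ᴾ
              ∑ (E₀.fillings ++ map (insert t v) (E₁.fillings ++ E₀.fillings)) weight
    expands = begin
      1ᴾ *ᴾ c (word u) +ᴾ ω *ᴾ U k c (word u)
        ≡⟨ cong (λ p → 1ᴾ *ᴾ c (word u) +ᴾ ω *ᴾ p)
             (trans (U-word k c u)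
                 (cong (λ d → if does d then c (word (u · s k)) +ᴾ β *ᴾ c (word u) else 0ᴾ) descent?)) ⟩
      1ᴾ *ᴾ c (word u) +ᴾ ω *ᴾ (c (word (u · s k)) +ᴾ β *ᴾ c (word u))
        ≈⟨ +-cong (*-cong ≈-refl E₀.expands)
            (*-cong ≈-refl (+-cong E₁.expands (*-cong ≈-refl E₀.expands))) ⟩
      1ᴾ *ᴾ Σ₀ +ᴾ ω *ᴾ (Σ₁ +ᴾ β *ᴾ Σ₀)
        ≈⟨ solve 4 (λ Σ₀ Σ₁ ω β → con 1 :* Σ₀ :+ ω :* (Σ₁ :+ β :* Σ₀) := Σ₀ :+ (ω :* Σ₁ :+ ω :* (β :* Σ₀)))
             ≈-refl Σ₀ Σ₁ ω β ⟩
      Σ₀ +ᴾ (ω *ᴾ Σ₁ +ᴾ ω *ᴾ (β *ᴾ Σ₀))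
        ≈⟨ +-cong ≈-refl (+-cong (∑-scale E₁.fillings ω weight)
             (≈-trans (∑-scale E₀.fillings ω _) (*-cong ≈-refl (∑-scale E₀.fillings β weight)))) ⟨
      Σ₀ +ᴾ (∑ E₁.fillings (λ T → ω *ᴾ weight T) +ᴾ ∑ E₀.fillings (λ T → ω *ᴾ (β *ᴾ weight T)))
        ≈⟨ +-cong ≈-refl (+-cong
             (+-Big.⨀-cong E₁.fillings (λ h → weight₁ (E₁.sound h)))
             (+-Big.⨀-cong E₀.fillings (λ h → weight₀ (E₀.sound h)))) ⟨
      Σ₀ +ᴾ (∑ E₁.fillings (λ T → weight (insert t v T)) +ᴾ ∑ E₀.fillings
          (λ T → weight (insert t v T)))
        ≈⟨ +-cong ≈-refl (+-Big.⨀-++ E₁.fillings E₀.fillings _) ⟨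
      Σ₀ +ᴾ ∑ (E₁.fillings ++ E₀.fillings) (λ T → weight (insert t v T))
        ≡⟨ cong (Σ₀ +ᴾ_) (+-Big.⨀-map (insert t v) (E₁.fillings ++ E₀.fillings) weight) ⟨
      Σ₀ +ᴾ ∑ (map (insert t v) (E₁.fillings ++ E₀.fillings)) weight
        ≈⟨ +-Big.⨀-++ E₀.fillings _ weight ⟨
      ∑ (E₀.fillings ++ map (insert t v) (E₁.fillings ++ E₀.fillings)) weight ∎
      where
      Σ₀ Σ₁ : Poly (suc m)
      Σ₀ = ∑ E₀.fillings weight
      Σ₁ = ∑ E₁.fillings weight

      ω≡ : weigh x B (v , lab t) ≡ ω
      ω≡ = cong (λ k → weigh x B (v , k)) lab≡

      weight₁ : ∀ {T} → Valid L (advance y-mono R k i) T → weight (insert t v T) ≈ᴾ ω *ᴾ weight T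
      weight₁ {T} V = ≈-trans
        (weight-insert-empty t v T (absent R f≤g rem row≡ lab≡ last V) (corner-empty V))
        (*-cong (≡⇒≈ ω≡) ≈-refl)

      weight₀ : ∀ {T} → Valid L g T → weight (insert t v T) ≈ᴾ ω *ᴾ (β *ᴾ weight T)
      weight₀ {T} V = ≈-trans
        (weight-insert-nonempty t v T (absent R f≤g rem row≡ lab≡ last V) (corner-nonempty V))
        (*-cong (≡⇒≈ ω≡) ≈-refl)

-- Enumeration of set-valued tableaux, and comparison of their entries.

module _ {A : Set} where

  lookup-AllPairs : ∀ {R : A → A → Set} {as} → AllPairs R as → ∀ {i j} → i Fin.< j →
      R (List.lookup as i) (List.lookup as j)
  lookup-AllPairs (a ∷ as) {zero}  {suc j} _       = All.lookup a (∈.∈-lookup j)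
  lookup-AllPairs (a ∷ as) {suc i} {suc j} (s≤s h) = lookup-AllPairs as h

  lookup-unique : ∀ {as : List A} → Unique as → ∀ {i j} → List.lookup as i ≡ List.lookup as j →
      i ≡ j
  lookup-unique u {i} {j} e with Fin.<-cmp i j
  ... | tri< i<j _ _ = contradiction e (lookup-AllPairs u i<j)
  ... | tri≈ _ i≡j _ = i≡j
  ... | tri> _ _ j<i = contradiction (sym e) (lookup-AllPairs u j<i)

  last-lookup : ∀ (as : List A) (i : Fin (length as)) → suc (toℕ i) ≡ length as →
      last as ≡ just (List.lookup as i)
  last-lookup (a ∷ [])      zero    e = refl
  last-lookup (a ∷ a′ ∷ as) (suc i) e = last-lookup (a′ ∷ as) i (ℕ.suc-injective e)

  vectorsOver-unique : ∀ {as : List A} → Unique as → ∀ k → Unique (vectorsOver as k)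
  vectorsOver-unique u zero    = [] ∷ []
  vectorsOver-unique u (suc k) = Unique.cartesianProductWith⁺ Vec._∷_ Vec.∷-injective u
      (vectorsOver-unique u k)

  ∈-vectorsOver : ∀ {as : List A} → (∀ a → a ∈ as) → ∀ {k} (v : Vec A k) → v ∈ vectorsOver as k
  ∈-vectorsOver all []      = here refl
  ∈-vectorsOver all (a ∷ v) = ∈.∈-cartesianProductWith⁺ Vec._∷_ (all a) (∈-vectorsOver all v)

module _ {n : ℕ} where

  private
    ∈-elements⁺ : ∀ {A : Subset n} {v} → v ∈ˢ A → v ∈ elements A
    ∈-elements⁺ {A} h = ∈.∈-filter⁺ (Subset._∈? A) (∈.∈-allFin _) h

    ∈-elements⁻ : ∀ {A : Subset n} {v} → v ∈ elements A → v ∈ˢ A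
    ∈-elements⁻ {A} h = proj₂ (∈.∈-filter⁻ (Subset._∈? A) {xs = allFin n} h)

    all-val : ∀ {P : ℕ → Set} {A : Subset n} → (∀ {v} → v ∈ˢ A → P (val v)) →
        All P (map val (elements A))
    all-val {A = A} h = All.map⁺ (All.tabulate (λ v∈ → h (∈-elements⁻ {A} v∈)))

    val≤maximum : ∀ {A : Subset n} {v} → v ∈ˢ A → val v ≤ maximum A
    val≤maximum {A} h = Extrema.v≤max⁺ 0 (map val (elements A))
      (inj₂ (Any.map ℕ.≤-reflexive (∈.∈-map⁺ val (∈-elements⁺ {A} h))))

    minimum≤val : ∀ {A : Subset n} {v} → v ∈ˢ A → minimum A ≤ val v
    minimum≤val {A} h = Extrema.min≤v⁺ (suc n) (map val (elements A))
      (inj₂ (Any.map (ℕ.≤-reflexive ∘ sym) (∈.∈-map⁺ val (∈-elements⁺ {A} h))))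

    maximum≤ : ∀ {A : Subset n} {c} → (∀ {v} → v ∈ˢ A → val v ≤ c) → maximum A ≤ c
    maximum≤ {A} h = Extrema.max≤v⁺ {xs = map val (elements A)} z≤n (all-val {A = A} h)

    ≤minimum : ∀ {A : Subset n} {c} → c ≤ suc n → (∀ {v} → v ∈ˢ A → c ≤ val v) → c ≤ minimum A
    ≤minimum {A} c≤ h = Extrema.v≤min⁺ {xs = map val (elements A)} c≤ (all-val {A = A} h)

  max≤min⁻ : ∀ {A C : Subset n} → maximum A ≤ minimum C → ∀ {a c} → a ∈ˢ A → c ∈ˢ C → a Fin.≤ c
  max≤min⁻ {A} {C} h a∈ c∈ = ℕ.≤-pred (ℕ.≤-trans (val≤maximum {A} a∈)
      (ℕ.≤-trans h (minimum≤val {C} c∈)))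

  max<min⁻ : ∀ {A C : Subset n} → maximum A < minimum C → ∀ {a c} → a ∈ˢ A → c ∈ˢ C → a Fin.< c
  max<min⁻ {A} {C} h a∈ c∈ = ℕ.≤-pred (ℕ.≤-<-trans (val≤maximum {A} a∈)
      (ℕ.<-≤-trans h (minimum≤val {C} c∈)))

  -- `min` also takes its default `suc n` into account, hence the bound of `val a` by `suc n`.
  max≤min⁺ : ∀ {A C : Subset n} → (∀ {a c} → a ∈ˢ A → c ∈ˢ C → a Fin.≤ c) → maximum A ≤ minimum C
  max≤min⁺ {A} {C} h = maximum≤ {A} λ {a} a∈ → ≤minimum {C} (ℕ.m≤n⇒m≤1+n (Fin.toℕ<n a)) λ c∈ → s≤s
      (h a∈ c∈)

  max<min⁺ : ∀ {A C : Subset n} → (∀ {a c} → a ∈ˢ A → c ∈ˢ C → a Fin.< c) → maximum A < minimum C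
  max<min⁺ {A} {C} h = ≤minimum {C} (s≤s (maximum≤ {A} (λ {a} _ → Fin.toℕ<n a)))
    λ {c} c∈ → s≤s (maximum≤ {A} λ {a} a∈ → h a∈ c∈)

module _ {n m : ℕ} {v v′ : Fin n} {k k′ : Fin m} where

  -- For equal values the larger label comes first in the product. Labels fall along a row, so equal
  -- entries are in order there, and rows are weak. Labels rise down a column, so equal entries are
  -- out of order there, and columns are strict.
  ⊏-row⁺ : k′ Fin.< k → v Fin.≤ v′ → (v , k) ⊏ (v′ , k′)
  ⊏-row⁺ k> v≤v′ with ℕ.m≤n⇒m<n∨m≡n v≤v′
  ... | inj₁ v<v′ = inj₁ v<v′
  ... | inj₂ e    = inj₂ (Fin.toℕ-injective e , k>)

  ⊏-row⁻ : (v , k) ⊏ (v′ , k′) → v Fin.≤ v′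
  ⊏-row⁻ (inj₁ v<v′)       = ℕ.<⇒≤ v<v′
  ⊏-row⁻ (inj₂ (refl , _)) = ℕ.≤-refl

  ⊏-column⁻ : k Fin.< k′ → (v , k) ⊏ (v′ , k′) → v Fin.< v′
  ⊏-column⁻ k< (inj₁ v<v′)     = v<v′
  ⊏-column⁻ k< (inj₂ (_ , k>)) = contradiction k> (ℕ.<-asym k<)

module _ {r : ℕ} (lam mu flag : Fin r → ℕ) (n : ℕ) where

  open SetValued lam mu flag n
  open Tableaux lam mu using (size)

  private
    subsets : List (Subset n)
    subsets = vectorsOver (inside ∷ outside ∷ []) n

    subsets-unique : Unique subsets
    subsets-unique = vectorsOver-unique (((λ ()) ∷ []) ∷ [] ∷ []) n

    ∈-subsets : ∀ A → A ∈ subsets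
    ∈-subsets = ∈-vectorsOver λ { true → here refl ; false → there (here refl) }

  SVT-unique : Unique SVT
  SVT-unique = Unique.filter⁺ isSVT? (vectorsOver-unique subsets-unique size)

  ∈-SVT⁺ : ∀ {T} → IsSVT T → T ∈ SVT
  ∈-SVT⁺ {T} h = ∈.∈-filter⁺ isSVT? (∈-vectorsOver ∈-subsets T) h

  ∈-SVT⁻ : ∀ {T} → T ∈ SVT → IsSVT T
  ∈-SVT⁻ h = proj₂ (∈.∈-filter⁻ isSVT? {xs = vectorsOver subsets size} h)

module _ {r : ℕ} (lam mu flag : Fin r → ℕ) (n : ℕ) where

  open SetValued lam mu flag n
  open Tableaux lam mu
  open Cardinality {n}

  module _ {N : ℕ} (ω : Fin size → Fin n → Poly N) where

    open Weights {N} {n} {size} ω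

    length-entries : ∀ T → (∀ t → Nonempty (lookup T t)) → length (entries T) ∸ size ≡ excess T
    length-entries T nonempty = trans (cong (_∸ size) total) (ℕ.m+n∸n≡m (excess T) size)
      where
      open ≡-Reasoning
      sum-pred : ∀ {k} (g : Fin k → ℕ) → (∀ t → 1 ≤ g t) → ℕΣ.sum g ≡ ℕΣ.sum (λ t → g t ∸ 1) + k
      sum-pred {zero}  g h = refl
      sum-pred {suc k} g h = trans (cong₂ _+_ (sym (ℕ.m∸n+n≡m (h zero)))
          (sum-pred (g ∘ suc) (h ∘ suc)))
        (solveℕ 3 (λ a s k → a ⊹ conℕ 1 ⊹ (s ⊹ k) ≐ a ⊹ s ⊹ (conℕ 1 ⊹ k)) refl (g zero ∸ 1)
            (ℕΣ.sum (λ t → g (suc t) ∸ 1)) k)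
      total : length (entries T) ≡ excess T + size
      total = begin
        length (entries T)
          ≡⟨ length-⨀ (entries T) ⟩
        ℕ-Big.⨀ (entries T) (λ _ → 1)
          ≡⟨ ℕ-Big.⨀-concatMap (λ t → map (box t ,_) (elements (lookup T t))) (allFin size)
              (λ _ → 1) ⟩
        ℕ-Big.⨀ (allFin size) (λ t → ℕ-Big.⨀ (map (box t ,_) (elements (lookup T t))) (λ _ → 1))
          ≡⟨ ℕ-Big.⨀-cong (allFin size) (λ {t} _ → trans
              (sym (length-⨀ (map (box t ,_) (elements (lookup T t)))))
              (trans (List.length-map (box t ,_) (elements (lookup T t)))
               (length-elements (lookup T t)))) ⟩
        ℕ-Big.⨀ (allFin size) (λ t → card (lookup T t))
          ≡⟨ ℕ-Big.⨀-tabulate id (λ t → card (lookup T t)) ⟩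
        ℕΣ.sum (λ t → card (lookup T t))
          ≡⟨ sum-pred (λ t → card (lookup T t)) (λ t → card-nonempty (nonempty t)) ⟩
        excess T + size ∎

    ∏-entries : ∀ (entry-weight : Box × Fin n → Poly N) →
        (∀ t v → entry-weight (box t , v) ≡ ω t v) →
                ∀ T → ∏ (entries T) entry-weight ≈ᴾ ×Π.sum (λ t → box-weight t (lookup T t))
    ∏-entries entry-weight ω≡ T = begin
      ∏ (entries T) entry-weight
        ≈⟨ ×-Big.⨀-concatMap (λ t → map (box t ,_) (elements (lookup T t)))
            (allFin size) entry-weight ⟩
      ∏ (allFin size) (λ t → ∏ (map (box t ,_) (elements (lookup T t))) entry-weight)
        ≈⟨ ×-Big.⨀-cong (allFin size) (λ {t} _ → in-box t) ⟩
      ∏ (allFin size) (λ t → box-weight t (lookup T t))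
        ≡⟨ ×-Big.⨀-tabulate id (λ t → box-weight t (lookup T t)) ⟩
      ×Π.sum (λ t → box-weight t (lookup T t)) ∎
      where
      open ≈-Reasoning
      in-box : ∀ t → ∏ (map (box t ,_) (elements (lookup T t))) entry-weight
          ≈ᴾ box-weight t (lookup T t)
      in-box t = begin
        ∏ (map (box t ,_) (elements (lookup T t))) entry-weight
          ≡⟨ ×-Big.⨀-map (box t ,_) (elements (lookup T t)) entry-weight ⟩
        ∏ (elements (lookup T t)) (λ v → entry-weight (box t , v))
          ≈⟨ ×-Big.⨀-cong (elements (lookup T t)) (λ {v} _ → ≡⇒≈ (ω≡ t v)) ⟩
        ∏ (elements (lookup T t)) (λ v → ω t v)
          ≈⟨ ×-Big.⨀-filter (Subset._∈? lookup T t) (allFin n) _ ⟩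
        ∏ (allFin n) (λ v → if does (v Subset.∈? lookup T t) then ω t v else 1ᴾ)
          ≡⟨ ×-Big.⨀-tabulate id (λ v → if does (v Subset.∈? lookup T t) then ω t v else 1ᴾ) ⟩
        box-weight t (lookup T t) ∎

-- K stands for w(fᵣ) - r, and e, y, k for fᵢ, w(fᵢ), i counted from 0.
module Shape {K e y k : ℕ} (k≤e : k ≤ e) (e≤y : e ≤ y) (y∸k≤K : y ∸ k ≤ K) where

  private
    λᵢ = K ∸ (e ∸ k)
    μᵢ = K ∸ (y ∸ k)

    -- With `a = e - k`, `d = y - e` and `h = K - (y - k)` all subtractions disappear: `λᵢ` is
    -- `d + h` and `μᵢ` is `h`.
    e+ : ∃ λ a → k + a ≡ e
    e+ = ℕ.m≤n⇒∃[o]m+o≡n k≤e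
    y+ : ∃ λ d → e + d ≡ y
    y+ = ℕ.m≤n⇒∃[o]m+o≡n e≤y
    K+ : ∃ λ h → y ∸ k + h ≡ K
    K+ = ℕ.m≤n⇒∃[o]m+o≡n y∸k≤K

    a = proj₁ e+
    d = proj₁ y+
    h = proj₁ K+

    y∸k : y ∸ k ≡ a + d
    y∸k = trans (cong (_∸ k) (trans (sym (proj₂ y+))
        (trans (cong (_+ d) (sym (proj₂ e+))) (ℕ.+-assoc k a d))))
                (ℕ.m+n∸m≡n k (a + d))

    e∸k : e ∸ k ≡ a
    e∸k = trans (cong (_∸ k) (sym (proj₂ e+))) (ℕ.m+n∸m≡n k a)

    K≡ : K ≡ a + (d + h)
    K≡ = trans (sym (proj₂ K+)) (trans (cong (_+ h) y∸k) (ℕ.+-assoc a d h))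

    λᵢ≡ : λᵢ ≡ d + h
    λᵢ≡ = trans (cong₂ _∸_ K≡ e∸k) (ℕ.m+n∸m≡n a (d + h))

    μᵢ≡ : μᵢ ≡ h
    μᵢ≡ = trans (cong (_∸ (y ∸ k)) (sym (proj₂ K+))) (ℕ.m+n∸m≡n (y ∸ k) h)

  row-length : λᵢ ∸ μᵢ ≡ y ∸ e
  row-length = trans (cong₂ _∸_ λᵢ≡ μᵢ≡) (trans (ℕ.m+n∸n≡m d h)
      (sym (trans (cong (_∸ e) (sym (proj₂ y+))) (ℕ.m+n∸m≡n e d))))

  λ+f : λᵢ + suc e ≡ suc (K + k)
  λ+f = trans (cong₂ (λ l e → l + suc e) λᵢ≡ (sym (proj₂ e+))) (trans
    (solveℕ 4 (λ a d h k → d ⊹ h ⊹ (conℕ 1 ⊹ (k ⊹ a)) ≐ conℕ 1 ⊹ (a ⊹ (d ⊹ h) ⊹ k)) refl a d h k)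
    (cong (λ K → suc (K + k)) (sym K≡)))

  -- Values and labels are counted from 0, so the successors in the flag and in the value cancel,
  -- and the `b`-index of an entry is label minus value, as in `weigh`.
  b-position : ∀ {l c} → l + c ≡ K + k → ∀ v → λᵢ + suc e ∸ (c + suc v) ≡ l ∸ v
  b-position {l} {c} h v = trans
    (cong₂ _∸_ (trans λ+f (cong suc (trans (sym h) (ℕ.+-comm l c)))) (ℕ.+-suc c v))
    (ℕ.[m+n]∸[m+o]≡n∸o c l v)

  -- Box `p` of the row carries the label `y - 1 - p`. Label plus column depends on the row alone,
  -- which translates rows and columns of the diagram into the heap order.
  label+column : ∀ {p} → p < y → (y ∸ suc p) + suc (μᵢ + p) ≡ K + k
  label+column {p} p<y = trans
    (solveℕ 3 (λ l m p → l ⊹ (conℕ 1 ⊹ (m ⊹ p)) ≐ l ⊹ (conℕ 1 ⊹ p) ⊹ m) refl (y ∸ suc p) μᵢ p)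
    (trans (cong₂ _+_ (ℕ.m∸n+n≡m p<y) μᵢ≡)
      (trans (cong (_+ h) (trans (sym (proj₂ y+)) (cong (_+ d) (sym (proj₂ e+)))))
        (trans (solveℕ 4 (λ a d h k → k ⊹ a ⊹ d ⊹ h ≐ a ⊹ (d ⊹ h) ⊹ k) refl a d h k)
            (cong (_+ k) (sym K≡)))))

-- The flagged skew shape of `w` as a heap.

module Tableau (m : ℕ) (w : Permutation′ (suc m)) (avoids : Avoids321 w) where

  r : ℕ
  r = #exc w

  e y : Fin r → Fin (suc m)
  e = List.lookup (excedances w)
  y i = w ⟨$⟩ʳ e i

  exc? : ∀ i → Dec (i Fin.< (w ⟨$⟩ʳ i))
  exc? i = i Fin.<? (w ⟨$⟩ʳ i)

  e<y : ∀ i → e i Fin.< y i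
  e<y i = proj₂ (∈.∈-filter⁻ exc? {xs = allFin (suc m)} (∈.∈-lookup {xs = excedances w} i))

  e-mono : ∀ {i j} → i Fin.< j → e i Fin.< e j
  e-mono = lookup-AllPairs {R = Fin._<_} (AllPairs.filter⁺ exc? sorted)
    where
    sorted : AllPairs Fin._<_ (allFin (suc m))
    sorted = AllPairs.tabulate⁺-< id

  y-mono : ∀ {i j} → i Fin.< j → y i Fin.< y j
  y-mono {i} {j} i<j = excedances-increase w avoids (e<y j) (e-mono i<j)

  shuffle : Shuffle y e w
  shuffle = record
    { on   = λ i → refl
    ; off  = λ {j} j∉ _ j<k → nonexcedances-increase w avoids (ℕ.≮⇒≥ (λ j<wj →
               let j∈ = ∈.∈-filter⁺ exc? (∈.∈-allFin j) j<wj in j∉ (Any.index j∈) (sym (Any.lookup-index j∈)))) j<k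
    ; mono = e-mono
    ; ≤y   = λ i → ℕ.<⇒≤ (e<y i)
    }

  open Tableaux (λ′ w) (μ′ w)
  open SetValued (λ′ w) (μ′ w) (f w) (suc m)

  K : ℕ
  K = wfᵣ w ∸ r

  i≤e : ∀ i → toℕ i ≤ toℕ (e i)
  i≤e i = ℕ.≤-trans (ℕ.m≤n+m (toℕ i) (toℕ (e i₀)))
    (mono-gap e e-mono (toℕ i) {i₀} {i} (cong (_+ toℕ i) (sym (Fin.toℕ-fromℕ< 0<r))))
    where
    0<r : 0 < r
    0<r = ℕ.≤-<-trans z≤n (Fin.toℕ<n i)
    i₀ : Fin r
    i₀ = fromℕ< 0<r

  -- `y i - i` is weakly increasing because `y` is strictly increasing, and `K` is its value in the
  -- last row.
  y∸i≤K : ∀ i → toℕ (y i) ∸ toℕ i ≤ K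
  y∸i≤K i = subst₂ _≤_ (ℕ.[m+n]∸[m+o]≡n∸o d (toℕ (y i)) (toℕ i)) (sym K≡)
    (ℕ.∸-monoˡ-≤ (d + toℕ i) (subst (_≤ toℕ (y l)) (ℕ.+-comm (toℕ (y i)) d)
      (mono-gap y y-mono d {i} {l} (trans (sym d+i) (ℕ.+-comm d (toℕ i))))))
    where
    r-1<r : pred r < r
    r-1<r = ℕ.≤-reflexive (ℕ.suc-pred r {{>-nonZero (ℕ.≤-<-trans z≤n (Fin.toℕ<n i))}})
    l : Fin r
    l = fromℕ< r-1<r
    suc-l : suc (toℕ l) ≡ r
    suc-l = trans (cong suc (Fin.toℕ-fromℕ< r-1<r))
        (ℕ.suc-pred r {{>-nonZero (ℕ.≤-<-trans z≤n (Fin.toℕ<n i))}})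
    d : ℕ
    d = toℕ l ∸ toℕ i
    d+i : d + toℕ i ≡ toℕ l
    d+i = ℕ.m∸n+n≡m (ℕ.≤-pred (subst (toℕ i <_) (sym suc-l) (Fin.toℕ<n i)))
    K≡ : K ≡ toℕ (y l) ∸ (d + toℕ i)
    K≡ = cong₂ _∸_ (cong (maybe′ (λ i → val (w ⟨$⟩ʳ i)) 0) (last-lookup (excedances w) l suc-l))
                   (trans (sym suc-l) (cong suc (sym d+i)))

  module Row (i : Fin r) = Shape (i≤e i) (ℕ.<⇒≤ (e<y i)) (y∸i≤K i)

  p<y : ∀ ((i , p) : Box) → toℕ p < toℕ (y i)
  p<y (i , p) = ℕ.<-≤-trans (Fin.toℕ<n p)
      (ℕ.≤-trans (ℕ.≤-reflexive (Row.row-length i)) (ℕ.m∸n≤m (toℕ (y i)) (toℕ (e i))))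

  labelℕ<y : ∀ ((i , p) : Box) → toℕ (y i) ∸ suc (toℕ p) < toℕ (y i)
  labelℕ<y t@(i , p) = ℕ.∸-monoʳ-< (s≤s z≤n) (p<y t)

  label<m : ∀ ((i , p) : Box) → toℕ (y i) ∸ suc (toℕ p) < m
  label<m t@(i , p) = ℕ.<-≤-trans (labelℕ<y t) (ℕ.≤-pred (Fin.toℕ<n (y i)))

  label : Box → Fin m
  label t = fromℕ< (label<m t)

  toℕ-label : ∀ ((i , p) : Box) → toℕ (label (i , p)) ≡ toℕ (y i) ∸ suc (toℕ p)
  toℕ-label t = Fin.toℕ-fromℕ< (label<m t)

  label+col : ∀ t → toℕ (label t) + col t ≡ K + toℕ (row t)
  label+col t@(i , p) = trans (cong (_+ col t) (toℕ-label t)) (Row.label+column i (p<y t))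

  e≤label : ∀ t → toℕ (e (row t)) ≤ toℕ (label t)
  e≤label t@(i , p) = subst (toℕ (e i) ≤_) (sym (toℕ-label t)) (subst (_≤ toℕ (y i) ∸ suc (toℕ p))
    (ℕ.m∸[m∸n]≡n (ℕ.<⇒≤ (e<y i)))
    (ℕ.∸-monoʳ-≤ (toℕ (y i)) (ℕ.<-≤-trans (Fin.toℕ<n p) (ℕ.≤-reflexive (Row.row-length i)))))

  rowBoxes : Fin r → List Box
  rowBoxes i = map (i ,_) (allFin (λ′ w i ∸ μ′ w i))

  ∈-boxes : ∀ t → t ∈ boxes
  ∈-boxes (i , p) = ∈.∈-concatMap⁺ rowBoxes
      (Any.map (λ { refl → ∈.∈-map⁺ (i ,_) (∈.∈-allFin p) }) (∈.∈-allFin i))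

  boxes-unique : Unique boxes
  boxes-unique = Unique.concat⁺
    (All.map⁺ (All.universal (λ i → Unique.map⁺ (λ { refl → refl }) (Unique.allFin⁺ _)) (allFin r)))
    (AllPairs.map⁺ (AllPairs.map disjoint (Unique.allFin⁺ r)))
    where
    disjoint : ∀ {i j} → i ≢ j → ∀ {t} → ¬ (t ∈ rowBoxes i × t ∈ rowBoxes j)
    disjoint {i} {j} i≢j (h , h′)
      with (_ , _ , refl) ← ∈.∈-map⁻ (i ,_) h | (_ , _ , refl) ← ∈.∈-map⁻ (j ,_) h′ = i≢j refl

  label-injective : ∀ {t u} → row t ≡ row u → label t ≡ label u → t ≡ u
  label-injective {t@(i , p)} {u@(.i , p′)} refl h = cong (i ,_) (Fin.toℕ-injective (ℕ.suc-injective
    (ℕ.∸-cancelˡ-≡ (p<y t) (p<y u) (trans (sym (toℕ-label t)) (trans (cong toℕ h) (toℕ-label u))))))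

  boxAt : ∀ i (k : Fin m) → toℕ (e i) ≤ toℕ k → toℕ k < toℕ (y i) → ∃ λ t →
      row (box t) ≡ i × label (box t) ≡ k
  boxAt i k e≤k k<y = Any.index t∈ , cong row found , trans (cong label found) label≡
    where
    p< : toℕ (y i) ∸ suc (toℕ k) < λ′ w i ∸ μ′ w i
    p< = subst (toℕ (y i) ∸ suc (toℕ k) <_) (sym (Row.row-length i)) (ℕ.∸-monoʳ-< (s≤s e≤k) k<y)
    t : Box
    t = i , fromℕ< p<
    t∈ : t ∈ boxes
    t∈ = ∈-boxes t
    found : box (Any.index t∈) ≡ t
    found = sym (Any.lookup-index t∈)
    label≡ : label t ≡ k
    label≡ = Fin.toℕ-injective (trans (toℕ-label t) (trans
      (cong (λ p → toℕ (y i) ∸ suc p) (Fin.toℕ-fromℕ< p<))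
      (trans (cong (toℕ (y i) ∸_) (sym (ℕ.+-∸-assoc 1 k<y))) (ℕ.m∸[m∸n]≡n (ℕ.<⇒≤ k<y)))))

  heap : Heap m r size
  heap = record
    { y      = y
    ; f₀     = e
    ; y-mono = y-mono
    ; rowᴴ   = row ∘ box
    ; lab    = label ∘ box
    ; box-≡  = λ h h′ → lookup-unique boxes-unique (label-injective h h′)
    ; box-at = boxAt
    ; lab<y  = λ t → subst (_< toℕ (y (row (box t)))) (sym (toℕ-label (box t))) (labelℕ<y (box t))
    }

  open HeapExpansion heap
  open Coefficients m
  open Cardinality {suc m}

  lab : Fin size → Fin m
  lab = label ∘ box

  ω : Fin size → Fin (suc m) → Poly (suc m)
  ω t v = weigh x B (v , lab t)

  open Weights {suc m} {suc m} {size} ω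

  row-order : ∀ t u → row (box t) ≡ row (box u) → col (box t) < col (box u) → lab u Fin.< lab t
  row-order t u r≡ c< = ℕ.≰⇒> λ t≤u → ℕ.<⇒≢ (ℕ.+-mono-≤-< t≤u c<)
    (trans (label+col (box t)) (trans (cong (λ i → K + toℕ i) r≡) (sym (label+col (box u)))))

  row-order⁻ : ∀ t u → row (box t) ≡ row (box u) → lab u Fin.< lab t → col (box t) < col (box u)
  row-order⁻ t u r≡ l< = ℕ.≰⇒> λ u≤t → ℕ.<⇒≢ (ℕ.+-mono-<-≤ l< u≤t)
    (trans (label+col (box u)) (trans (cong (λ i → K + toℕ i) (sym r≡)) (sym (label+col (box t)))))

  column-order : ∀ t u → col (box t) ≡ col (box u) →
                 toℕ (lab t) + toℕ (row (box u)) ≡ toℕ (lab u) + toℕ (row (box t))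
  column-order t u c≡ = ℕ.+-cancelˡ-≡ (K + col (box t)) _ _ (trans
    (solveℕ 4 (λ K c l i → K ⊹ c ⊹ (l ⊹ i) ≐ (l ⊹ c) ⊹ (K ⊹ i)) refl K (col (box t)) (toℕ (lab t))
        (toℕ (row (box u))))
    (trans (cong₂ _+_ (label+col (box t))
        (trans (sym (label+col (box u))) (cong (toℕ (lab u) +_) (sym c≡))))
      (solveℕ 4 (λ K c l i → (K ⊹ i) ⊹ (l ⊹ c) ≐ K ⊹ c ⊹ (l ⊹ i)) refl K (col (box t)) (toℕ (lab u))
          (toℕ (row (box t))))))

  column-order⁻ : ∀ t u → toℕ (lab t) + toℕ (row (box u)) ≡ toℕ (lab u) + toℕ (row (box t)) →
                  col (box t) ≡ col (box u)
  column-order⁻ t u h = ℕ.+-cancelˡ-≡ (toℕ (lab t) + (K + toℕ (row (box u)))) _ _ (trans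
    (solveℕ 4 (λ K c l i → l ⊹ (K ⊹ i) ⊹ c ≐ (l ⊹ c) ⊹ (K ⊹ i)) refl K (col (box t)) (toℕ (lab t))
        (toℕ (row (box u))))
    (trans (cong₂ _+_ (label+col (box t)) (sym (label+col (box u))))
      (trans (solveℕ 4 (λ K c l i → (K ⊹ i) ⊹ (l ⊹ c) ≐ (l ⊹ i) ⊹ (K ⊹ c)) refl K (col (box u))
          (toℕ (lab u)) (toℕ (row (box t))))
        (trans (cong (_+ (K + col (box u))) (sym h))
          (solveℕ 4 (λ K c l i → (l ⊹ i) ⊹ (K ⊹ c) ≐ l ⊹ (K ⊹ i) ⊹ c) refl K (col (box u))
              (toℕ (lab t)) (toℕ (row (box u))))))))

  SVT⇒valid : ∀ {T} → IsSVT T → Valid (positions m) e T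
  SVT⇒valid {T} (nonempty , rows , columns , flags) = record
    { support⁺ = λ t _ → nonempty t
    ; support⁻ = λ {t} _ → e≤label (box t)
    ; order    = order
    ; allowed  = λ {t} {v} h → ∈-positions⁺ m (ℕ.≤-trans (ℕ.≤-pred (flags t v h)) (e≤label (box t)))
    }
    where
    order : ∀ {t u a c} → t ≺ u → a ∈ˢ lookup T t → c ∈ˢ lookup T u → (a , lab t) ⊏ (c , lab u)
    order {t} {u} (inj₁ (r≡ , l<)) a∈ c∈ =
      ⊏-row⁺ l< (max≤min⁻ {A = lookup T t} {lookup T u} (rows t u r≡ (row-order⁻ t u r≡ l<)) a∈ c∈)
    order {t} {u} (inj₂ (r< , l≡)) a∈ c∈ =
      inj₁ (max<min⁻ {A = lookup T t} {lookup T u} (columns t u (column-order⁻ t u l≡) r<) a∈ c∈)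

  valid⇒SVT : ∀ {T} → Valid (positions m) e T → IsSVT T
  valid⇒SVT {T} V = nonempty , rows , columns , flags
    where
    open Valid V

    nonempty : ∀ t → Nonempty (lookup T t)
    nonempty t = support⁺ t (e≤label (box t))

    rows : ∀ t u → row (box t) ≡ row (box u) → col (box t) < col (box u) →
        maximum (lookup T t) ≤ minimum (lookup T u)
    rows t u r≡ c< = max≤min⁺ {A = lookup T t} {lookup T u} λ a∈ c∈ →
      ⊏-row⁻ (order (inj₁ (r≡ , row-order t u r≡ c<)) a∈ c∈)

    columns : ∀ t u → col (box t) ≡ col (box u) → row (box t) Fin.< row (box u) →
        maximum (lookup T t) < minimum (lookup T u)
    columns t u c≡ r< = max<min⁺ {A = lookup T t} {lookup T u} λ a∈ c∈ →
      ⊏-column⁻ lab< (order (inj₂ (r< , column-order t u c≡)) a∈ c∈)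
      where
      lab< : lab t Fin.< lab u
      lab< = ℕ.≰⇒> λ u≤t → ℕ.<⇒≢ (ℕ.+-mono-≤-< u≤t r<) (sym (column-order t u c≡))

    flags : ∀ t v → v ∈ˢ lookup T t → val v ≤ f w (row (box t))
    -- Membership in `positions` bounds `v` only by the label of its box. The last box of the row
    -- has the label `e i`, so its entries are at most `e i`, and `v` is at most these by the row
    -- order.
    flags t v v∈ = s≤s (v≤e (ℕ.m≤n⇒m<n∨m≡n (e≤label (box t))))
      where
      i : Fin r
      i = row (box t)
      e<m : toℕ (e i) < m
      e<m = ℕ.<-≤-trans (e<y i) (ℕ.≤-pred (Fin.toℕ<n (y i)))
      toℕ-k : toℕ (fromℕ< e<m) ≡ toℕ (e i)
      toℕ-k = Fin.toℕ-fromℕ< e<m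
      v≤e : toℕ (e i) < toℕ (lab t) ⊎ toℕ (e i) ≡ toℕ (lab t) → toℕ v ≤ toℕ (e i)
      v≤e (inj₂ h) = subst (toℕ v ≤_) (sym h) (∈-positions⁻ m (allowed v∈))
      v≤e (inj₁ h) = ℕ.≤-trans
        (⊏-row⁻ (order {t} {u} (inj₁ (sym r≡ , subst (_< toℕ (lab t)) (sym lab≡) h)) v∈ c∈))
        (subst (toℕ (proj₁ (nonempty u)) ≤_) lab≡ (∈-positions⁻ m (allowed c∈)))
        where
        found : ∃ λ u → row (box u) ≡ i × lab u ≡ fromℕ< e<m
        found = boxAt i (fromℕ< e<m) (ℕ.≤-reflexive (sym toℕ-k))
            (subst (_< toℕ (y i)) (sym toℕ-k) (e<y i))
        u : Fin size
        u = proj₁ found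
        r≡ : row (box u) ≡ i
        r≡ = proj₁ (proj₂ found)
        lab≡ : toℕ (lab u) ≡ toℕ (e i)
        lab≡ = trans (cong toℕ (proj₂ (proj₂ found))) toℕ-k
        c∈ : proj₁ (nonempty u) ∈ˢ lookup T u
        c∈ = proj₂ (nonempty u)

  entry-weight : Box × Fin (suc m) → Poly (suc m)
  entry-weight en = x (proj₂ en) ⊕ b (b-index w en)

  toℕ-b-index : ∀ t v → toℕ (b-index w (t , v)) ≡ toℕ (label t) ∸ toℕ v
  toℕ-b-index t v = trans (Fin.toℕ-fromℕ< (b-index<n w t v))
      (Row.b-position (row t) (label+col t) (toℕ v))

  entry-weight≡ : ∀ t v → entry-weight (t , v) ≡ weigh x B (v , label t)
  entry-weight≡ t v = cong (λ j → x v ⊕ b j) (Fin.toℕ-injective (trans (toℕ-b-index t v)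
    (sym (toℕ-clamp (ℕ.≤-trans (ℕ.m∸n≤m (toℕ (label t)) (toℕ v)) (ℕ.<⇒≤ (Fin.toℕ<n (label t))))))))

  SVT! : Unique SVT
  SVT! = SVT-unique (λ′ w) (μ′ w) (f w) (suc m)

  ∈SVT⁺ : ∀ {T} → IsSVT T → T ∈ SVT
  ∈SVT⁺ = ∈-SVT⁺ (λ′ w) (μ′ w) (f w) (suc m)

  ∈SVT⁻ : ∀ {T} → T ∈ SVT → IsSVT T
  ∈SVT⁻ = ∈-SVT⁻ (λ′ w) (μ′ w) (f w) (suc m)

  tableau-formula : 𝔊 w ≈ᴾ ∑ SVT (λ T →
      β ^ᴾ (length (entries T) ∸ size) *ᴾ ∏ (entries T) entry-weight)
  tableau-formula = begin
    𝔊 w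
      ≈⟨ 𝔊-by-coefficient (choices w) ⟩
    coefficient (HeckeWords.stair m x B) w
      ≡⟨ cong (λ L → coefficient L w) (stair-positions m x B) ⟩
    coefficient (map (factor x B) (positions m)) w
      ≈⟨ expands ⟩
    ∑ fillings weight
      ≈⟨ +-Big.⨀-↭ weight (unique-↭ unique SVT! (∈SVT⁺ ∘ valid⇒SVT ∘ sound)
          (complete ∘ SVT⇒valid ∘ ∈SVT⁻)) ⟩
    ∑ SVT weight
      ≈⟨ +-Big.⨀-cong SVT (λ {T} T∈ → *-cong
           (≡⇒≈ (cong (β ^ᴾ_) (length-entries (λ′ w) (μ′ w) (f w) (suc m) ω T (proj₁ (∈SVT⁻ T∈)))))
               (∏-entries (λ′ w) (μ′ w) (f w) (suc m) ω entry-weight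
               (λ t → entry-weight≡ (box t)) T)) ⟨
    ∑ SVT (λ T → β ^ᴾ (length (entries T) ∸ size) *ᴾ ∏ (entries T) entry-weight) ∎
    where
    open ≈-Reasoning
    open Expansion (expansion (positions m) (positions-sorted m) shuffle (λ i → ℕ.≤-refl))

theorem3p1 : ∀ (m : ℕ) (w : Permutation′ (suc m)) → Avoids321 w →
  let open Tableaux (λ′ w) (μ′ w)
      open SetValued (λ′ w) (μ′ w) (f w) (suc m)
  in 𝔊 w ≈ᴾ ∑ SVT (λ T → β ^ᴾ (length (entries T) ∸ size)
                         *ᴾ ∏ (entries T) (λ e → x (proj₂ e) ⊕ b (b-index w e)))
theorem3p1 m w avoids = Tableau.tableau-formula m w avoids
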